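{- Let $q$ be a prime power and $n\geq 3$. Let $L$ be a maximum scattered $\mathbb{F}_q$-linear set of $\Lambda=PG(3,q^n)$ having at least two lines of pseudoregulus type. Then $L$ is projectively equivalent (under $P\Gamma L(4,q^n)$) to $$L_{s,t}=\{\langle (x,x^{q^s},y,y^{q^t})\rangle : x,y\in\mathbb{F}_{q^n},\ (x,y)\neq(0,0)\}$$ for some $s,t\in\{1,\dots,n-1\}$ with $\gcd(s,n)=\gcd(t,n)=1$. Moreover, $L_{s,t}$ is of pseudoregulus type if and only if either $s=t$ or $s=n-t$. On the other hand, if $s\neq t$ and $s\neq n-t$, then $n\geq 5$ and the only long lines of $L_{s,t}$ are the two lines $X_2=X_3=0$ and $X_0=X_1=0$.
   Context: Let $V$ be a vector space over $\mathbb{F}_{q^n}$ and $\Lambda=PG(V,\mathbb{F}_{q^n})$. An $\mathbb{F}_q$-linear set of $\Lambda$ is a set $L_U=\{\langle \mathbf{u}\rangle_{\mathbb{F}_{q^n}} : \mathbf{u}\in U\setminus\{\mathbf{0}\}\}$ where $U$ is an $\mathbb{F}_q$-subspace of $V$; its rank is $\dim_{\mathbb{F}_q}U$. For a subspace $\Omega=PG(W,\mathbb{F}_{q^n})$, the weight of $\Omega$ in $L_U$ is $\dim_{\mathbb{F}_q}(W\cap U)$. $L_U$ is scattered if every point has weight $1$ in $L_U$; a scattered $\mathbb{F}_q$-linear set of $PG(r-1,q^n)$ is maximum scattered if its rank is $rn/2$ (so rank $2n$ in $PG(3,q^n)$). If $L$ is a scattered $\mathbb{F}_q$-linear set, a line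 of weight $n$ in $L$ is a long line of $L$. A scattered $\mathbb{F}_q$-linear set $L$ of $PG(3,q^n)$ of rank $2n$ is of pseudoregulus type if (i) there exist $q^n+1$ pairwise disjoint long lines $s_1,\dots,s_{q^n+1}$ of $L$, and (ii) there exist exactly two lines $T_1,T_2$ of $PG(3,q^n)$ disjoint from $L$ such that $T_j\cap s_i\neq\emptyset$ for all $i$ and $j=1,2$. On the projective line $PG(1,q^n)=PG(V,\mathbb{F}_{q^n})$, an $\mathbb{F}_q$-linear set is of pseudoregulus type if it equals $\{\langle\lambda\mathbf{w}+\rho\lambda^{\tau}\mathbf{v}\rangle:\lambda\in\mathbb{F}_{q^n}^*\}$ for some linearly independent $\mathbf{w},\mathbf{v}\in V$, some $\rho\in\mathbb{F}_{q^n}^*$ and some automorphism $\tau$ of $\mathbb{F}_{q^n}$ with fixed field $\mathbb{F}_q$. If $L$ is an $\mathbb{F}_q$-linear set of $PG(3,q^n)$, a line $r$ is of pseudoregulus type (with respect to $L$) if $L\cap r$ is an $\mathbb{F}_q$-linear set of pseudoregulus type of the line $r$. -}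

module Defs where

open import Data.Nat using (ℕ; zero; suc; _≤_; _<_; _^_) renaming (_*_ to _*ℕ_)
open import Data.Nat.Primality using (Prime)
open import Data.Nat.GCD using (gcd)
open import Data.Fin using (Fin) renaming (zero to fzero; suc to fsuc)
open import Data.List using (List)
open import Data.List.Membership.Propositional using (_∈_)
open import Data.List.Relation.Unary.Unique.Propositional using (Unique)
open import Data.Product using (Σ; Σ-syntax; _×_; _,_)
open import Data.Sum using (_⊎_)
open import Relation.Nullary using (¬_)
open import Relation.Binary.PropositionalEquality using (_≡_; _≢_)
open import Relation.Binary.Definitions using (DecidableEquality)
open import Algebra.Structures using (IsCommutativeRing)
open import Function using (_∘_; Injective; Surjective)

Iff : ∀ {a b} → Set a → Set b → Set _
Iff A B = (A → B) × (B → A)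

IsPrimePower : ℕ → Set
IsPrimePower q = Σ[ p ∈ ℕ ] Σ[ k ∈ ℕ ] (Prime p × 1 ≤ k × q ≡ p ^ k)

record FiniteField : Set₁ where
  field
    Carrier  : Set
    _+_      : Carrier → Carrier → Carrier
    _*_      : Carrier → Carrier → Carrier
    -_       : Carrier → Carrier
    0#       : Carrier
    1#       : Carrier
    isCommutativeRing : IsCommutativeRing _≡_ _+_ _*_ -_ 0# 1#
    inv      : Carrier → Carrier
    inv-r    : ∀ x → x ≢ 0# → x * inv x ≡ 1#
    0≢1      : 0# ≢ 1#
    _≟_      : DecidableEquality Carrier
    elems    : List Carrier
    complete : ∀ x → x ∈ elems
    unique   : Unique elems

-- Geometry of PG(3, q^n) = PG(F^4, F) where F = F_{q^n};
-- F_q is the subfield { x | x^q = x }.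
module Geometry (F : FiniteField) (q n : ℕ) where
  open FiniteField F

  pow : Carrier → ℕ → Carrier
  pow x zero    = 1#
  pow x (suc k) = x * pow x k

  InFq : Carrier → Set
  InFq x = pow x q ≡ x

  IsFieldAut : (Carrier → Carrier) → Set
  IsFieldAut σ = (∀ x y → σ (x + y) ≡ σ x + σ y)
               × (∀ x y → σ (x * y) ≡ σ x * σ y)
               × Injective _≡_ _≡_ σ × Surjective _≡_ _≡_ σ

  IsAutFixingFq : (Carrier → Carrier) → Set
  IsAutFixingFq τ = IsFieldAut τ × (∀ x → Iff (τ x ≡ x) (InFq x))

  record V4 : Set where
    constructor ⟨_,_,_,_⟩
    field
      c0 c1 c2 c3 : Carrier
  open V4 public

  𝟎 : V4
  𝟎 = ⟨ 0# , 0# , 0# , 0# ⟩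

  _⊕_ : V4 → V4 → V4
  u ⊕ v = ⟨ c0 u + c0 v , c1 u + c1 v , c2 u + c2 v , c3 u + c3 v ⟩

  _·_ : Carrier → V4 → V4
  a · v = ⟨ a * c0 v , a * c1 v , a * c2 v , a * c3 v ⟩

  Pred : Set₁
  Pred = V4 → Set

  _∩_ : Pred → Pred → Pred
  (S ∩ T) v = S v × T v

  IsFqSubspace : Pred → Set
  IsFqSubspace U = U 𝟎 × (∀ u v → U u → U v → U (u ⊕ v))
                 × (∀ c u → InFq c → U u → U (c · u))

  lincomb : ∀ {k} → (Fin k → Carrier) → (Fin k → V4) → V4
  lincomb {zero}  c b = 𝟎
  lincomb {suc k} c b = (c fzero · b fzero) ⊕ lincomb (c ∘ fsuc) (b ∘ fsuc)

  HasDimFq : Pred → ℕ → Set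
  HasDimFq S k =
    Σ[ b ∈ (Fin k → V4) ]
      (∀ i → S (b i))
    × (∀ c → (∀ i → InFq (c i)) → lincomb c b ≡ 𝟎 → ∀ i → c i ≡ 0#)
    × (∀ v → S v → Σ[ c ∈ (Fin k → Carrier) ] ((∀ i → InFq (c i)) × v ≡ lincomb c b))

  Fspan : V4 → Pred
  Fspan u v = Σ[ a ∈ Carrier ] v ≡ a · u

  -- the nonzero vector v represents a point of L_U
  PointOf : Pred → V4 → Set
  PointOf U v = Σ[ u ∈ V4 ] (U u × u ≢ 𝟎 × Fspan u v)

  Scattered : Pred → Set
  Scattered U = ∀ u → U u → u ≢ 𝟎 → HasDimFq (Fspan u ∩ U) 1

  MaxScattered : Pred → Set
  MaxScattered U = IsFqSubspace U × HasDimFq U (2 *ℕ n) × Scattered U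

  record Line : Set where
    field
      a b   : V4
      indep : ∀ α β → (α · a) ⊕ (β · b) ≡ 𝟎 → (α ≡ 0# × β ≡ 0#)

  onLine : Line → Pred
  onLine ℓ v = Σ[ α ∈ Carrier ] Σ[ β ∈ Carrier ] v ≡ (α · Line.a ℓ) ⊕ (β · Line.b ℓ)

  SameLine : Line → Line → Set
  SameLine ℓ m = ∀ v → Iff (onLine ℓ v) (onLine m v)

  Meet : Line → Line → Set
  Meet ℓ m = Σ[ v ∈ V4 ] (v ≢ 𝟎 × onLine ℓ v × onLine m v)

  DisjointFromL : Pred → Line → Set
  DisjointFromL U ℓ = ∀ v → onLine ℓ v → U v → v ≡ 𝟎

  LongLine : Pred → Line → Set
  LongLine U ℓ = HasDimFq (onLine ℓ ∩ U) n

  PseudoregulusLine : Pred → Line → Set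
  PseudoregulusLine U r =
    Σ[ w ∈ V4 ] Σ[ v ∈ V4 ] Σ[ ρ ∈ Carrier ] Σ[ τ ∈ (Carrier → Carrier) ]
      ( onLine r w × onLine r v
      × (∀ α β → (α · w) ⊕ (β · v) ≡ 𝟎 → (α ≡ 0# × β ≡ 0#))
      × ρ ≢ 0# × IsAutFixingFq τ
      × (∀ x → onLine r x → x ≢ 𝟎 →
           Iff (PointOf U x)
               (Σ[ λ' ∈ Carrier ] (λ' ≢ 0# ×
                  Σ[ μ ∈ Carrier ] x ≡ μ · ((λ' · w) ⊕ ((ρ * τ λ') · v))))))

  PseudoregulusType : Pred → Set
  PseudoregulusType U =
    IsFqSubspace U × Scattered U × HasDimFq U (2 *ℕ n)
    × Σ[ s ∈ (Fin (suc (q ^ n)) → Line) ]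
        ( (∀ i → LongLine U (s i))
        × (∀ i j → i ≢ j → ¬ Meet (s i) (s j))
        × Σ[ T₁ ∈ Line ] Σ[ T₂ ∈ Line ]
            let Good = λ T → DisjointFromL U T × (∀ i → Meet T (s i)) in
            ( ¬ SameLine T₁ T₂ × Good T₁ × Good T₂
            × (∀ T → Good T → SameLine T T₁ ⊎ SameLine T T₂)))

  HasTwoPseudoregulusLines : Pred → Set
  HasTwoPseudoregulusLines U =
    Σ[ r₁ ∈ Line ] Σ[ r₂ ∈ Line ]
      (¬ SameLine r₁ r₂ × PseudoregulusLine U r₁ × PseudoregulusLine U r₂)

  IsCollineation : (V4 → V4) → Set
  IsCollineation f = Σ[ σ ∈ (Carrier → Carrier) ]
      ( IsFieldAut σ
      × (∀ u v → f (u ⊕ v) ≡ f u ⊕ f v)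
      × (∀ a u → f (a · u) ≡ σ a · f u)
      × Injective _≡_ _≡_ f × Surjective _≡_ _≡_ f)

  ProjEquiv : Pred → Pred → Set
  ProjEquiv U U' = Σ[ f ∈ (V4 → V4) ]
      (IsCollineation f × (∀ v → v ≢ 𝟎 → Iff (PointOf U v) (PointOf U' (f v))))

  Ust : ℕ → ℕ → Pred
  Ust s t v = Σ[ x ∈ Carrier ] Σ[ y ∈ Carrier ]
                v ≡ ⟨ x , pow x (q ^ s) , y , pow y (q ^ t) ⟩

  Admissible : ℕ → Set
  Admissible s = 1 ≤ s × s < n × gcd s n ≡ 1

  IsLineX2X3 : Line → Set
  IsLineX2X3 ℓ = ∀ v → Iff (onLine ℓ v) (c2 v ≡ 0# × c3 v ≡ 0#)

  IsLineX0X1 : Line → Set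
  IsLineX0X1 ℓ = ∀ v → Iff (onLine ℓ v) (c0 v ≡ 0# × c1 v ≡ 0#)

  OnlyLongLinesAreAxes : Pred → Set
  OnlyLongLinesAreAxes U =
    (Σ[ ℓ ∈ Line ] (IsLineX2X3 ℓ × LongLine U ℓ))
    × (Σ[ ℓ ∈ Line ] (IsLineX0X1 ℓ × LongLine U ℓ))
    × (∀ ℓ → LongLine U ℓ → IsLineX2X3 ℓ ⊎ IsLineX0X1 ℓ)

{-# OPTIONS --safe #-}

-- Counting shows that two distinct lines of weight n of a scattered linear set of rank 2n cannot meet. A line of
-- pseudoregulus type has weight n, and U ∩ r is the graph of an F_q-linear map f = Σ aᵢ x^(q^i) for which f(x)/x runs
-- through the same values as ρ τ(x)/x. Hence, for J a nonempty proper subset of {0, …, n-1}, the sum over x ≠ 0 of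
-- (f(x)/x)^(Σ_{j ∈ J} q^j) vanishes. Take for J the vertices of a shortest closed walk in ℤ/n with steps in {i : aᵢ ≠ 0}:
-- if J were proper, the absence of chords would leave exactly one term in the expansion of this sum. So every such walk
-- has length at least n, which forces f = a x^(q^s) with gcd(s, n) = 1. Two such lines are disjoint and give coordinates
-- in which L = L_{s,t}.
--
-- A long line of L_{s,t} other than the axes X₂ = X₃ = 0 and X₀ = X₁ = 0 misses both, hence is the graph of a linear map
-- between them; comparing coefficients of x^(q^i) gives s = t or s = n - t. In these cases the long lines through the
-- points (1, 0, b, 0) and (0, 1, 0, b^(q^s)) form the pseudoregulus, up to exchanging the last two coordinates.
module Submission where

open import Defs
open import Algebra.Bundles using (CommutativeRing; CommutativeMonoid)
import Algebra.Properties.CommutativeMonoid.Sum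
import Algebra.Properties.CommutativeSemiring.Binomial
import Algebra.Properties.Ring
import Algebra.Properties.Semiring.Exp
import Algebra.Properties.Semiring.Mult
import Algebra.Properties.Semiring.Mult.TCOptimised
import Algebra.Properties.Semiring.Sum
import Algebra.Solver.Ring
open import Algebra.Solver.Ring.AlmostCommutativeRing using (fromCommutativeRing; _-Raw-AlmostCommutative⟶_)
open import Data.Empty using (⊥; ⊥-elim)
open import Data.Fin as Fin using (Fin; zero; suc; toℕ; fromℕ; inject₁)
import Data.Fin.Properties as Finₚ
open import Data.Fin.Relation.Unary.Top using (view; ‵fromℕ; ‵inject₁)
open import Data.Integer as ℤ using (ℤ; -[1+_]) renaming (+_ to pos)
import Data.Integer.Properties as ℤₚ
open import Data.List as List using (List; []; _∷_; length; filter; _++_; take; drop; replicate)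
open import Data.List.Membership.Propositional using (_∈_)
open import Data.List.Membership.Propositional.Properties using (∈-lookup; ∈-filter⁺; ∈-filter⁻)
import Data.List.Properties as Listₚ
open import Data.List.Relation.Unary.All as All using (All; []; _∷_)
import Data.List.Relation.Unary.All.Properties as Allₚ
open import Data.List.Relation.Unary.AllPairs using (_∷_)
open import Data.List.Relation.Unary.Any as Any using (Any)
open import Data.List.Relation.Unary.Any.Properties using (lookup-index)
open import Data.List.Relation.Unary.Unique.Propositional using (Unique)
open import Data.List.Relation.Unary.Unique.Propositional.Properties using (filter⁺)
open import Data.Maybe using (Maybe; just; nothing)
open import Data.Nat as ℕ using (ℕ; zero; suc; NonZero; s≤s; z≤n; _≤_; _<_; _^_; _∸_)
open import Data.Nat.Base using (_!; nonTrivial⇒n>1)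
open import Data.Nat.Combinatorics using (nCn≡1; k![n∸k]!∣n!) renaming (_C_ to _choose_)
open import Data.Nat.Combinatorics.Specification using (nCk≡n!/k![n-k]!)
open import Data.Nat.DivMod
open import Data.Nat.Divisibility as ∣ using (_∣_; _∤_; divides; ∣⇒≤)
open import Data.Nat.GCD using (gcd; gcd[m,n]∣m; gcd[m,n]∣n; gcd[m,n]≡0⇒n≡0; gcd-GCD; module Bézout)
open import Data.Nat.Induction using (<-wellFounded)
open import Data.Nat.ListAction using () renaming (sum to sumℕ)
open import Data.Nat.Primality using (Prime; euclidsLemma; prime⇒nonTrivial)
import Data.Nat.Properties as ℕₚ
open import Data.Nat.Solver using (module +-*-Solver)
open import Data.Product using (Σ-syntax; ∃; _×_; _,_; proj₁; proj₂)
open import Data.Product.Function.NonDependent.Propositional using (_×-↔_)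
open import Data.Sum using (_⊎_; inj₁; inj₂; [_,_]′)
open import Data.Vec as Vec using (Vec; []; _∷_)
import Data.Vec.Properties as Vecₚ
open import Function using (_∘_; _↔_; Inverse; mk↔ₛ′)
open import Function.Construct.Composition using (_↔-∘_)
open import Function.Construct.Identity using (↔-id)
open import Function.Construct.Symmetry using (↔-sym)
open import Induction.WellFounded using (Acc; acc)
open import Relation.Binary.Definitions using (tri<; tri≈; tri>)
open import Relation.Binary.PropositionalEquality
open import Relation.Nullary using (¬_; Dec; yes; no; contradiction)
open import Relation.Nullary.Decidable using (¬?; map′; decidable-stable; _×-dec_)

-- The points of a line of pseudoregulus type determine neither U ∩ r nor τ: for every s prime to n
-- the quotients x^(q^s) / x run through exactly the elements of norm 1. So f cannot be compared
-- with τ directly, and only sums of functions of f(x)/x are available. The exponents Σ_{j ∈ J} q^j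
-- are those for which such sums can be read: modulo q^n - 1 every carry in base q lowers the digit
-- sum, so a product of |J| Frobenius powers of x equals the monomial of J only if its exponents are
-- those of J. The set J has to be proper, since J = {0, ..., n-1} yields the norm of f(x)/x, whose
-- sum over x ≠ 0 is not zero. The bound n ≥ 3 is what keeps two long lines from meeting: the count
-- gives q^(4n) ≤ q^(3n+2), that is n ≤ 2. Bases, inverse maps and preimages come from a single
-- principle, that an injection between finite sets of equal size is onto; it stands in for
-- determinants and Galois theory.

-- Finite sets: searching and counting

↔-injective : {A B : Set} (e : A ↔ B) → ∀ {x y} → Inverse.to e x ≡ Inverse.to e y → x ≡ y
↔-injective e {x} {y} eq = trans (sym (strictlyInverseʳ x)) (trans (cong from eq) (strictlyInverseʳ y))
  where open Inverse e

opaque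
  ∃? : ∀ {A : Set} {m} → A ↔ Fin m → {P : A → Set} → (∀ x → Dec (P x)) → Dec (∃ P)
  ∃? card {P} P? with Finₚ.any? (P? ∘ Inverse.from card)
  ... | yes (i , p) = yes (Inverse.from card i , p)
  ... | no ¬p = no λ (x , p) → ¬p (Inverse.to card x , subst P (sym (Inverse.strictlyInverseʳ card x)) p)

  injective⇒card≤ : ∀ {A B : Set} {m k} → A ↔ Fin m → B ↔ Fin k → (f : A → B) → (∀ {x y} → f x ≡ f y → x ≡ y) → m ℕ.≤ k
  injective⇒card≤ cardA cardB f inj = Finₚ.injective⇒≤ {f = Inverse.to cardB ∘ f ∘ Inverse.from cardA}
    (↔-injective (↔-sym cardA) ∘ inj ∘ ↔-injective cardB)

  -- A missed value `y` would extend `f` to an injection of `Fin (suc m)` into `Fin m`, with `zero`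
  -- sent to `y`.
  injective⇒surjective : ∀ {A B : Set} {m} → A ↔ Fin m → B ↔ Fin m → (f : A → B) → (∀ {x y} → f x ≡ f y → x ≡ y) →
                         ∀ y → Σ[ x ∈ A ] f x ≡ y
  injective⇒surjective {m = m} cardA cardB f inj y
    with Finₚ.any? (λ i → Inverse.to cardB (f (Inverse.from cardA i)) Finₚ.≟ Inverse.to cardB y)
  ... | yes (i , eq) = Inverse.from cardA i , ↔-injective cardB eq
  ... | no ¬hit = contradiction (Finₚ.injective⇒≤ {f = g} g-injective) (ℕₚ.<⇒≱ ℕₚ.≤-refl)
    where
    g : Fin (suc m) → Fin m
    g zero = Inverse.to cardB y
    g (suc i) = Inverse.to cardB (f (Inverse.from cardA i))
    g-injective : ∀ {i j} → g i ≡ g j → i ≡ j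
    g-injective {zero} {zero} _ = refl
    g-injective {zero} {suc j} eq = contradiction (j , sym eq) ¬hit
    g-injective {suc i} {zero} eq = contradiction (i , eq) ¬hit
    g-injective {suc i} {suc j} eq = cong suc (↔-injective (↔-sym cardA) (inj (↔-injective cardB eq)))

×-card : ∀ {A B : Set} {m k} → A ↔ Fin m → B ↔ Fin k → (A × B) ↔ Fin (m ℕ.* k)
×-card a b = ↔-sym Finₚ.*↔× ↔-∘ (a ×-↔ b)

Vec-card : ∀ {A : Set} {m} → A ↔ Fin m → ∀ k → Vec A k ↔ Fin (m ℕ.^ k)
Vec-card a zero = mk↔ₛ′ (λ _ → zero) (λ _ → []) (λ { zero → refl }) (λ { [] → refl })
Vec-card a (suc k) = ×-card a (Vec-card a k) ↔-∘
  mk↔ₛ′ Vec.uncons (λ (x , xs) → x ∷ xs) (λ _ → refl) (λ { (x ∷ xs) → refl })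

lookup-injective : {A : Set} {xs : List A} → Unique xs → ∀ i j → List.lookup xs i ≡ List.lookup xs j → i ≡ j
lookup-injective (_ ∷ _) zero zero _ = refl
lookup-injective {xs = _ ∷ xs} (x∉ ∷ _) zero (suc j) eq = contradiction eq (All.lookup x∉ (∈-lookup {xs = xs} j))
lookup-injective {xs = _ ∷ xs} (x∉ ∷ _) (suc i) zero eq = contradiction (sym eq) (All.lookup x∉ (∈-lookup {xs = xs} i))
lookup-injective (_ ∷ u) (suc i) (suc j) eq = cong suc (lookup-injective u i j eq)

enumeration-card : {A : Set} (xs : List A) → (∀ x → x ∈ xs) → Unique xs → A ↔ Fin (length xs)
enumeration-card xs complete unique = mk↔ₛ′
  (λ x → Any.index (complete x)) (List.lookup xs)
  (λ i → lookup-injective unique _ i (sym (lookup-index (complete (List.lookup xs i)))))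
  (λ x → sym (lookup-index (complete x)))

-- Ring identities in a finite field

module FieldFacts (F : FiniteField) where
  open FiniteField F public using (Carrier; inv; inv-r; 0≢1; _≟_; isCommutativeRing; elems; complete; unique)

  commutativeRing : CommutativeRing _ _
  commutativeRing = record { isCommutativeRing = isCommutativeRing }

  open CommutativeRing commutativeRing public
    using (_+_; _*_; -_; 0#; 1#; +-assoc; +-comm; *-assoc; *-comm; +-identityˡ; +-identityʳ;
           *-identityˡ; *-identityʳ; distribˡ; distribʳ; zeroˡ; zeroʳ; -‿inverseˡ; -‿inverseʳ;
           semiring; commutativeSemiring; +-commutativeMonoid; *-commutativeMonoid; ring)

  private
    open Algebra.Properties.Semiring.Mult.TCOptimised semiring using ()
      renaming (_×_ to _×′_; ×1-homo-* to ×′-homo-*; ×-homo-+ to ×′-homo-+)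
    open import Algebra.Properties.Ring ring

    -- With coefficients in ℤ the ring solver can compute and so cancels opposite terms; elements of
    -- the abstract field would not reduce.
    fromℤ : ℤ → Carrier
    fromℤ (pos n) = n ×′ 1#
    fromℤ -[1+ n ] = - (suc n ×′ 1#)

    suc-×′ : ∀ n → suc n ×′ 1# ≡ 1# + n ×′ 1#
    suc-×′ n = ×′-homo-+ 1# 1 n

    +-cancel-1 : ∀ a b → (1# + a) + (- (1# + b)) ≡ a + (- b)
    +-cancel-1 a b = begin
      (1# + a) + (- (1# + b)) ≡⟨ cong ((1# + a) +_) (sym (-‿+-comm 1# b)) ⟩
      (1# + a) + ((- 1#) + (- b)) ≡⟨ cong (_+ ((- 1#) + (- b))) (+-comm 1# a) ⟩
      (a + 1#) + ((- 1#) + (- b)) ≡⟨ +-assoc a 1# _ ⟩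
      a + (1# + ((- 1#) + (- b))) ≡⟨ cong (a +_) (sym (+-assoc 1# (- 1#) (- b))) ⟩
      a + ((1# + (- 1#)) + (- b)) ≡⟨ cong (λ z → a + (z + (- b))) (-‿inverseʳ 1#) ⟩
      a + (0# + (- b)) ≡⟨ cong (a +_) (+-identityˡ (- b)) ⟩
      a + (- b) ∎ where open ≡-Reasoning

    fromℤ-⊖ : ∀ m n → fromℤ (m ℤ.⊖ n) ≡ (m ×′ 1#) + (- (n ×′ 1#))
    fromℤ-⊖ zero zero = sym (-‿inverseʳ 0#)
    fromℤ-⊖ zero (suc n) = sym (+-identityˡ _)
    fromℤ-⊖ (suc m) zero = sym (trans (cong (suc m ×′ 1# +_) -0#≈0#) (+-identityʳ _))
    fromℤ-⊖ (suc m) (suc n) = begin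
      fromℤ (suc m ℤ.⊖ suc n) ≡⟨ cong fromℤ (ℤₚ.[1+m]⊖[1+n]≡m⊖n m n) ⟩
      fromℤ (m ℤ.⊖ n) ≡⟨ fromℤ-⊖ m n ⟩
      (m ×′ 1#) + (- (n ×′ 1#)) ≡⟨ sym (+-cancel-1 _ _) ⟩
      (1# + m ×′ 1#) + (- (1# + n ×′ 1#)) ≡⟨ cong₂ (λ a b → a + (- b)) (sym (suc-×′ m)) (sym (suc-×′ n)) ⟩
      (suc m ×′ 1#) + (- (suc n ×′ 1#)) ∎ where open ≡-Reasoning

    fromℤ-+ : ∀ i j → fromℤ (i ℤ.+ j) ≡ fromℤ i + fromℤ j
    fromℤ-+ (pos m) (pos n) = ×′-homo-+ 1# m n
    fromℤ-+ (pos m) -[1+ n ] = fromℤ-⊖ m (suc n)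
    fromℤ-+ -[1+ m ] (pos n) = trans (fromℤ-⊖ n (suc m)) (+-comm _ _)
    fromℤ-+ -[1+ m ] -[1+ n ] = trans
      (cong -_ (trans (cong (_×′ 1#) (cong suc (sym (ℕₚ.+-suc m n)))) (×′-homo-+ 1# (suc m) (suc n))))
      (sym (-‿+-comm _ _))

    fromℤ-neg : ∀ i → fromℤ (ℤ.- i) ≡ - fromℤ i
    fromℤ-neg (pos zero) = sym -0#≈0#
    fromℤ-neg (pos (suc n)) = refl
    fromℤ-neg -[1+ n ] = sym (-‿involutive _)

    fromℤ-*-+ : ∀ m j → fromℤ (pos m ℤ.* j) ≡ fromℤ (pos m) * fromℤ j
    fromℤ-*-+ m (pos n) = trans (cong fromℤ (sym (ℤₚ.pos-* m n))) (×′-homo-* m n)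
    fromℤ-*-+ m -[1+ n ] = begin
      fromℤ (pos m ℤ.* -[1+ n ]) ≡⟨ cong fromℤ (sym (ℤₚ.neg-distribʳ-* (pos m) (pos (suc n)))) ⟩
      fromℤ (ℤ.- (pos m ℤ.* pos (suc n))) ≡⟨ fromℤ-neg (pos m ℤ.* pos (suc n)) ⟩
      - fromℤ (pos m ℤ.* pos (suc n)) ≡⟨ cong -_ (fromℤ-*-+ m (pos (suc n))) ⟩
      - (fromℤ (pos m) * fromℤ (pos (suc n))) ≡⟨ -‿distribʳ-* _ _ ⟩
      fromℤ (pos m) * fromℤ -[1+ n ] ∎ where open ≡-Reasoning

    fromℤ-* : ∀ i j → fromℤ (i ℤ.* j) ≡ fromℤ i * fromℤ j
    fromℤ-* (pos m) j = fromℤ-*-+ m j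
    fromℤ-* -[1+ m ] j = begin
      fromℤ (-[1+ m ] ℤ.* j) ≡⟨ cong fromℤ (sym (ℤₚ.neg-distribˡ-* (pos (suc m)) j)) ⟩
      fromℤ (ℤ.- (pos (suc m) ℤ.* j)) ≡⟨ fromℤ-neg (pos (suc m) ℤ.* j) ⟩
      - fromℤ (pos (suc m) ℤ.* j) ≡⟨ cong -_ (fromℤ-*-+ (suc m) j) ⟩
      - (fromℤ (pos (suc m)) * fromℤ j) ≡⟨ -‿distribˡ-* _ _ ⟩
      fromℤ -[1+ m ] * fromℤ j ∎ where open ≡-Reasoning

    homomorphism : ℤ.+-*-rawRing -Raw-AlmostCommutative⟶ fromCommutativeRing commutativeRing
    homomorphism = record
      { ⟦_⟧ = fromℤ ; +-homo = fromℤ-+ ; *-homo = fromℤ-* ; -‿homo = fromℤ-neg ; 0-homo = refl ; 1-homo = refl }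

    coeff≟ : ∀ i j → Maybe (fromℤ i ≡ fromℤ j)
    coeff≟ i j with i ℤₚ.≟ j
    ... | yes eq = just (cong fromℤ eq)
    ... | no _ = nothing

  open Algebra.Solver.Ring ℤ.+-*-rawRing (fromCommutativeRing commutativeRing) homomorphism coeff≟ public
    using (Polynomial; solve; _:=_; _:+_; _:*_; :-_; con)

  :0 :1 :-1 : ∀ {n} → Polynomial n
  :0 = con (pos 0)
  :1 = con (pos 1)
  :-1 = :- :1

-- Binomial coefficients modulo a prime

prime∤! : ∀ {p} → Prime p → ∀ m → m < p → p ∤ m !
prime∤! {p} pp zero m<p p∣1 = ℕₚ.<⇒≱ (nonTrivial⇒n>1 p {{prime⇒nonTrivial pp}}) (∣⇒≤ p∣1)
prime∤! pp (suc m) m<p p∣ with euclidsLemma (suc m) (m !) pp p∣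
... | inj₁ p∣m = ℕₚ.<⇒≱ m<p (∣⇒≤ p∣m)
... | inj₂ p∣m! = prime∤! pp m (ℕₚ.<-trans (ℕₚ.n<1+n m) m<p) p∣m!

-- The prime p divides p!, which is the binomial coefficient times k! (p - k)!, but it divides
-- neither factorial, as k and p - k are smaller than p.
prime∣C : ∀ {p} → Prime p → ∀ k → 1 ≤ k → k < p → p ∣ p choose k
prime∣C {p@(suc p′)} pp k 1≤k k<p
  with euclidsLemma (p choose k) ((k !) ℕ.* ((p ℕ.∸ k) !)) pp (subst (p ∣_) (sym C*k!) (∣.m∣m*n (p′ !)))
  where
  instance _ = ℕₚ.m*n≢0 (k !) ((p ℕ.∸ k) !) {{k ℕₚ.!≢0}} {{(p ℕ.∸ k) ℕₚ.!≢0}}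
  C*k! : (p choose k) ℕ.* ((k !) ℕ.* ((p ℕ.∸ k) !)) ≡ p !
  C*k! = trans (cong (ℕ._* ((k !) ℕ.* ((p ℕ.∸ k) !))) (nCk≡n!/k![n-k]! (ℕₚ.<⇒≤ k<p))) (m/n*n≡m (k![n∸k]!∣n! (ℕₚ.<⇒≤ k<p)))
... | inj₁ p∣C = p∣C
... | inj₂ p∣k!l! with euclidsLemma (k !) ((p ℕ.∸ k) !) pp p∣k!l!
... | inj₁ p∣k! = contradiction p∣k! (prime∤! pp k k<p)
... | inj₂ p∣l! = contradiction p∣l! (prime∤! pp (p ℕ.∸ k) (ℕₚ.∸-monoʳ-< 1≤k (ℕₚ.<⇒≤ k<p)))

primePower≥2 : ∀ {q} → IsPrimePower q → 2 ≤ q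
primePower≥2 (p , suc k , pp , _ , refl) =
  ℕₚ.≤-trans p≥2 (ℕₚ.m≤m*n p (p ℕ.^ k) {{ℕₚ.m^n≢0 p k {{ℕ.>-nonZero (ℕₚ.<⇒≤ p≥2)}}}})
  where p≥2 = nonTrivial⇒n>1 p {{prime⇒nonTrivial pp}}

-- Sums with at most one nontrivial term in a commutative monoid

module _ {c ℓ} (M : CommutativeMonoid c ℓ) where
  open CommutativeMonoid M renaming (sym to ≈-sym; trans to ≈-trans)
  open Algebra.Properties.CommutativeMonoid.Sum M using (sum; sum-replicate-zero; sum-cong-≋)

  sum-ε : ∀ {k} (g : Fin k → Carrier) → (∀ j → g j ≈ ε) → sum g ≈ ε
  sum-ε {k} g g≈ε = ≈-trans (sum-cong-≋ g≈ε) (sum-replicate-zero k)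

  sum-single : ∀ {k} (g : Fin k → Carrier) i → (∀ j → j ≢ i → g j ≈ ε) → sum g ≈ g i
  sum-single g zero g≈ε = ≈-trans (∙-congˡ (sum-ε _ (λ j → g≈ε (suc j) λ ()))) (identityʳ _)
  sum-single g (suc i) g≈ε = ≈-trans (∙-cong (g≈ε zero λ ()) (sum-single (g ∘ suc) i (λ j j≢i → g≈ε (suc j) (j≢i ∘ Finₚ.suc-injective)))) (identityˡ _)

-- Arithmetic of the field with q^n elements

module Theory (F : FiniteField) (q n : ℕ) (isPrimePower : IsPrimePower q) (3≤n : 3 ≤ n)
              (|F| : length (FiniteField.elems F) ≡ q ℕ.^ n) where
  open FieldFacts F public
  open Geometry F q n public

  module ΣF = Algebra.Properties.Semiring.Sum semiring
  module ΠF = Algebra.Properties.CommutativeMonoid.Sum *-commutativeMonoid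
  module ×F = Algebra.Properties.Semiring.Mult semiring
  open ΣF using (sum)
  open ΠF using () renaming (sum to ∏)

  Q : ℕ
  Q = q ℕ.^ n

  2≤q : 2 ≤ q
  2≤q = primePower≥2 isPrimePower

  instance
    q≢0 : NonZero q
    q≢0 = ℕ.>-nonZero (ℕₚ.<⇒≤ 2≤q)
    n≢0 : NonZero n
    n≢0 = ℕ.>-nonZero (ℕₚ.≤-trans (s≤s z≤n) 3≤n)
    Q≢0 : NonZero Q
    Q≢0 = ℕₚ.m^n≢0 q n

  q^≢0 : ∀ k → NonZero (q ℕ.^ k)
  q^≢0 k = ℕₚ.m^n≢0 q k

  q^-< : ∀ {i j} → i < j → q ℕ.^ i < q ℕ.^ j
  q^-< = ℕₚ.^-monoʳ-< q 2≤q

  opaque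
    cardF : Carrier ↔ Fin Q
    cardF = subst (λ k → Carrier ↔ Fin k) |F| (enumeration-card elems complete unique)

  module cardF = Inverse cardF

  el : Fin Q → Carrier
  el = cardF.from

  el-injective : ∀ {i j} → el i ≡ el j → i ≡ j
  el-injective = ↔-injective (↔-sym cardF)

  el-to : ∀ x → el (cardF.to x) ≡ x
  el-to = cardF.strictlyInverseʳ

  inv-l : ∀ x → x ≢ 0# → inv x * x ≡ 1#
  inv-l x x≢0 = trans (*-comm _ _) (inv-r x x≢0)

  *-cancelˡ : ∀ x {y z} → x ≢ 0# → x * y ≡ x * z → y ≡ z
  *-cancelˡ x {y} {z} x≢0 eq = begin
    y ≡⟨ sym (*-identityˡ y) ⟩
    1# * y ≡⟨ cong (_* y) (sym (inv-l x x≢0)) ⟩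
    (inv x * x) * y ≡⟨ *-assoc _ _ _ ⟩
    inv x * (x * y) ≡⟨ cong (inv x *_) eq ⟩
    inv x * (x * z) ≡⟨ sym (*-assoc _ _ _) ⟩
    (inv x * x) * z ≡⟨ cong (_* z) (inv-l x x≢0) ⟩
    1# * z ≡⟨ *-identityˡ z ⟩
    z ∎ where open ≡-Reasoning

  *-zero-product : ∀ x {y} → x ≢ 0# → x * y ≡ 0# → y ≡ 0#
  *-zero-product x x≢0 eq = *-cancelˡ x x≢0 (trans eq (sym (zeroʳ x)))

  *-≢0 : ∀ {x y} → x ≢ 0# → y ≢ 0# → x * y ≢ 0#
  *-≢0 x≢0 y≢0 eq = y≢0 (*-zero-product _ x≢0 eq)

  inv-≢0 : ∀ {x} → x ≢ 0# → inv x ≢ 0#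
  inv-≢0 {x} x≢0 eq = 0≢1 (trans (sym (zeroʳ x)) (trans (cong (x *_) (sym eq)) (inv-r x x≢0)))

  1≢0 : 1# ≢ 0#
  1≢0 = 0≢1 ∘ sym

  x-y≡0⇒x≡y : ∀ {x y} → x + (- y) ≡ 0# → x ≡ y
  x-y≡0⇒x≡y {x} {y} eq = begin
    x ≡⟨ solve 2 (λ x y → x := (x :+ (:- y)) :+ y) refl x y ⟩
    (x + (- y)) + y ≡⟨ cong (_+ y) eq ⟩
    0# + y ≡⟨ +-identityˡ y ⟩
    y ∎ where open ≡-Reasoning

  x≡y⇒x-y≡0 : ∀ {x y} → x ≡ y → x + (- y) ≡ 0#
  x≡y⇒x-y≡0 {x} refl = -‿inverseʳ x

  x+y≡0⇒x≡-y : ∀ {x y} → x + y ≡ 0# → x ≡ - y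
  x+y≡0⇒x≡-y {x} {y} eq = x-y≡0⇒x≡y (trans (cong (x +_) (solve 1 (λ y → :- (:- y) := y) refl y)) eq)

  pow-homo-+ : ∀ x a b → pow x (a ℕ.+ b) ≡ pow x a * pow x b
  pow-homo-+ x zero b = sym (*-identityˡ _)
  pow-homo-+ x (suc a) b = trans (cong (x *_) (pow-homo-+ x a b)) (sym (*-assoc _ _ _))

  pow-distrib-* : ∀ x y a → pow (x * y) a ≡ pow x a * pow y a
  pow-distrib-* x y zero = sym (*-identityˡ _)
  pow-distrib-* x y (suc a) = trans (cong ((x * y) *_) (pow-distrib-* x y a))
    (solve 4 (λ x y a b → (x :* y) :* (a :* b) := (x :* a) :* (y :* b)) refl x y _ _)

  pow-1# : ∀ a → pow 1# a ≡ 1#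
  pow-1# zero = refl
  pow-1# (suc a) = trans (*-identityˡ _) (pow-1# a)

  pow-0# : ∀ a → .{{NonZero a}} → pow 0# a ≡ 0#
  pow-0# (suc a) = zeroˡ _

  pow-one : ∀ x → pow x 1 ≡ x
  pow-one x = *-identityʳ x

  pow-* : ∀ x a b → pow x (a ℕ.* b) ≡ pow (pow x a) b
  pow-* x a zero = cong (pow x) (ℕₚ.*-zeroʳ a)
  pow-* x a (suc b) = trans (cong (pow x) (ℕₚ.*-suc a b)) (trans (pow-homo-+ x a (a ℕ.* b)) (cong (pow x a *_) (pow-* x a b)))

  pow-≢0 : ∀ {x} a → x ≢ 0# → pow x a ≢ 0#
  pow-≢0 zero x≢0 = 1≢0
  pow-≢0 (suc a) x≢0 = *-≢0 x≢0 (pow-≢0 a x≢0)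

  pow-≡0 : ∀ {x} a → pow x a ≡ 0# → x ≡ 0#
  pow-≡0 {x} a eq with x ≟ 0#
  ... | yes x≡0 = x≡0
  ... | no x≢0 = contradiction eq (pow-≢0 a x≢0)

  -- Sums and products over the field

  ∑F ∏F : (Carrier → Carrier) → Carrier
  ∑F g = sum (g ∘ el)
  ∏F g = ∏ (g ∘ el)

  permutation : (f : Carrier → Carrier) → (∀ {x y} → f x ≡ f y → x ≡ y) → Fin Q ↔ Fin Q
  permutation f inj = cardF ↔-∘ (mk↔ₛ′ f (proj₁ ∘ surj) (proj₂ ∘ surj) (λ x → inj (proj₂ (surj (f x)))) ↔-∘ ↔-sym cardF)
    where surj = injective⇒surjective cardF cardF f inj

  ∑F-reindex : ∀ g f → (∀ {x y} → f x ≡ f y → x ≡ y) → ∑F (g ∘ f) ≡ ∑F g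
  ∑F-reindex g f inj = sym (trans (ΣF.sum-permute (g ∘ el) (permutation f inj)) (ΣF.sum-cong-≗ {Q} {λ i → g (el (cardF.to (f (el i))))} λ i → cong g (el-to (f (el i)))))

  ∏F-reindex : ∀ g f → (∀ {x y} → f x ≡ f y → x ≡ y) → ∏F (g ∘ f) ≡ ∏F g
  ∏F-reindex g f inj = sym (trans (ΠF.sum-permute (g ∘ el) (permutation f inj)) (ΠF.sum-cong-≗ {Q} {λ i → g (el (cardF.to (f (el i))))} λ i → cong g (el-to (f (el i)))))

  ∑F-cong : ∀ {f g} → (∀ x → f x ≡ g x) → ∑F f ≡ ∑F g
  ∑F-cong eq = ΣF.sum-cong-≗ (eq ∘ el)

  ∏F-cong : ∀ {f g} → (∀ x → f x ≡ g x) → ∏F f ≡ ∏F g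
  ∏F-cong eq = ΠF.sum-cong-≗ (eq ∘ el)

  ∑F-single : ∀ g y → (∀ x → x ≢ y → g x ≡ 0#) → ∑F g ≡ g y
  ∑F-single g y g≡0 = trans (sum-single +-commutativeMonoid (g ∘ el) (cardF.to y)
    (λ j j≢ → g≡0 (el j) λ eq → j≢ (trans (sym (cardF.strictlyInverseˡ j)) (cong cardF.to eq)))) (cong g (el-to y))

  ∏F-single : ∀ g y → (∀ x → x ≢ y → g x ≡ 1#) → ∏F g ≡ g y
  ∏F-single g y g≡1 = trans (sum-single *-commutativeMonoid (g ∘ el) (cardF.to y)
    (λ j j≢ → g≡1 (el j) λ eq → j≢ (trans (sym (cardF.strictlyInverseˡ j)) (cong cardF.to eq)))) (cong g (el-to y))

  ∏-≢0 : ∀ {k} (g : Fin k → Carrier) → (∀ i → g i ≢ 0#) → ∏ g ≢ 0#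
  ∏-≢0 {zero} g g≢0 = 1≢0
  ∏-≢0 {suc k} g g≢0 = *-≢0 (g≢0 zero) (∏-≢0 (g ∘ suc) (g≢0 ∘ suc))

  ∏-replicate : ∀ k x → ∏ {k} (λ _ → x) ≡ pow x k
  ∏-replicate zero x = refl
  ∏-replicate (suc k) x = cong (x *_) (∏-replicate k x)

  -- Multiplication by `a ≠ 0` permutes the field. To keep the products nonzero, `h` replaces 0 by
  -- 1; then `h (a * x) ≡ r x * h x`, where `r` is `a` away from 0, and so `∏F r ≡ 1#`. The function
  -- `s` is `a` at 0 only; it supplies the factor which makes `r x * s x` constant, with product
  -- a^Q.
  Fermat : ∀ x → pow x Q ≡ x
  Fermat a with a ≟ 0#
  ... | yes refl = pow-0# Q
  ... | no a≢0 = begin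
    pow a Q ≡⟨ sym (∏-replicate Q a) ⟩
    ∏F (λ _ → a) ≡⟨ ∏F-cong (λ x → sym (r*s x)) ⟩
    ∏F (λ x → r x * s x) ≡⟨ ΠF.∑-distrib-+ (r ∘ el) (s ∘ el) ⟩
    ∏F r * ∏F s ≡⟨ cong₂ _*_ ∏r≡1 (∏F-single s 0# s≡1) ⟩
    1# * s 0# ≡⟨ *-identityˡ _ ⟩
    s 0# ≡⟨ s0≡a ⟩
    a ∎
    where
    open ≡-Reasoning
    h r s : Carrier → Carrier
    h x with x ≟ 0#
    ... | yes _ = 1#
    ... | no _ = x
    r x with x ≟ 0#
    ... | yes _ = 1#
    ... | no _ = a
    s x with x ≟ 0#
    ... | yes _ = a
    ... | no _ = 1#
    r*s : ∀ x → r x * s x ≡ a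
    r*s x with x ≟ 0#
    ... | yes _ = *-identityˡ a
    ... | no _ = *-identityʳ a
    s≡1 : ∀ x → x ≢ 0# → s x ≡ 1#
    s≡1 x x≢0 with x ≟ 0#
    ... | yes x≡0 = contradiction x≡0 x≢0
    ... | no _ = refl
    s0≡a : s 0# ≡ a
    s0≡a with 0# ≟ 0#
    ... | yes _ = refl
    ... | no 0≢0 = contradiction refl 0≢0
    h-* : ∀ x → h (a * x) ≡ r x * h x
    h-* x with x ≟ 0# | (a * x) ≟ 0#
    ... | yes x≡0 | yes _ = sym (*-identityˡ 1#)
    ... | yes x≡0 | no ax≢0 = contradiction (trans (cong (a *_) x≡0) (zeroʳ a)) ax≢0
    ... | no x≢0 | yes ax≡0 = contradiction ax≡0 (*-≢0 a≢0 x≢0)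
    ... | no x≢0 | no _ = refl
    h≢0 : ∀ x → h x ≢ 0#
    h≢0 x with x ≟ 0#
    ... | yes _ = 1≢0
    ... | no x≢0 = x≢0
    ∏r≡1 : ∏F r ≡ 1#
    ∏r≡1 = *-cancelˡ (∏F h) (∏-≢0 (h ∘ el) (h≢0 ∘ el)) (begin
      ∏F h * ∏F r ≡⟨ *-comm _ _ ⟩
      ∏F r * ∏F h ≡⟨ sym (ΠF.∑-distrib-+ (r ∘ el) (h ∘ el)) ⟩
      ∏F (λ x → r x * h x) ≡⟨ ∏F-cong (λ x → sym (h-* x)) ⟩
      ∏F (λ x → h (a * x)) ≡⟨ ∏F-reindex h (a *_) (*-cancelˡ a a≢0) ⟩
      ∏F h ≡⟨ sym (*-identityʳ _) ⟩
      ∏F h * 1# ∎)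

  -- Characteristic, and additivity of the q-th power

  -- The translation x ↦ x + 1 permutes the field, so adding Q times 1 to the sum of all elements
  -- does not change it.
  Q×1≡0 : Q ×F.× 1# ≡ 0#
  Q×1≡0 = begin
    Q ×F.× 1# ≡⟨ sym (ΣF.sum-replicate Q) ⟩
    S₁ ≡⟨ solve 2 (λ s t → t := (s :+ t) :+ (:- s)) refl S S₁ ⟩
    (S + S₁) + (- S) ≡⟨ cong (_+ (- S)) (sym (ΣF.∑-distrib-+ el (λ _ → 1#))) ⟩
    ∑F (λ x → x + 1#) + (- S) ≡⟨ cong (_+ (- S)) (∑F-reindex (λ x → x) (_+ 1#) inj) ⟩
    S + (- S) ≡⟨ -‿inverseʳ S ⟩
    0# ∎
    where
    open ≡-Reasoning
    S S₁ : Carrier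
    S = ∑F (λ x → x)
    S₁ = ∑F (λ _ → 1#)
    inj : ∀ {x y} → x + 1# ≡ y + 1# → x ≡ y
    inj {x} {y} eq = begin
      x ≡⟨ solve 2 (λ x o → x := (x :+ o) :+ (:- o)) refl x 1# ⟩
      (x + 1#) + (- 1#) ≡⟨ cong (_+ (- 1#)) eq ⟩
      (y + 1#) + (- 1#) ≡⟨ solve 2 (λ x o → (x :+ o) :+ (:- o) := x) refl y 1# ⟩
      y ∎

  p×1≡0 : ∀ p k → (p ℕ.^ k) ×F.× 1# ≡ 0# → p ×F.× 1# ≡ 0#
  p×1≡0 p zero eq = contradiction (trans (sym (+-identityʳ 1#)) eq) 1≢0
  p×1≡0 p (suc k) eq with (p ×F.× 1#) ≟ 0#
  ... | yes p≡0 = p≡0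
  ... | no p≢0 = p×1≡0 p k (*-zero-product _ p≢0 (trans (sym (×F.×1-homo-* p (p ℕ.^ k))) eq))

  ∣×≡0 : ∀ {p c} x → p ×F.× 1# ≡ 0# → p ∣ c → c ×F.× x ≡ 0#
  ∣×≡0 {p} x p≡0 (divides r refl) = begin
    (r ℕ.* p) ×F.× x ≡⟨ cong ((r ℕ.* p) ×F.×_) (sym (*-identityˡ x)) ⟩
    (r ℕ.* p) ×F.× (1# * x) ≡⟨ sym (×F.×-assoc-* (r ℕ.* p) 1# x) ⟩
    ((r ℕ.* p) ×F.× 1#) * x ≡⟨ cong (_* x) (×F.×1-homo-* r p) ⟩
    ((r ×F.× 1#) * (p ×F.× 1#)) * x ≡⟨ cong (λ z → ((r ×F.× 1#) * z) * x) p≡0 ⟩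
    ((r ×F.× 1#) * 0#) * x ≡⟨ solve 2 (λ r x → (r :* :0) :* x := :0) refl (r ×F.× 1#) x ⟩
    0# ∎
    where open ≡-Reasoning

  private
    module Bin = Algebra.Properties.CommutativeSemiring.Binomial commutativeSemiring
    open Algebra.Properties.Semiring.Exp semiring using () renaming (_^_ to _^F_)

    pow≡^ : ∀ x a → pow x a ≡ x ^F a
    pow≡^ x zero = refl
    pow≡^ x (suc a) = cong (x *_) (pow≡^ x a)

  -- In the binomial expansion every term except the two outer ones has a coefficient divisible by
  -- p.
  freshman : ∀ {p} → Prime p → p ×F.× 1# ≡ 0# → ∀ x y → pow (x + y) p ≡ pow x p + pow y p
  freshman {suc p′} pp p≡0 x y = begin
    pow (x + y) p ≡⟨ pow≡^ (x + y) p ⟩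
    (x + y) ^F p ≡⟨ Bin.theorem p x y ⟩
    sum t ≡⟨⟩
    t zero + sum (t ∘ suc) ≡⟨ cong (t zero +_) (ΣF.sum-init-last (t ∘ suc)) ⟩
    t zero + (sum (t ∘ suc ∘ inject₁) + t (suc (fromℕ p′)))
      ≡⟨ cong₂ (λ a b → a + (b + t (suc (fromℕ p′)))) t-first (sum-ε +-commutativeMonoid _ t-middle) ⟩
    pow y p + (0# + t (suc (fromℕ p′))) ≡⟨ cong (λ z → pow y p + (0# + z)) t-last ⟩
    pow y p + (0# + pow x p) ≡⟨ cong (pow y p +_) (+-identityˡ _) ⟩
    pow y p + pow x p ≡⟨ +-comm _ _ ⟩
    pow x p + pow y p ∎
    where
    open ≡-Reasoning
    p = suc p′
    t = Bin.binomialTerm x y p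
    t-first : t zero ≡ pow y p
    t-first = trans (+-identityʳ _) (trans (*-identityˡ _) (sym (pow≡^ y p)))
    t-middle : ∀ i → t (suc (inject₁ i)) ≡ 0#
    t-middle i = ∣×≡0 _ p≡0 (prime∣C pp (suc (toℕ (inject₁ i))) (s≤s z≤n)
      (s≤s (subst (_< p′) (sym (Finₚ.toℕ-inject₁ i)) (Finₚ.toℕ<n i))))
    t-last : t (suc (fromℕ p′)) ≡ pow x p
    t-last = begin
      (p choose suc (toℕ (fromℕ p′))) ×F.× ((x ^F suc (toℕ (fromℕ p′))) * (y ^F (p ℕ.∸ suc (toℕ (fromℕ p′)))))
        ≡⟨ cong (λ j → (p choose suc j) ×F.× ((x ^F suc j) * (y ^F (p ℕ.∸ suc j)))) (Finₚ.toℕ-fromℕ p′) ⟩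
      (p choose p) ×F.× ((x ^F p) * (y ^F (p ℕ.∸ p))) ≡⟨ cong₂ (λ c e → c ×F.× ((x ^F p) * (y ^F e))) (nCn≡1 p) (ℕₚ.n∸n≡0 p) ⟩
      1 ×F.× ((x ^F p) * 1#) ≡⟨ +-identityʳ _ ⟩
      (x ^F p) * 1# ≡⟨ *-identityʳ _ ⟩
      x ^F p ≡⟨ sym (pow≡^ x p) ⟩
      pow x p ∎

  pow-p^-+ : ∀ {p} → Prime p → p ×F.× 1# ≡ 0# → ∀ k x y → pow (x + y) (p ℕ.^ k) ≡ pow x (p ℕ.^ k) + pow y (p ℕ.^ k)
  pow-p^-+ pp p≡0 zero x y = trans (pow-one _) (sym (cong₂ _+_ (pow-one x) (pow-one y)))
  pow-p^-+ {p} pp p≡0 (suc k) x y = begin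
    pow (x + y) (p ℕ.* p ℕ.^ k) ≡⟨ pow-* (x + y) p (p ℕ.^ k) ⟩
    pow (pow (x + y) p) (p ℕ.^ k) ≡⟨ cong (λ z → pow z (p ℕ.^ k)) (freshman pp p≡0 x y) ⟩
    pow (pow x p + pow y p) (p ℕ.^ k) ≡⟨ pow-p^-+ pp p≡0 k _ _ ⟩
    pow (pow x p) (p ℕ.^ k) + pow (pow y p) (p ℕ.^ k) ≡⟨ sym (cong₂ _+_ (pow-* x p (p ℕ.^ k)) (pow-* y p (p ℕ.^ k))) ⟩
    pow x (p ℕ.* p ℕ.^ k) + pow y (p ℕ.* p ℕ.^ k) ∎ where open ≡-Reasoning

  pow-q-+ : ∀ x y → pow (x + y) q ≡ pow x q + pow y q
  pow-q-+ x y = let (p , k , pp , _ , q≡) = isPrimePower in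
    subst (λ r → pow (x + y) r ≡ pow x r + pow y r) (sym q≡)
    -- From q = p^k it follows that Q = p^(k n), and Q annihilates 1; hence so does p.
    (pow-p^-+ pp (p×1≡0 p (k ℕ.* n) (subst (λ r → r ×F.× 1# ≡ 0#) (trans (cong (ℕ._^ n) q≡) (ℕₚ.^-*-assoc p k n)) Q×1≡0)) k x y)

  -- The Frobenius maps x ↦ x^(q^i)

  φ : ℕ → Carrier → Carrier
  φ i x = pow x (q ℕ.^ i)

  φ-zero : ∀ x → φ 0 x ≡ x
  φ-zero = pow-one

  φ-suc : ∀ i x → φ (suc i) x ≡ φ i (pow x q)
  φ-suc i x = pow-* x q (q ℕ.^ i)

  φ-homo-+ : ∀ i x y → φ i (x + y) ≡ φ i x + φ i y
  φ-homo-+ zero x y = trans (φ-zero _) (sym (cong₂ _+_ (φ-zero x) (φ-zero y)))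
  φ-homo-+ (suc i) x y = begin
    φ (suc i) (x + y) ≡⟨ φ-suc i (x + y) ⟩
    φ i (pow (x + y) q) ≡⟨ cong (φ i) (pow-q-+ x y) ⟩
    φ i (pow x q + pow y q) ≡⟨ φ-homo-+ i _ _ ⟩
    φ i (pow x q) + φ i (pow y q) ≡⟨ sym (cong₂ _+_ (φ-suc i x) (φ-suc i y)) ⟩
    φ (suc i) x + φ (suc i) y ∎ where open ≡-Reasoning

  φ-homo-* : ∀ i x y → φ i (x * y) ≡ φ i x * φ i y
  φ-homo-* i x y = pow-distrib-* x y (q ℕ.^ i)

  φ-0# : ∀ i → φ i 0# ≡ 0#
  φ-0# i = pow-0# (q ℕ.^ i) {{q^≢0 i}}

  φ-1# : ∀ i → φ i 1# ≡ 1#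
  φ-1# i = pow-1# (q ℕ.^ i)

  φ-≢0 : ∀ i {x} → x ≢ 0# → φ i x ≢ 0#
  φ-≢0 i = pow-≢0 (q ℕ.^ i)

  φ-neg : ∀ i x → φ i (- x) ≡ - φ i x
  φ-neg i x = x+y≡0⇒x≡-y (trans (sym (φ-homo-+ i (- x) x)) (trans (cong (φ i) (-‿inverseˡ x)) (φ-0# i)))

  φ-∘ : ∀ i j x → φ i (φ j x) ≡ φ (i ℕ.+ j) x
  φ-∘ i j x = trans (sym (pow-* x (q ℕ.^ j) (q ℕ.^ i))) (cong (pow x) (trans (ℕₚ.*-comm (q ℕ.^ j) (q ℕ.^ i)) (sym (ℕₚ.^-distribˡ-+-* q i j))))

  φ-n : ∀ x → φ n x ≡ x
  φ-n = Fermat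

  φ-injective : ∀ i {x y} → φ i x ≡ φ i y → x ≡ y
  φ-injective i {x} {y} eq = x-y≡0⇒x≡y (pow-≡0 (q ℕ.^ i) (begin
    φ i (x + (- y)) ≡⟨ φ-homo-+ i x (- y) ⟩
    φ i x + φ i (- y) ≡⟨ cong (φ i x +_) (φ-neg i y) ⟩
    φ i x + (- φ i y) ≡⟨ x≡y⇒x-y≡0 eq ⟩
    0# ∎)) where open ≡-Reasoning

  -- Polynomial functions and their roots

  eval : ∀ {d} → Vec Carrier d → Carrier → Carrier
  eval [] x = 0#
  eval (c ∷ cs) x = c + x * eval cs x

  -- Synthetic division by x - r. Coefficients are listed from the constant term upwards, and those
  -- of the quotient are the Horner values at r of the successive tails.
  quo : ∀ {d} → Carrier → Vec Carrier (suc d) → Vec Carrier d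
  quo r (c ∷ []) = []
  quo r (c ∷ cs@(_ ∷ _)) = eval cs r ∷ quo r cs

  eval-quo : ∀ {d} r (cs : Vec Carrier (suc d)) x → eval cs x ≡ (x + (- r)) * eval (quo r cs) x + eval cs r
  eval-quo r (c ∷ []) x = solve 3 (λ c x r → c :+ x :* :0 := ((x :+ (:- r)) :* :0) :+ (c :+ r :* :0)) refl c x r
  eval-quo r (c ∷ cs@(_ ∷ _)) x = trans (cong (λ z → c + x * z) (eval-quo r cs x))
    (solve 5 (λ c x r e f → c :+ x :* ((x :+ (:- r)) :* f :+ e) := ((x :+ (:- r)) :* (e :+ x :* f)) :+ (c :+ r :* e)) refl
      c x r (eval cs r) (eval (quo r cs) x))

  0s : ∀ d → Vec Carrier d
  0s d = Vec.replicate d 0#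

  eval-0s : ∀ d x → eval (0s d) x ≡ 0#
  eval-0s zero x = refl
  eval-0s (suc d) x = trans (+-identityˡ _) (trans (cong (x *_) (eval-0s d x)) (zeroʳ x))

  quo-zero : ∀ {d} r (cs : Vec Carrier (suc d)) → quo r cs ≡ 0s d → eval cs r ≡ 0# → cs ≡ 0s (suc d)
  quo-zero r (c ∷ []) _ eq = cong (_∷ []) (trans (solve 2 (λ c r → c := c :+ r :* :0) refl c r) eq)
  quo-zero r (c ∷ cs@(_ ∷ _)) q≡ eq = cong₂ _∷_
    (trans (solve 2 (λ c r → c := c :+ r :* :0) refl c r) (trans (cong (λ z → c + r * z) (sym (Vecₚ.∷-injectiveˡ q≡))) eq))
    (quo-zero r cs (Vecₚ.∷-injectiveʳ q≡) (Vecₚ.∷-injectiveˡ q≡))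

  -- Division by x minus the first root leaves a quotient which still has all the other roots. By
  -- induction this quotient is zero, and so is the remainder.
  roots⇒0s : ∀ {d m} (cs : Vec Carrier d) (r : Fin m → Carrier) → (∀ {i j} → r i ≡ r j → i ≡ j) → d ≤ m →
             (∀ i → eval cs (r i) ≡ 0#) → cs ≡ 0s d
  roots⇒0s [] r inj _ _ = refl
  roots⇒0s {suc d} {suc m} cs@(_ ∷ _) r inj (s≤s d≤m) root = quo-zero (r zero) cs
    (roots⇒0s (quo (r zero) cs) (r ∘ suc) (Finₚ.suc-injective ∘ inj) d≤m λ i →
      *-zero-product (r (suc i) + (- r zero)) (λ eq → Finₚ.0≢1+n (sym (inj (x-y≡0⇒x≡y eq))))
        (begin
          (r (suc i) + (- r zero)) * eval (quo (r zero) cs) (r (suc i)) ≡⟨ sym (+-identityʳ _) ⟩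
          (r (suc i) + (- r zero)) * eval (quo (r zero) cs) (r (suc i)) + 0# ≡⟨ cong (((r (suc i) + (- r zero)) * eval (quo (r zero) cs) (r (suc i))) +_) (sym (root zero)) ⟩
          (r (suc i) + (- r zero)) * eval (quo (r zero) cs) (r (suc i)) + eval cs (r zero) ≡⟨ sym (eval-quo (r zero) cs (r (suc i))) ⟩
          eval cs (r (suc i)) ≡⟨ root (suc i) ⟩
          0# ∎))
    (root zero)
    where open ≡-Reasoning

  -- The number `d` counts coefficients, so the degree is strictly below `d`.
  Poly : ℕ → (Carrier → Carrier) → Set
  Poly d g = Σ[ cs ∈ Vec Carrier d ] (∀ x → g x ≡ eval cs x)

  poly-0 : ∀ d → Poly d (λ _ → 0#)
  poly-0 d = 0s d , λ x → sym (eval-0s d x)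

  poly-+ : ∀ {d f g} → Poly d f → Poly d g → Poly d (λ x → f x + g x)
  poly-+ (cs , f≡) (ds , g≡) = Vec.zipWith _+_ cs ds , λ x → trans (cong₂ _+_ (f≡ x) (g≡ x)) (go cs ds x)
    where
    go : ∀ {d} (cs ds : Vec Carrier d) x → eval cs x + eval ds x ≡ eval (Vec.zipWith _+_ cs ds) x
    go [] [] x = +-identityˡ 0#
    go (c ∷ cs) (d ∷ ds) x = trans (solve 5 (λ c x e d f → (c :+ x :* e) :+ (d :+ x :* f) := (c :+ d) :+ x :* (e :+ f)) refl c x (eval cs x) d (eval ds x))
      (cong (λ z → (c + d) + x * z) (go cs ds x))

  poly-monomial : ∀ {d i} c → i < d → Poly d (λ x → c * pow x i)
  poly-monomial {suc d} {zero} c _ = c ∷ 0s d , λ x → trans (*-identityʳ c)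
    (sym (trans (cong (λ z → c + x * z) (eval-0s d x)) (solve 2 (λ c x → c :+ x :* :0 := c) refl c x)))
  poly-monomial {suc d} {suc i} c (s≤s i<d) with poly-monomial c i<d
  ... | cs , eq = 0# ∷ cs , λ x → trans (solve 3 (λ c x p → c :* (x :* p) := :0 :+ x :* (c :* p)) refl c x (pow x i))
    (cong (λ z → 0# + x * z) (eq x))

  poly-sum : ∀ {d k} (g : Fin k → Carrier → Carrier) → (∀ i → Poly d (g i)) → Poly d (λ x → sum (λ i → g i x))
  poly-sum {d} {zero} g _ = poly-0 d
  poly-sum {d} {suc k} g p = poly-+ (p zero) (poly-sum (g ∘ suc) (p ∘ suc))

  -- The form in which the bound on the number of roots is applied. The lower terms enter only as a
  -- function `g`; with `a` equal to 1 the conclusion becomes a contradiction.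
  leading-coefficient-zero : ∀ {d m g} a → Poly d g → (r : Fin m → Carrier) → (∀ {i j} → r i ≡ r j → i ≡ j) → d < m →
    (∀ i → g (r i) + a * pow (r i) d ≡ 0#) → a ≡ 0#
  leading-coefficient-zero {d} {m} a (cs , g≡) r inj d<m root =
    snoc-zero cs a (roots⇒0s (cs Vec.∷ʳ a) r inj d<m λ i →
      trans (eval-snoc cs a (r i)) (trans (cong (_+ (a * pow (r i) d)) (sym (g≡ (r i)))) (root i)))
    where
    eval-snoc : ∀ {d} (cs : Vec Carrier d) a x → eval (cs Vec.∷ʳ a) x ≡ eval cs x + a * pow x d
    eval-snoc [] a x = solve 2 (λ a x → a :+ x :* :0 := :0 :+ a :* :1) refl a x
    eval-snoc {suc d} (c ∷ cs) a x = trans (cong (λ z → c + x * z) (eval-snoc cs a x))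
      (solve 5 (λ c x e a p → c :+ x :* (e :+ a :* p) := (c :+ x :* e) :+ a :* (x :* p)) refl c x (eval cs x) a (pow x d))
    snoc-zero : ∀ {d} (cs : Vec Carrier d) a → cs Vec.∷ʳ a ≡ 0s (suc d) → a ≡ 0#
    snoc-zero [] a eq = Vecₚ.∷-injectiveˡ eq
    snoc-zero (c ∷ cs) a eq = snoc-zero cs a (Vecₚ.∷-injectiveʳ eq)

  -- For d < e the polynomial x^e - x^d is monic of degree e < Q, yet it would vanish at all Q
  -- elements.
  pow-injective : ∀ {d e} → 1 ≤ d → d < Q → 1 ≤ e → e < Q → (∀ x → pow x d ≡ pow x e) → d ≡ e
  pow-injective {d} {e} 1≤d d<Q 1≤e e<Q eq with ℕₚ.<-cmp d e
  ... | tri≈ _ d≡e _ = d≡e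
  ... | tri< d<e _ _ = contradiction (leading-coefficient-zero 1# (poly-monomial (- 1#) d<e) el el-injective e<Q
      λ i → trans (cong (λ z → (- 1#) * z + 1# * pow (el i) e) (eq (el i))) (solve 1 (λ z → :-1 :* z :+ :1 :* z := :0) refl _)) 1≢0
  ... | tri> _ _ e<d = contradiction (leading-coefficient-zero 1# (poly-monomial (- 1#) e<d) el el-injective d<Q
      λ i → trans (cong (λ z → (- 1#) * pow (el i) e + 1# * z) (eq (el i))) (solve 1 (λ z → :-1 :* z :+ :1 :* z := :0) refl _)) 1≢0

  -- The subfield F_q and the trace

  inFq-φ : ∀ {c} → InFq c → ∀ i → φ i c ≡ c
  inFq-φ c∈ zero = φ-zero _
  inFq-φ {c} c∈ (suc i) = trans (φ-suc i c) (trans (cong (φ i) c∈) (inFq-φ c∈ i))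

  inFq-0 : InFq 0#
  inFq-0 = pow-0# q

  inFq-1 : InFq 1#
  inFq-1 = pow-1# q

  inFq-+ : ∀ {x y} → InFq x → InFq y → InFq (x + y)
  inFq-+ x∈ y∈ = trans (pow-q-+ _ _) (cong₂ _+_ x∈ y∈)

  inFq-* : ∀ {x y} → InFq x → InFq y → InFq (x * y)
  inFq-* x∈ y∈ = trans (pow-distrib-* _ _ q) (cong₂ _*_ x∈ y∈)

  φ1≡pow : ∀ x → φ 1 x ≡ pow x q
  φ1≡pow x = cong (pow x) (ℕₚ.*-identityʳ q)

  inFq-neg : ∀ {x} → InFq x → InFq (- x)
  inFq-neg {x} x∈ = trans (sym (φ1≡pow _)) (trans (φ-neg 1 x) (cong -_ (trans (φ1≡pow x) x∈)))

  inFq-inv : ∀ {x} → x ≢ 0# → InFq x → InFq (inv x)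
  inFq-inv {x} x≢0 x∈ = *-cancelˡ x x≢0 (begin
    x * pow (inv x) q ≡⟨ cong (_* pow (inv x) q) (sym x∈) ⟩
    pow x q * pow (inv x) q ≡⟨ sym (pow-distrib-* x (inv x) q) ⟩
    pow (x * inv x) q ≡⟨ cong (λ z → pow z q) (inv-r x x≢0) ⟩
    pow 1# q ≡⟨ pow-1# q ⟩
    1# ≡⟨ sym (inv-r x x≢0) ⟩
    x * inv x ∎) where open ≡-Reasoning

  inFq? : ∀ x → Dec (InFq x)
  inFq? x = pow x q ≟ x

  record Enumeration (P : Carrier → Set) : Set where
    field
      size : ℕ
      at : Fin size → Carrier
      at-injective : ∀ {i j} → at i ≡ at j → i ≡ j
      at-sound : ∀ i → P (at i)
      index : ∀ x → P x → Fin size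
      at-index : ∀ x p → at (index x p) ≡ x

  enumerate : ∀ {P} → (∀ x → Dec (P x)) → Enumeration P
  enumerate {P} P? = record
    { size = length xs
    ; at = List.lookup xs
    ; at-injective = lookup-injective {xs = xs} (filter⁺ P? unique) _ _
    ; at-sound = λ i → proj₂ (∈-filter⁻ P? {xs = elems} (∈-lookup {xs = xs} i))
    ; index = λ x p → Any.index (∈-filter⁺ P? (complete x) p)
    ; at-index = λ x p → sym (lookup-index (∈-filter⁺ P? (complete x) p))
    }
    where xs = List.filter P? elems

  n′ : ℕ
  n′ = ℕ.pred n

  n≡ : suc n′ ≡ n
  n≡ = ℕₚ.suc-pred n

  tr : ℕ → Carrier → Carrier
  tr zero x = 0#
  tr (suc k) x = tr k x + φ k x

  trace : Carrier → Carrier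
  trace = tr n

  tr-homo-+ : ∀ k x y → tr k (x + y) ≡ tr k x + tr k y
  tr-homo-+ zero x y = sym (+-identityˡ 0#)
  tr-homo-+ (suc k) x y = trans (cong₂ _+_ (tr-homo-+ k x y) (φ-homo-+ k x y))
    (solve 4 (λ a b c d → (a :+ b) :+ (c :+ d) := (a :+ c) :+ (b :+ d)) refl _ _ _ _)

  tr-scale : ∀ k {c} x → InFq c → tr k (c * x) ≡ c * tr k x
  tr-scale zero {c} x c∈ = sym (zeroʳ c)
  tr-scale (suc k) {c} x c∈ = trans (cong₂ _+_ (tr-scale k x c∈) (trans (φ-homo-* k c x) (cong (_* φ k x) (inFq-φ c∈ k))))
    (sym (distribˡ c _ _))

  -- The q-th power shifts the summands of the trace, and the last one returns to the first place
  -- because x^(q^n) = x. The induction `shift` carries the missing summand x along, so that it also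
  -- holds for partial sums.
  trace-inFq : ∀ x → InFq (trace x)
  trace-inFq x = begin
    pow (trace x) q ≡⟨ solve 2 (λ t x → t := (t :+ x) :+ (:- x)) refl (pow (trace x) q) x ⟩
    (pow (trace x) q + x) + (- x) ≡⟨ cong (_+ (- x)) (shift n) ⟩
    (trace x + φ n x) + (- x) ≡⟨ cong (λ z → (trace x + z) + (- x)) (φ-n x) ⟩
    (trace x + x) + (- x) ≡⟨ solve 2 (λ t x → (t :+ x) :+ (:- x) := t) refl (trace x) x ⟩
    trace x ∎
    where
    open ≡-Reasoning
    shift : ∀ k → pow (tr k x) q + x ≡ tr k x + φ k x
    shift zero = cong₂ _+_ (pow-0# q) (sym (φ-zero x))
    shift (suc k) = begin
      pow (tr k x + φ k x) q + x ≡⟨ cong (_+ x) (pow-q-+ _ _) ⟩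
      (pow (tr k x) q + pow (φ k x) q) + x ≡⟨ solve 3 (λ a b x → (a :+ b) :+ x := (a :+ x) :+ b) refl (pow (tr k x) q) (pow (φ k x) q) x ⟩
      (pow (tr k x) q + x) + pow (φ k x) q ≡⟨ cong₂ _+_ (shift k) (trans (sym (φ1≡pow _)) (φ-∘ 1 k x)) ⟩
      (tr k x + φ k x) + φ (suc k) x ∎

  poly-tr : ∀ k → Poly (q ℕ.^ k) (tr k)
  poly-tr k = go k k ℕₚ.≤-refl
    where
    go : ∀ d k → k ≤ d → Poly (q ℕ.^ d) (tr k)
    go d zero _ = poly-0 _
    go d (suc k) k<d = poly-+ (go d k (ℕₚ.<⇒≤ k<d))
      (let cs , eq = poly-monomial 1# (q^-< k<d) in cs , λ x → trans (sym (*-identityˡ _)) (eq x))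

  q*q^n′ : q ℕ.* q ℕ.^ n′ ≡ Q
  q*q^n′ = cong (q ℕ.^_) n≡

  q^n′<Q : q ℕ.^ n′ < Q
  q^n′<Q = q^-< (ℕₚ.≤-reflexive n≡)

  -- The trace is a monic polynomial of degree q^(n-1).
  trace-kernel : ∀ {m} (r : Fin m → Carrier) → (∀ {i j} → r i ≡ r j → i ≡ j) → (∀ i → trace (r i) ≡ 0#) → m ≤ q ℕ.^ n′
  trace-kernel {m} r inj zero-at with m ℕₚ.≤? q ℕ.^ n′
  ... | yes m≤ = m≤
  ... | no m≰ = contradiction (leading-coefficient-zero 1# (poly-tr n′) r inj (ℕₚ.≰⇒> m≰)
    λ i → trans (cong (tr n′ (r i) +_) (*-identityˡ _)) (trans (cong (λ k → tr k (r i)) n≡) (zero-at i))) 1≢0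

  opaque
    trace-nonzero : Σ[ x ∈ Carrier ] trace x ≢ 0#
    trace-nonzero with ∃? cardF (λ x → ¬? (trace x ≟ 0#))
    ... | yes found = found
    ... | no none = contradiction (trace-kernel el el-injective vanish) (ℕₚ.<⇒≱ q^n′<Q)
      where
      vanish : ∀ i → trace (el i) ≡ 0#
      vanish i with trace (el i) ≟ 0#
      ... | yes eq = eq
      ... | no neq = contradiction (el i , neq) none

  private
    module FqE = Enumeration (enumerate inFq?)

    -- The elements of F_q are roots of x^q - x.
    fq≤q : FqE.size ≤ q
    fq≤q with FqE.size ℕₚ.≤? q
    ... | yes ≤q = ≤q
    ... | no ≰q = contradiction (leading-coefficient-zero 1# (poly-monomial {i = 1} (- 1#) 2≤q) FqE.at FqE.at-injective (ℕₚ.≰⇒> ≰q)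
      λ i → trans (cong (λ z → (- 1#) * pow (FqE.at i) 1 + 1# * z) (FqE.at-sound i))
        (solve 1 (λ x → :-1 :* (x :* :1) :+ :1 :* x := :0) refl (FqE.at i))) 1≢0

    module Ker = Enumeration (enumerate (λ x → trace x ≟ 0#))

    -- A priori x^q - x might have fewer than q roots in the field. But the trace takes its values
    -- among these roots and has a kernel of at most q^(n-1) elements, so that q^n ≤ |F_q| q^(n-1).
    q≤fq : q ≤ FqE.size
    q≤fq = ℕₚ.*-cancelʳ-≤ q FqE.size (q ℕ.^ n′) {{q^≢0 n′}} (begin
      q ℕ.* q ℕ.^ n′ ≡⟨ q*q^n′ ⟩
      Q ≤⟨ injective⇒card≤ cardF (×-card (↔-id _) (↔-id _)) h h-injective ⟩
      FqE.size ℕ.* Ker.size ≤⟨ ℕₚ.*-monoʳ-≤ FqE.size (trace-kernel Ker.at Ker.at-injective Ker.at-sound) ⟩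
      FqE.size ℕ.* q ℕ.^ n′ ∎)
      where
      open ℕₚ.≤-Reasoning
      -- A section of the trace on its image; the default 0 is taken outside the image only.
      rep : Carrier → Carrier
      rep c with ∃? cardF (λ x → trace x ≟ c)
      ... | yes (x , _) = x
      ... | no _ = 0#
      trace-rep : ∀ x → trace (rep (trace x)) ≡ trace x
      trace-rep x with ∃? cardF (λ y → trace y ≟ trace x)
      ... | yes (_ , eq) = eq
      ... | no none = contradiction (x , refl) none
      diff : ∀ x → trace (x + (- rep (trace x))) ≡ 0#
      diff x = trans (tr-homo-+ n x _) (trans (cong (trace x +_) (trans (cong trace (solve 1 (λ r → :- r := :-1 :* r) refl _))
         (tr-scale n _ (inFq-neg inFq-1)))) (trans (cong (λ z → trace x + (- 1#) * z) (trace-rep x)) (solve 1 (λ t → t :+ :-1 :* t := :0) refl (trace x))))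
      h : Carrier → Fin FqE.size × Fin Ker.size
      h x = FqE.index (trace x) (trace-inFq x) , Ker.index (x + (- rep (trace x))) (diff x)
      h-injective : ∀ {x y} → h x ≡ h y → x ≡ y
      h-injective {x} {y} eq = trans (solve 2 (λ x r → x := (x :+ (:- r)) :+ r) refl x (rep (trace x)))
        (trans (cong₂ _+_ diff≡ (cong rep trace≡)) (solve 2 (λ x r → (x :+ (:- r)) :+ r := x) refl y (rep (trace y))))
        where
        trace≡ : trace x ≡ trace y
        trace≡ = trans (sym (FqE.at-index _ (trace-inFq x))) (trans (cong (FqE.at ∘ proj₁) eq) (FqE.at-index _ (trace-inFq y)))
        diff≡ : x + (- rep (trace x)) ≡ y + (- rep (trace y))
        diff≡ = trans (sym (Ker.at-index _ (diff x))) (trans (cong (Ker.at ∘ proj₂) eq) (Ker.at-index _ (diff y)))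

    fq≡q : FqE.size ≡ q
    fq≡q = ℕₚ.≤-antisym fq≤q q≤fq

  opaque
    fq : Fin q → Carrier
    fq = FqE.at ∘ Fin.cast (sym fq≡q)

    fq-injective : ∀ {i j} → fq i ≡ fq j → i ≡ j
    fq-injective eq = Finₚ.toℕ-injective (trans (sym (Finₚ.toℕ-cast _ _)) (trans (cong toℕ (FqE.at-injective eq)) (Finₚ.toℕ-cast _ _)))

    fq-inFq : ∀ i → InFq (fq i)
    fq-inFq i = FqE.at-sound _

    fq-index : ∀ c → InFq c → Fin q
    fq-index c c∈ = Fin.cast fq≡q (FqE.index c c∈)

    fq-fq-index : ∀ c c∈ → fq (fq-index c c∈) ≡ c
    fq-fq-index c c∈ = trans (cong FqE.at (Finₚ.cast-involutive (sym fq≡q) fq≡q (FqE.index c c∈))) (FqE.at-index c c∈)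

  -- An F_q-basis of F

  scal : ∀ {k} → (Fin k → Carrier) → (Fin k → Carrier) → Carrier
  scal c b = sum (λ i → c i * b i)

  sum-cong : ∀ {k} {f g : Fin k → Carrier} → (∀ i → f i ≡ g i) → sum f ≡ sum g
  sum-cong = ΣF.sum-cong-≗

  scal-affine : ∀ {k} (c d b : Fin k → Carrier) a → scal (λ i → c i + a * d i) b ≡ scal c b + a * scal d b
  scal-affine c d b a = begin
    sum (λ i → (c i + a * d i) * b i) ≡⟨ sum-cong (λ i → solve 4 (λ c a d b → (c :+ a :* d) :* b := c :* b :+ a :* (d :* b)) refl (c i) a (d i) (b i)) ⟩
    sum (λ i → c i * b i + a * (d i * b i)) ≡⟨ ΣF.∑-distrib-+ (λ i → c i * b i) (λ i → a * (d i * b i)) ⟩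
    scal c b + sum (λ i → a * (d i * b i)) ≡⟨ cong (scal c b +_) (sym (ΣF.*-distribˡ-sum a (λ i → d i * b i))) ⟩
    scal c b + a * scal d b ∎ where open ≡-Reasoning

  Independent : ∀ {k} → (Fin k → Carrier) → Set
  Independent {k} b = (c : Fin k → Carrier) → (∀ i → InFq (c i)) → scal c b ≡ 0# → ∀ i → c i ≡ 0#

  fqs : ∀ {k} → Vec (Fin q) k → Fin k → Carrier
  fqs v i = fq (Vec.lookup v i)

  fqs-index : ∀ {k} (c : Fin k → Carrier) → (∀ i → InFq (c i)) → Vec (Fin q) k
  fqs-index c c∈ = Vec.tabulate (λ i → fq-index (c i) (c∈ i))

  fqs-fqs-index : ∀ {k} (c : Fin k → Carrier) c∈ i → fqs (fqs-index c c∈) i ≡ c i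
  fqs-fqs-index c c∈ i = trans (cong fq (Vecₚ.lookup∘tabulate _ i)) (fq-fq-index (c i) (c∈ i))

  lookup-ext : ∀ {A : Set} {k} {v w : Vec A k} → (∀ i → Vec.lookup v i ≡ Vec.lookup w i) → v ≡ w
  lookup-ext {v = v} {w} eq = trans (sym (Vecₚ.tabulate∘lookup v)) (trans (Vecₚ.tabulate-cong eq) (Vecₚ.tabulate∘lookup w))

  fqs-injective : ∀ {k} {v w : Vec (Fin q) k} → (∀ i → fqs v i ≡ fqs w i) → v ≡ w
  fqs-injective eq = lookup-ext (λ i → fq-injective (eq i))

  opaque
    card-fqs : ∀ k → Vec (Fin q) k ↔ Fin (q ℕ.^ k)
    card-fqs = Vec-card (↔-id _)

  inFq-sub : ∀ {x y} → InFq x → InFq y → InFq (x + (- 1#) * y)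
  inFq-sub x∈ y∈ = inFq-+ x∈ (inFq-* (inFq-neg inFq-1) y∈)

  x-1*y≡0⇒x≡y : ∀ {x y} → x + (- 1#) * y ≡ 0# → x ≡ y
  x-1*y≡0⇒x≡y {x} {y} eq = x-y≡0⇒x≡y (trans (solve 2 (λ x y → x :+ (:- y) := x :+ :-1 :* y) refl x y) eq)

  x≡y⇒x-1*y≡0 : ∀ {x y} → x ≡ y → x + (- 1#) * y ≡ 0#
  x≡y⇒x-1*y≡0 {x} refl = solve 1 (λ x → x :+ :-1 :* x := :0) refl x

  scal-injective : ∀ {k} {b : Fin k → Carrier} → Independent b → ∀ {v w} → scal (fqs v) b ≡ scal (fqs w) b → v ≡ w
  scal-injective {b = b} ind {v} {w} eq = fqs-injective λ i → x-1*y≡0⇒x≡y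
    (ind (λ i → fqs v i + (- 1#) * fqs w i) (λ i → inFq-sub (fq-inFq _) (fq-inFq _))
      (trans (scal-affine (fqs v) (fqs w) b (- 1#)) (x≡y⇒x-1*y≡0 eq)) i)

  private
    cons : ∀ {k} → Carrier → (Fin k → Carrier) → Fin (suc k) → Carrier
    cons x b zero = x
    cons x b (suc i) = b i

    -- The span of k elements has at most q^k < q^n members.
    outside-span : ∀ {k} (b : Fin k → Carrier) → k < n → Σ[ x ∈ Carrier ] (∀ v → scal (fqs v) b ≢ x)
    outside-span {k} b k<n with ∃? cardF (λ x → ¬? (∃? (card-fqs k) (λ v → scal (fqs v) b ≟ x)))
    ... | yes (x , x∉) = x , λ v eq → x∉ (v , eq)
    ... | no none = contradiction (injective⇒card≤ cardF (card-fqs k) (proj₁ ∘ spanned)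
        (λ {x} {y} eq → trans (sym (proj₂ (spanned x))) (trans (cong (λ v → scal (fqs v) b) eq) (proj₂ (spanned y)))))
        (ℕₚ.<⇒≱ (q^-< k<n))
      where
      spanned : ∀ x → Σ[ v ∈ Vec (Fin q) k ] scal (fqs v) b ≡ x
      spanned x with ∃? (card-fqs k) (λ v → scal (fqs v) b ≟ x)
      ... | yes p = p
      ... | no ¬p = contradiction (x , ¬p) none

    independent-cons : ∀ {k} {b : Fin k → Carrier} x → Independent b → (∀ v → scal (fqs v) b ≢ x) → Independent (cons x b)
    independent-cons {k} {b} x ind x∉ c c∈ eq = λ { zero → c₀≡0 ; (suc i) → ind (c ∘ suc) (c∈ ∘ suc) rest i }
      where
      open ≡-Reasoning
      S = scal (c ∘ suc) b
      eq′ : c zero * x + S ≡ 0#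
      eq′ = eq
      c₀≡0 : c zero ≡ 0#
      c₀≡0 with c zero ≟ 0#
      ... | yes c₀≡0 = c₀≡0
      ... | no c₀≢0 = contradiction (begin
          scal (fqs (fqs-index d d∈)) b ≡⟨ sum-cong {f = λ i → fqs (fqs-index d d∈) i * b i} {λ i → d i * b i} (λ i → cong (_* b i) (fqs-fqs-index d d∈ i)) ⟩
          scal d b ≡⟨ sum-cong {f = λ i → d i * b i} {λ i → (- inv (c zero)) * (c (suc i) * b i)} (λ i → *-assoc (- inv (c zero)) (c (suc i)) (b i)) ⟩
          sum (λ i → (- inv (c zero)) * (c (suc i) * b i)) ≡⟨ sym (ΣF.*-distribˡ-sum (- inv (c zero)) (λ i → c (suc i) * b i)) ⟩
          (- inv (c zero)) * S ≡⟨ *-cancelˡ (c zero) c₀≢0 (begin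
              c zero * ((- inv (c zero)) * S) ≡⟨ solve 3 (λ c i s → c :* ((:- i) :* s) := (c :* i) :* (:- s)) refl (c zero) (inv (c zero)) S ⟩
              (c zero * inv (c zero)) * (- S) ≡⟨ cong (_* (- S)) (inv-r _ c₀≢0) ⟩
              1# * (- S) ≡⟨ *-identityˡ _ ⟩
              - S ≡⟨ sym (x+y≡0⇒x≡-y eq′) ⟩
              c zero * x ∎) ⟩
          x ∎) (x∉ (fqs-index d d∈))
        where
        d : Fin k → Carrier
        d i = (- inv (c zero)) * c (suc i)
        d∈ : ∀ i → InFq (d i)
        d∈ i = inFq-* (inFq-neg (inFq-inv c₀≢0 (c∈ zero))) (c∈ (suc i))
      rest : S ≡ 0#
      rest = trans (trans (sym (+-identityˡ S)) (cong (_+ S) (sym (trans (cong (_* x) c₀≡0) (zeroˡ x))))) eq′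

    independent-family : ∀ k → k ≤ n → Σ[ b ∈ (Fin k → Carrier) ] Independent b
    independent-family zero _ = (λ ()) , λ _ _ _ ()
    independent-family (suc k) k<n =
      let b , ind = independent-family k (ℕₚ.<⇒≤ k<n)
          x , x∉ = outside-span b k<n
      in cons x b , independent-cons x ind x∉

  opaque
    basis : Fin n → Carrier
    basis = proj₁ (independent-family n ℕₚ.≤-refl)

    basis-independent : Independent basis
    basis-independent = proj₂ (independent-family n ℕₚ.≤-refl)

    -- Independence makes the map from F_q^n to the field injective; both sides have q^n elements,
    -- so the n independent elements also span.
    coords : Carrier → Vec (Fin q) n
    coords x = proj₁ (injective⇒surjective (card-fqs n) cardF (λ v → scal (fqs v) basis) (scal-injective basis-independent) x)

    scal-coords : ∀ x → scal (fqs (coords x)) basis ≡ x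
    scal-coords x = proj₂ (injective⇒surjective (card-fqs n) cardF (λ v → scal (fqs v) basis) (scal-injective basis-independent) x)

  -- q-polynomials

  L : ∀ {k} → (Fin k → Carrier) → Carrier → Carrier
  L a x = sum (λ i → a i * φ (toℕ i) x)

  poly-L : ∀ {k} (a : Fin k → Carrier) → Poly (q ℕ.^ k) (L a)
  poly-L a = poly-sum (λ i x → a i * φ (toℕ i) x) (λ i → poly-monomial (a i) (q^-< (Finₚ.toℕ<n i)))

  L-init-last : ∀ {k} (a : Fin (suc k) → Carrier) x → L a x ≡ L (a ∘ inject₁) x + a (fromℕ k) * φ k x
  L-init-last {k} a x = trans (ΣF.sum-init-last (λ i → a i * φ (toℕ i) x))
    (cong₂ _+_ (sum-cong λ i → cong (λ j → a (inject₁ i) * φ j x) (Finₚ.toℕ-inject₁ i)) (cong (λ j → a (fromℕ k) * φ j x) (Finₚ.toℕ-fromℕ k)))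

  -- As k ≤ n, the polynomial has degree below q^n and vanishes at q^n elements. The coefficients
  -- are removed from the top one downwards.
  L-independent : ∀ {k} (a : Fin k → Carrier) → k ≤ n → (∀ x → L a x ≡ 0#) → ∀ i → a i ≡ 0#
  L-independent {suc k} a k<n L≡0 i with view i
  ... | ‵fromℕ = leading-coefficient-zero _ (poly-L (a ∘ inject₁)) el el-injective (q^-< k<n) (λ j → trans (sym (L-init-last a (el j))) (L≡0 (el j)))
  ... | ‵inject₁ j = L-independent (a ∘ inject₁) (ℕₚ.<⇒≤ k<n) (λ x → begin
      L (a ∘ inject₁) x ≡⟨ sym (+-identityʳ _) ⟩
      L (a ∘ inject₁) x + 0# ≡⟨ cong (L (a ∘ inject₁) x +_) (sym (trans (cong (_* φ k x) top≡0) (zeroˡ _))) ⟩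
      L (a ∘ inject₁) x + a (fromℕ k) * φ k x ≡⟨ sym (L-init-last a x) ⟩
      L a x ≡⟨ L≡0 x ⟩
      0# ∎) j
    where
    open ≡-Reasoning
    top≡0 : a (fromℕ k) ≡ 0#
    top≡0 = leading-coefficient-zero _ (poly-L (a ∘ inject₁)) el el-injective (q^-< k<n) (λ j → trans (sym (L-init-last a (el j))) (L≡0 (el j)))

  FqLinear : (Carrier → Carrier) → Set
  FqLinear f = (∀ x y → f (x + y) ≡ f x + f y) × (∀ c x → InFq c → f (c * x) ≡ c * f x)

  linear-0 : ∀ {f} → FqLinear f → f 0# ≡ 0#
  linear-0 {f} (_ , f*) = trans (cong f (sym (zeroˡ 0#))) (trans (f* 0# 0# inFq-0) (zeroˡ _))

  linear-scal : ∀ {f} → FqLinear f → ∀ {k} (c b : Fin k → Carrier) → (∀ i → InFq (c i)) → f (scal c b) ≡ scal c (f ∘ b)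
  linear-scal lin {zero} c b c∈ = linear-0 lin
  linear-scal lin@(f+ , f*) {suc k} c b c∈ = trans (f+ _ _) (cong₂ _+_ (f* _ _ (c∈ zero)) (linear-scal lin (c ∘ suc) (b ∘ suc) (c∈ ∘ suc)))

  L-linear : ∀ {k} (a : Fin k → Carrier) → FqLinear (L a)
  L-linear a =
    (λ x y → trans (sum-cong λ i → trans (cong (a i *_) (φ-homo-+ (toℕ i) x y)) (distribˡ _ _ _)) (ΣF.∑-distrib-+ (λ i → a i * φ (toℕ i) x) (λ i → a i * φ (toℕ i) y))) ,
    (λ c x c∈ → trans (sum-cong λ i → trans (cong (a i *_) (trans (φ-homo-* (toℕ i) c x) (cong (_* φ (toℕ i) x) (inFq-φ c∈ (toℕ i)))))
       (solve 3 (λ a c p → a :* (c :* p) := c :* (a :* p)) refl (a i) c _)) (sym (ΣF.*-distribˡ-sum c (λ i → a i * φ (toℕ i) x))))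

  linear-determined : ∀ {f g} → FqLinear f → FqLinear g → (∀ i → f (basis i) ≡ g (basis i)) → ∀ x → f x ≡ g x
  linear-determined {f} {g} lf lg eq x = begin
    f x ≡⟨ cong f (sym (scal-coords x)) ⟩
    f (scal c basis) ≡⟨ linear-scal lf c basis (λ _ → fq-inFq _) ⟩
    scal c (f ∘ basis) ≡⟨ sum-cong (λ i → cong (c i *_) (eq i)) ⟩
    scal c (g ∘ basis) ≡⟨ sym (linear-scal lg c basis (λ _ → fq-inFq _)) ⟩
    g (scal c basis) ≡⟨ cong g (scal-coords x) ⟩
    g x ∎
    where
    open ≡-Reasoning
    c = fqs (coords x)

  opaque
    -- Sending the n coefficients of a q-polynomial to its values on the basis is an injective map
    -- of F^n to itself, by independence of the Frobenius maps. It is therefore onto, so the values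
    -- of `f` on the basis are attained.
    q-polynomial : ∀ {f} → FqLinear f → Σ[ a ∈ (Fin n → Carrier) ] (∀ x → f x ≡ L a x)
    q-polynomial {f} lf =
      let v , eq = injective⇒surjective (Vec-card cardF n) (Vec-card cardF n) values values-injective (Vec.tabulate (f ∘ basis))
          a = Vec.lookup v
      in a , linear-determined lf (L-linear a) λ i →
         trans (sym (Vecₚ.lookup∘tabulate _ i)) (trans (cong (λ w → Vec.lookup w i) (sym eq)) (Vecₚ.lookup∘tabulate _ i))
      where
      values : Vec Carrier n → Vec Carrier n
      values v = Vec.tabulate (L (Vec.lookup v) ∘ basis)
      values-injective : ∀ {v w} → values v ≡ values w → v ≡ w
      values-injective {v} {w} eq = lookup-ext λ i → x-1*y≡0⇒x≡y (L-independent
        (λ i → Vec.lookup v i + (- 1#) * Vec.lookup w i) ℕₚ.≤-refl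
        (λ x → trans (scal-affine (Vec.lookup v) (Vec.lookup w) (λ i → φ (toℕ i) x) (- 1#))
          (x≡y⇒x-1*y≡0 (linear-determined (L-linear (Vec.lookup v)) (L-linear (Vec.lookup w)) (λ i →
             trans (sym (Vecₚ.lookup∘tabulate _ i)) (trans (cong (λ w → Vec.lookup w i) eq) (Vecₚ.lookup∘tabulate _ i))) x))) i)

  -- Digits in base q

  val : ∀ {k} → Vec ℕ k → ℕ
  val [] = 0
  val (c ∷ cs) = c ℕ.+ q ℕ.* val cs

  Digits : ∀ {k} → Vec ℕ k → Set
  Digits cs = ∀ i → Vec.lookup cs i < q

  private
    module NS = +-*-Solver

  -- A carry replaces q units at one place by a single unit at the next one, and q ≥ 2 makes the
  -- digit sum drop. The number `o` counts units pushed out of the top place, each of weight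
  -- q^(k+1).
  carry : ∀ {k} (cs : Vec ℕ (suc k)) → Digits cs ⊎
    (Σ[ ds ∈ Vec ℕ (suc k) ] Σ[ o ∈ ℕ ] (val cs ≡ val ds ℕ.+ q ℕ.^ suc k ℕ.* o × o ℕ.+ Vec.sum ds < Vec.sum cs))
  carry (c ∷ []) with c ℕₚ.<? q
  ... | yes c<q = inj₁ λ { zero → c<q }
  ... | no c≮q = inj₂ (c ℕ.∸ q ∷ [] , 1 , trans (cong (ℕ._+ q ℕ.* 0) (sym eq))
      (NS.solve 2 (λ d r → (d NS.:+ r) NS.:+ r NS.:* NS.con 0 NS.:= (d NS.:+ r NS.:* NS.con 0) NS.:+ (r NS.:* NS.con 1) NS.:* NS.con 1) refl (c ℕ.∸ q) q) ,
      lt)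
    where
    eq : c ℕ.∸ q ℕ.+ q ≡ c
    eq = ℕₚ.m∸n+n≡m (ℕₚ.≮⇒≥ c≮q)
    open ℕₚ.≤-Reasoning
    lt : 1 ℕ.+ (c ℕ.∸ q ℕ.+ 0) < c ℕ.+ 0
    lt = begin-strict
      1 ℕ.+ (c ℕ.∸ q ℕ.+ 0) ≡⟨ NS.solve 1 (λ d → NS.con 1 NS.:+ (d NS.:+ NS.con 0) NS.:= d NS.:+ NS.con 1) refl (c ℕ.∸ q) ⟩
      c ℕ.∸ q ℕ.+ 1 <⟨ ℕₚ.+-monoʳ-< (c ℕ.∸ q) 2≤q ⟩
      c ℕ.∸ q ℕ.+ q ≡⟨ trans eq (sym (ℕₚ.+-identityʳ c)) ⟩
      c ℕ.+ 0 ∎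
  carry {suc k} (c ∷ d ∷ ds) with c ℕₚ.<? q
  ... | no c≮q = inj₂ (c ℕ.∸ q ∷ suc d ∷ ds , 0 , trans (cong (ℕ._+ q ℕ.* (d ℕ.+ q ℕ.* val ds)) (sym eq))
      (NS.solve 5 (λ e r d v z → (e NS.:+ r) NS.:+ r NS.:* (d NS.:+ r NS.:* v) NS.:=
          (e NS.:+ r NS.:* (NS.con 1 NS.:+ d NS.:+ r NS.:* v)) NS.:+ z NS.:* NS.con 0) refl (c ℕ.∸ q) q d (val ds) (q ℕ.^ suc (suc k))) , lt)
    where
    eq : c ℕ.∸ q ℕ.+ q ≡ c
    eq = ℕₚ.m∸n+n≡m (ℕₚ.≮⇒≥ c≮q)
    open ℕₚ.≤-Reasoning
    lt : c ℕ.∸ q ℕ.+ (suc d ℕ.+ Vec.sum ds) < c ℕ.+ (d ℕ.+ Vec.sum ds)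
    lt = begin-strict
      c ℕ.∸ q ℕ.+ (suc d ℕ.+ Vec.sum ds) ≡⟨ NS.solve 3 (λ e d s → e NS.:+ (NS.con 1 NS.:+ d NS.:+ s) NS.:= (e NS.:+ NS.con 1) NS.:+ (d NS.:+ s)) refl (c ℕ.∸ q) d (Vec.sum ds) ⟩
      (c ℕ.∸ q ℕ.+ 1) ℕ.+ (d ℕ.+ Vec.sum ds) <⟨ ℕₚ.+-monoˡ-< (d ℕ.+ Vec.sum ds) (ℕₚ.+-monoʳ-< (c ℕ.∸ q) 2≤q) ⟩
      (c ℕ.∸ q ℕ.+ q) ℕ.+ (d ℕ.+ Vec.sum ds) ≡⟨ cong (ℕ._+ (d ℕ.+ Vec.sum ds)) eq ⟩
      c ℕ.+ (d ℕ.+ Vec.sum ds) ∎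
  ... | yes c<q with carry (d ∷ ds)
  ... | inj₁ digits = inj₁ λ { zero → c<q ; (suc i) → digits i }
  ... | inj₂ (es , o , val≡ , lt) = inj₂ (c ∷ es , o , trans (cong (λ v → c ℕ.+ q ℕ.* v) val≡)
      (NS.solve 5 (λ c r v p o → c NS.:+ r NS.:* (v NS.:+ p NS.:* o) NS.:= (c NS.:+ r NS.:* v) NS.:+ (r NS.:* p) NS.:* o) refl c q (val es) (q ℕ.^ suc k) o) ,
      subst (ℕ._< c ℕ.+ (d ℕ.+ Vec.sum ds)) (NS.solve 3 (λ c o s → c NS.:+ (o NS.:+ s) NS.:= o NS.:+ (c NS.:+ s)) refl c o (Vec.sum es)) (ℕₚ.+-monoʳ-< c lt))

  pow-Q^ : ∀ x o → pow x (Q ℕ.* o) ≡ pow x o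
  pow-Q^ x o = trans (pow-* x Q o) (cong (λ z → pow z o) (Fermat x))

  -- With n places the overflow has weight Q, and x^Q = x lets it re-enter at the lowest place. The
  -- falling digit sum gives termination, and it is recorded in the last component: either nothing
  -- was carried or the digit sum became strictly smaller.
  normalise : ∀ {k} → suc k ≡ n → (cs : Vec ℕ (suc k)) → Acc _<_ (Vec.sum cs) →
    Σ[ ds ∈ Vec ℕ (suc k) ] (Digits ds × (∀ x → pow x (val ds) ≡ pow x (val cs)) × (ds ≡ cs ⊎ Vec.sum ds < Vec.sum cs))
  normalise {k} k≡ cs (acc rs) with carry cs
  ... | inj₁ digits = cs , digits , (λ _ → refl) , inj₁ refl
  ... | inj₂ (d ∷ ds , o , val≡ , lt) =
    let es , digits , pow≡ , small = normalise k≡ (o ℕ.+ d ∷ ds) (rs lt′)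
    in es , digits , (λ x → trans (pow≡ x) (reduce x)) , inj₂ (shrink small)
    where
    lt′ : (o ℕ.+ d) ℕ.+ Vec.sum ds < Vec.sum cs
    lt′ = subst (_< Vec.sum cs) (sym (ℕₚ.+-assoc o d _)) lt
    shrink : ∀ {es} → es ≡ (o ℕ.+ d ∷ ds) ⊎ Vec.sum es < (o ℕ.+ d) ℕ.+ Vec.sum ds → Vec.sum es < Vec.sum cs
    shrink (inj₁ refl) = lt′
    shrink (inj₂ es<) = ℕₚ.<-trans es< lt′
    reduce : ∀ x → pow x (val (o ℕ.+ d ∷ ds)) ≡ pow x (val cs)
    reduce x = begin
      pow x ((o ℕ.+ d) ℕ.+ q ℕ.* val ds) ≡⟨ cong (pow x) (ℕₚ.+-assoc o d _) ⟩
      pow x (o ℕ.+ val (d ∷ ds)) ≡⟨ pow-homo-+ x o _ ⟩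
      pow x o * pow x (val (d ∷ ds)) ≡⟨ cong (_* pow x (val (d ∷ ds))) (sym (pow-Q^ x o)) ⟩
      pow x (Q ℕ.* o) * pow x (val (d ∷ ds)) ≡⟨ *-comm _ _ ⟩
      pow x (val (d ∷ ds)) * pow x (Q ℕ.* o) ≡⟨ sym (pow-homo-+ x (val (d ∷ ds)) _) ⟩
      pow x (val (d ∷ ds) ℕ.+ Q ℕ.* o) ≡⟨ cong (λ j → pow x (val (d ∷ ds) ℕ.+ q ℕ.^ j ℕ.* o)) (sym k≡) ⟩
      pow x (val (d ∷ ds) ℕ.+ q ℕ.^ suc k ℕ.* o) ≡⟨ cong (pow x) (sym val≡) ⟩
      pow x (val cs) ∎ where open ≡-Reasoning

  val-< : ∀ {k} (cs : Vec ℕ k) → Digits cs → val cs < q ℕ.^ k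
  val-< [] _ = s≤s z≤n
  val-< {suc k} (c ∷ cs) digits = begin-strict
    c ℕ.+ q ℕ.* val cs <⟨ ℕₚ.+-monoˡ-< (q ℕ.* val cs) (digits zero) ⟩
    q ℕ.+ q ℕ.* val cs ≡⟨ sym (ℕₚ.*-suc q (val cs)) ⟩
    q ℕ.* suc (val cs) ≤⟨ ℕₚ.*-monoʳ-≤ q (val-< cs (digits ∘ suc)) ⟩
    q ℕ.* q ℕ.^ k ∎ where open ℕₚ.≤-Reasoning

  digits-unique : ∀ {k} (cs ds : Vec ℕ k) → Digits cs → Digits ds → val cs ≡ val ds → cs ≡ ds
  digits-unique [] [] _ _ _ = refl
  digits-unique (c ∷ cs) (d ∷ ds) dc dd eq with
    trans (sym (m<n⇒m%n≡m (dc zero))) (trans (sym ([m+kn]%n≡m%n c (val cs) q)) (trans (cong (ℕ._% q) eq′) (trans ([m+kn]%n≡m%n d (val ds) q) (m<n⇒m%n≡m (dd zero)))))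
    where
    eq′ : c ℕ.+ val cs ℕ.* q ≡ d ℕ.+ val ds ℕ.* q
    eq′ = trans (cong (c ℕ.+_) (ℕₚ.*-comm (val cs) q)) (trans eq (cong (d ℕ.+_) (ℕₚ.*-comm q (val ds))))
  ... | refl = cong (c ∷_) (digits-unique cs ds (dc ∘ suc) (dd ∘ suc) (ℕₚ.*-cancelˡ-≡ _ _ q (ℕₚ.+-cancelˡ-≡ c _ _ eq)))

  -- Monomials given by multisets of Frobenius exponents

  count : ∀ {k m} → (Fin m → Fin k) → Vec ℕ k
  count {k} {zero} ks = Vec.replicate k 0
  count {k} {suc m} ks = Vec.updateAt (count (ks ∘ suc)) (ks zero) suc

  val-updateAt : ∀ {k} (cs : Vec ℕ k) i → val (Vec.updateAt cs i suc) ≡ q ℕ.^ toℕ i ℕ.+ val cs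
  val-updateAt (c ∷ cs) zero = refl
  val-updateAt (c ∷ cs) (suc i) = trans (cong (λ v → c ℕ.+ q ℕ.* v) (val-updateAt cs i))
    (NS.solve 4 (λ c r p v → c NS.:+ r NS.:* (p NS.:+ v) NS.:= r NS.:* p NS.:+ (c NS.:+ r NS.:* v)) refl c q (q ℕ.^ toℕ i) (val cs))

  sum-updateAt : ∀ {k} (cs : Vec ℕ k) i → Vec.sum (Vec.updateAt cs i suc) ≡ suc (Vec.sum cs)
  sum-updateAt (c ∷ cs) zero = refl
  sum-updateAt (c ∷ cs) (suc i) = trans (cong (c ℕ.+_) (sum-updateAt cs i)) (ℕₚ.+-suc c _)

  val-0s : ∀ k → val (Vec.replicate k 0) ≡ 0
  val-0s zero = refl
  val-0s (suc k) = trans (cong (q ℕ.*_) (val-0s k)) (ℕₚ.*-zeroʳ q)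

  sum-0s : ∀ k → Vec.sum (Vec.replicate k 0) ≡ 0
  sum-0s zero = refl
  sum-0s (suc k) = sum-0s k

  sum-count : ∀ {k m} (ks : Fin m → Fin k) → Vec.sum (count ks) ≡ m
  sum-count {k} {zero} ks = sum-0s k
  sum-count {k} {suc m} ks = trans (sum-updateAt (count (ks ∘ suc)) (ks zero)) (cong suc (sum-count (ks ∘ suc)))

  pow-count : ∀ {k m} (ks : Fin m → Fin k) x → pow x (val (count ks)) ≡ ∏ (λ l → φ (toℕ (ks l)) x)
  pow-count {k} {zero} ks x = cong (pow x) (val-0s k)
  pow-count {k} {suc m} ks x = trans (cong (pow x) (val-updateAt (count (ks ∘ suc)) (ks zero)))
    (trans (pow-homo-+ x (q ℕ.^ toℕ (ks zero)) _) (cong (φ (toℕ (ks zero)) x *_) (pow-count (ks ∘ suc) x)))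

  val-count≥1 : ∀ {k m} (ks : Fin m → Fin k) → 1 ≤ m → 1 ≤ val (count ks)
  val-count≥1 {k} {suc m} ks _ = subst (1 ≤_) (sym (val-updateAt (count (ks ∘ suc)) (ks zero)))
    (ℕₚ.≤-trans (ℕ.>-nonZero⁻¹ _ {{q^≢0 (toℕ (ks zero))}}) (ℕₚ.m≤m+n _ _))

  count-hit : ∀ {k m} (ks : Fin m → Fin k) l → 1 ≤ Vec.lookup (count ks) (ks l)
  count-hit ks zero = subst (1 ≤_) (sym (Vecₚ.lookup∘updateAt (ks zero) (count (ks ∘ suc)))) (s≤s z≤n)
  count-hit ks (suc l) with ks (suc l) Finₚ.≟ ks zero
  ... | yes eq = subst (λ i → 1 ≤ Vec.lookup (count ks) i) (sym eq) (count-hit ks zero)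
  ... | no neq = subst (1 ≤_) (sym (Vecₚ.lookup∘updateAt′ (ks (suc l)) (ks zero) neq (count (ks ∘ suc)))) (count-hit (ks ∘ suc) l)

  count-miss : ∀ {k m} (ks : Fin m → Fin k) i → (∀ l → ks l ≢ i) → Vec.lookup (count ks) i ≡ 0
  count-miss {m = zero} ks i _ = Vecₚ.lookup-replicate i 0
  count-miss {m = suc m} ks i miss = trans (Vecₚ.lookup∘updateAt′ i (ks zero) (miss zero ∘ sym) (count (ks ∘ suc))) (count-miss (ks ∘ suc) i (miss ∘ suc))

  count-injective : ∀ {k m} (ks : Fin m → Fin k) → (∀ {i j} → ks i ≡ ks j → i ≡ j) → ∀ i → Vec.lookup (count ks) i ≤ 1
  count-injective {m = zero} ks inj i = subst (_≤ 1) (sym (Vecₚ.lookup-replicate i 0)) z≤n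
  count-injective {m = suc m} ks inj i with i Finₚ.≟ ks zero
  ... | yes refl = ℕₚ.≤-reflexive (trans (Vecₚ.lookup∘updateAt (ks zero) (count (ks ∘ suc)))
      (cong suc (count-miss (ks ∘ suc) (ks zero) (λ l eq → Finₚ.0≢1+n (sym (inj eq))))))
  ... | no neq = subst (_≤ 1) (sym (Vecₚ.lookup∘updateAt′ i (ks zero) neq (count (ks ∘ suc)))) (count-injective (ks ∘ suc) (Finₚ.suc-injective ∘ inj) i)

  -- Since `vs` is injective, the exponent on the right has digits 0 and 1. Normalising the exponent
  -- on the left leads to the same digits, with digit sum m. The digit sum was m from the start, so
  -- nothing was carried and the two multisets coincide.
  monomial-support : ∀ {k m} → k ≡ n → (ks vs : Fin m → Fin k) → (∀ {i j} → vs i ≡ vs j → i ≡ j) → 1 ≤ m →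
    (∀ x → ∏ (λ l → φ (toℕ (ks l)) x) ≡ ∏ (λ l → φ (toℕ (vs l)) x)) → ∀ l → Σ[ l′ ∈ Fin m ] vs l′ ≡ ks l
  monomial-support {zero} k≡n _ _ _ _ _ = contradiction (sym k≡n) (ℕ.≢-nonZero⁻¹ n)
  monomial-support {suc k} {m} k≡n ks vs inj 1≤m eq l with normalise k≡n (count ks) (<-wellFounded _)
  ... | ds , digits , pow≡ , small with Finₚ.any? (λ l′ → vs l′ Finₚ.≟ ks l)
  ... | yes hit = hit
  ... | no none = contradiction (subst (1 ≤_) (trans (cong (λ v → Vec.lookup v (ks l)) (count≡ small)) (count-miss vs (ks l) (λ l′ e → none (l′ , e)))) (count-hit ks l)) λ ()
    where
    digits′ : Digits (count vs)
    digits′ i = ℕₚ.≤-trans (s≤s (count-injective vs inj i)) 2≤q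
    pow-eq : ∀ x → pow x (val ds) ≡ pow x (val (count vs))
    pow-eq x = trans (pow≡ x) (trans (pow-count ks x) (trans (eq x) (sym (pow-count vs x))))
    positive : 1 ≤ val ds
    positive with val ds | pow-eq
    ... | suc _ | _ = s≤s z≤n
    ... | zero | p = contradiction (trans (p 0#) (pow-0# _ {{ℕ.>-nonZero (val-count≥1 vs 1≤m)}})) 1≢0
    bound : ∀ {v : ℕ} → v < q ℕ.^ suc k → v < Q
    bound {v} = subst (λ j → v < q ℕ.^ j) k≡n
    ds≡ : ds ≡ count vs
    ds≡ = digits-unique ds (count vs) digits digits′
      (pow-injective positive (bound (val-< ds digits)) (val-count≥1 vs 1≤m) (bound (val-< (count vs) digits′)) pow-eq)
    count≡ : ds ≡ count ks ⊎ Vec.sum ds < Vec.sum (count ks) → count ks ≡ count vs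
    count≡ (inj₁ e) = trans (sym e) ds≡
    count≡ (inj₂ lt) = contradiction (trans (cong Vec.sum ds≡) (trans (sum-count vs) (sym (sum-count ks)))) (ℕₚ.<⇒≢ lt)

  -- Congruences modulo n

  mod-cancel : ∀ a s → (a ℕ.+ s) % n ≡ a % n → n ∣ s
  mod-cancel a s eq = ∣.∣m+n∣m⇒∣n {m = (a / n) ℕ.* n} (subst (n ∣_) eq′ (∣.n∣m*n ((a ℕ.+ s) / n))) (∣.n∣m*n (a / n))
    where
    open ≡-Reasoning
    eq′ : ((a ℕ.+ s) / n) ℕ.* n ≡ (a / n) ℕ.* n ℕ.+ s
    eq′ = ℕₚ.+-cancelˡ-≡ (a % n) _ _ (begin
      a % n ℕ.+ ((a ℕ.+ s) / n) ℕ.* n ≡⟨ cong (ℕ._+ ((a ℕ.+ s) / n) ℕ.* n) (sym eq) ⟩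
      (a ℕ.+ s) % n ℕ.+ ((a ℕ.+ s) / n) ℕ.* n ≡⟨ sym (m≡m%n+[m/n]*n (a ℕ.+ s) n) ⟩
      a ℕ.+ s ≡⟨ cong (ℕ._+ s) (m≡m%n+[m/n]*n a n) ⟩
      (a % n ℕ.+ (a / n) ℕ.* n) ℕ.+ s ≡⟨ ℕₚ.+-assoc (a % n) _ s ⟩
      a % n ℕ.+ ((a / n) ℕ.* n ℕ.+ s) ∎)

  mod-unique : ∀ a {i j} → i < n → j < n → (a ℕ.+ i) % n ≡ (a ℕ.+ j) % n → i ≡ j
  mod-unique a {i} {j} i<n j<n eq = [ (λ i≤j → ordered i≤j j<n (sym eq)) , (λ j≤i → sym (ordered j≤i i<n eq)) ]′ (ℕₚ.≤-total i j)
    where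
    ordered : ∀ {i j} → i ≤ j → j < n → (a ℕ.+ j) % n ≡ (a ℕ.+ i) % n → i ≡ j
    ordered {i} {j} i≤j j<n eq with j ℕ.∸ i in d≡ | mod-cancel (a ℕ.+ i) (j ℕ.∸ i) (trans (cong (_% n) (trans (ℕₚ.+-assoc a i _) (cong (a ℕ.+_) (ℕₚ.m+[n∸m]≡n i≤j)))) eq)
    ... | zero | _ = ℕₚ.≤-antisym i≤j (ℕₚ.m∸n≡0⇒m≤n d≡)
    ... | suc d | n∣ = contradiction (∣.∣⇒≤ n∣) (ℕₚ.<⇒≱ (ℕₚ.≤-<-trans (subst (_≤ j) d≡ (ℕₚ.m∸n≤m j i)) j<n))

  mod-+ˡ : ∀ {a b} c → a % n ≡ b % n → (a ℕ.+ c) % n ≡ (b ℕ.+ c) % n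
  mod-+ˡ {a} {b} c eq = begin
    (a ℕ.+ c) % n ≡⟨ %-distribˡ-+ a c n ⟩
    (a % n ℕ.+ c % n) % n ≡⟨ cong (λ z → (z ℕ.+ c % n) % n) eq ⟩
    (b % n ℕ.+ c % n) % n ≡⟨ sym (%-distribˡ-+ b c n) ⟩
    (b ℕ.+ c) % n ∎ where open ≡-Reasoning

  residue : ℕ → Fin n
  residue a = Fin.fromℕ< (m%n<n a n)

  toℕ-residue : ∀ a → toℕ (residue a) ≡ a % n
  toℕ-residue a = Finₚ.toℕ-fromℕ< (m%n<n a n)

  residue-≡ : ∀ {a b} → residue a ≡ residue b → a % n ≡ b % n
  residue-≡ {a} {b} eq = trans (sym (toℕ-residue a)) (trans (cong toℕ eq) (toℕ-residue b))

  φ-*n : ∀ k x → φ (k ℕ.* n) x ≡ x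
  φ-*n zero x = φ-zero x
  φ-*n (suc k) x = trans (sym (φ-∘ n (k ℕ.* n) x)) (trans (φ-n _) (φ-*n k x))

  φ-% : ∀ i x → φ (i % n) x ≡ φ i x
  φ-% i x = trans (cong (φ (i % n)) (sym (φ-*n (i / n) x))) (trans (φ-∘ (i % n) (i / n ℕ.* n) x) (cong (λ j → φ j x) (sym (m≡m%n+[m/n]*n i n))))

  φ-residue : ∀ i x → φ (toℕ (residue i)) x ≡ φ i x
  φ-residue i x = trans (cong (λ j → φ j x) (toℕ-residue i)) (φ-% i x)

  φ-∣ : ∀ {i} x → n ∣ i → φ i x ≡ x
  φ-∣ x (divides k refl) = φ-*n k x

  -- Expansion of a product of sums over words

  ∏-cong : ∀ {k} {f g : Fin k → Carrier} → (∀ i → f i ≡ g i) → ∏ f ≡ ∏ g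
  ∏-cong = ΠF.sum-cong-≗

  ∏-* : ∀ {k} (f g : Fin k → Carrier) → ∏ (λ i → f i * g i) ≡ ∏ f * ∏ g
  ∏-* = ΠF.∑-distrib-+

  ∏-has-0 : ∀ {k} (f : Fin k → Carrier) i → f i ≡ 0# → ∏ f ≡ 0#
  ∏-has-0 f zero eq = trans (cong (_* ∏ (f ∘ suc)) eq) (zeroˡ _)
  ∏-has-0 f (suc i) eq = trans (cong (f zero *_) (∏-has-0 (f ∘ suc) i eq)) (zeroʳ _)

  -- A word selects one summand from each of the m factors of a product of sums.
  ∑words : ∀ m → (Vec (Fin n) m → Carrier) → Carrier
  ∑words zero h = h []
  ∑words (suc m) h = sum (λ i → ∑words m (λ g → h (i ∷ g)))

  ∑words-cong : ∀ m {f g : Vec (Fin n) m → Carrier} → (∀ w → f w ≡ g w) → ∑words m f ≡ ∑words m g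
  ∑words-cong zero eq = eq []
  ∑words-cong (suc m) eq = sum-cong λ i → ∑words-cong m λ w → eq (i ∷ w)

  ∑words-*ˡ : ∀ m c (h : Vec (Fin n) m → Carrier) → c * ∑words m h ≡ ∑words m (λ w → c * h w)
  ∑words-*ˡ zero c h = refl
  ∑words-*ˡ (suc m) c h = trans (ΣF.*-distribˡ-sum c (λ i → ∑words m (λ g → h (i ∷ g)))) (sum-cong {f = λ i → c * ∑words m (λ g → h (i ∷ g))} λ i → ∑words-*ˡ m c (λ g → h (i ∷ g)))

  ∑F-∑words : ∀ m (h : Vec (Fin n) m → Carrier → Carrier) → ∑F (λ x → ∑words m (λ w → h w x)) ≡ ∑words m (λ w → ∑F (h w))
  ∑F-∑words zero h = refl
  ∑F-∑words (suc m) h = trans (ΣF.∑-comm (λ j i → ∑words m (λ w → h (i ∷ w) (el j)))) (sum-cong λ i → ∑F-∑words m (λ w → h (i ∷ w)))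

  ∏-∑ : ∀ {m} (A : Fin m → Fin n → Carrier) → ∏ (λ l → sum (A l)) ≡ ∑words m (λ w → ∏ (λ l → A l (Vec.lookup w l)))
  ∏-∑ {zero} A = refl
  ∏-∑ {suc m} A = trans (cong (sum (A zero) *_) (∏-∑ (A ∘ suc)))
    (trans (ΣF.*-distribʳ-sum (∑words m (λ w → ∏ (λ l → A (suc l) (Vec.lookup w l)))) (A zero))
      (sum-cong λ i → ∑words-*ˡ m (A zero i) _))

  ∑words-0 : ∀ m {h : Vec (Fin n) m → Carrier} → (∀ w → h w ≡ 0#) → ∑words m h ≡ 0#
  ∑words-0 zero h≡0 = h≡0 []
  ∑words-0 (suc m) h≡0 = sum-ε +-commutativeMonoid _ λ i → ∑words-0 m λ w → h≡0 (i ∷ w)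

  ∑words-single : ∀ m (h : Vec (Fin n) m → Carrier) w → (∀ v → v ≢ w → h v ≡ 0#) → ∑words m h ≡ h w
  ∑words-single zero h [] _ = refl
  ∑words-single (suc m) h (i ∷ w) h≡0 = trans
    (sum-single +-commutativeMonoid (λ j → ∑words m (λ v → h (j ∷ v))) i λ j j≢i → ∑words-0 m λ v → h≡0 (j ∷ v) (j≢i ∘ Vecₚ.∷-injectiveˡ))
    (∑words-single m (λ v → h (i ∷ v)) w λ v v≢w → h≡0 (i ∷ v) (v≢w ∘ Vecₚ.∷-injectiveʳ))

  -- Character sums

  inv-* : ∀ {x y} → x ≢ 0# → y ≢ 0# → inv (x * y) ≡ inv x * inv y
  inv-* {x} {y} x≢0 y≢0 = *-cancelˡ (x * y) (*-≢0 x≢0 y≢0) (trans (inv-r _ (*-≢0 x≢0 y≢0))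
    (sym (trans (solve 4 (λ x y a b → (x :* y) :* (a :* b) := (x :* a) :* (y :* b)) refl x y (inv x) (inv y))
      (trans (cong₂ _*_ (inv-r x x≢0) (inv-r y y≢0)) (*-identityˡ 1#)))))

  -- A multiplicative character with values in the field itself, extended by 0.
  Character : (Carrier → Carrier) → Set
  Character χ = χ 0# ≡ 0# × (∀ x y → x ≢ 0# → y ≢ 0# → χ (x * y) ≡ χ x * χ y)

  -- Substituting x y for y multiplies the sum by `χ x`.
  character-sum : ∀ {χ} → Character χ → ∑F χ ≢ 0# → ∀ x → x ≢ 0# → χ x ≡ 1#
  character-sum {χ} (χ0 , χ*) ∑≢0 x x≢0 = *-cancelˡ (∑F χ) ∑≢0 (begin
    ∑F χ * χ x ≡⟨ *-comm _ _ ⟩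
    χ x * ∑F χ ≡⟨ ΣF.*-distribˡ-sum (χ x) (χ ∘ el) ⟩
    ∑F (λ y → χ x * χ y) ≡⟨ ∑F-cong (λ y → sym (mult y)) ⟩
    ∑F (λ y → χ (x * y)) ≡⟨ ∑F-reindex χ (x *_) (*-cancelˡ x x≢0) ⟩
    ∑F χ ≡⟨ sym (*-identityʳ _) ⟩
    ∑F χ * 1# ∎)
    where
    open ≡-Reasoning
    mult : ∀ y → χ (x * y) ≡ χ x * χ y
    mult y with y ≟ 0#
    ... | yes refl = trans (cong χ (zeroʳ x)) (trans χ0 (sym (trans (cong (χ x *_) χ0) (zeroʳ _))))
    ... | no y≢0 = χ* x y x≢0 y≢0

  -- The sum is Q - 1 times 1, that is -1: adding the indicator function `δ` of 0 completes it to Q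
  -- times 1, which is 0.
  trivial-sum : ∀ {χ} → χ 0# ≡ 0# → (∀ x → x ≢ 0# → χ x ≡ 1#) → ∑F χ ≢ 0#
  trivial-sum {χ} χ0 χ1 ∑≡0 = 1≢0 (begin
    1# ≡⟨ sym δ0 ⟩
    δ 0# ≡⟨ sym (∑F-single δ 0# δ≡0) ⟩
    ∑F δ ≡⟨ sym (trans (cong (_+ ∑F δ) ∑≡0) (+-identityˡ _)) ⟩
    ∑F χ + ∑F δ ≡⟨ sym (ΣF.∑-distrib-+ (χ ∘ el) (δ ∘ el)) ⟩
    ∑F (λ x → χ x + δ x) ≡⟨ ∑F-cong total ⟩
    ∑F (λ _ → 1#) ≡⟨ ΣF.sum-replicate Q ⟩
    Q ×F.× 1# ≡⟨ Q×1≡0 ⟩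
    0# ∎)
    where
    open ≡-Reasoning
    δ : Carrier → Carrier
    δ x with x ≟ 0#
    ... | yes _ = 1#
    ... | no _ = 0#
    δ0 : δ 0# ≡ 1#
    δ0 with 0# ≟ 0#
    ... | yes _ = refl
    ... | no ≢ = contradiction refl ≢
    δ≡0 : ∀ x → x ≢ 0# → δ x ≡ 0#
    δ≡0 x x≢0 with x ≟ 0#
    ... | yes x≡0 = contradiction x≡0 x≢0
    ... | no _ = refl
    total : ∀ x → χ x + δ x ≡ 1#
    total x with x ≟ 0#
    ... | yes refl = trans (cong (_+ 1#) χ0) (+-identityˡ _)
    ... | no x≢0 = trans (+-identityʳ _) (χ1 x x≢0)

  -- Zero-sum sequences in ℤ/n

  total : List (Fin n) → ℕ
  total xs = sumℕ (List.map toℕ xs)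

  total-++ : ∀ xs ys → total (xs ++ ys) ≡ total xs ℕ.+ total ys
  total-++ [] ys = refl
  total-++ (x ∷ xs) ys = trans (cong (toℕ x ℕ.+_) (total-++ xs ys)) (sym (ℕₚ.+-assoc (toℕ x) _ _))

  total-take-drop : ∀ k xs → total (take k xs) ℕ.+ total (drop k xs) ≡ total xs
  total-take-drop k xs = trans (sym (total-++ (take k xs) (drop k xs))) (cong total (Listₚ.take++drop≡id k xs))

  total-segment : ∀ {k l} xs → k ≤ l → total (take k xs) ℕ.+ total (drop k (take l xs)) ≡ total (take l xs)
  total-segment {k} {l} xs k≤l = trans (cong (λ ys → total ys ℕ.+ total (drop k (take l xs))) (sym (take-take xs k≤l)))
    (total-take-drop k (take l xs))
    where
    take-take : ∀ {k l} (xs : List (Fin n)) → k ≤ l → take k (take l xs) ≡ take k xs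
    take-take xs z≤n = refl
    take-take [] (s≤s k≤l) = refl
    take-take (x ∷ xs) (s≤s k≤l) = cong (x ∷_) (take-take xs k≤l)

  total-take-suc : ∀ xs (l : Fin (length xs)) → total (take (suc (toℕ l)) xs) ≡ total (take (toℕ l) xs) ℕ.+ toℕ (List.lookup xs l)
  total-take-suc (x ∷ xs) zero = ℕₚ.+-identityʳ _
  total-take-suc (x ∷ xs) (suc l) = trans (cong (toℕ x ℕ.+_) (total-take-suc xs l)) (sym (ℕₚ.+-assoc (toℕ x) _ _))

  total-take-all : ∀ xs → total (take (length xs) xs) ≡ total xs
  total-take-all xs = cong total (Listₚ.take-all (length xs) xs ℕₚ.≤-refl)

  length-segment : ∀ k {l} (xs : List (Fin n)) → l ≤ length xs → length (drop k (take l xs)) ≡ l ℕ.∸ k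
  length-segment k {l} xs l≤ = trans (Listₚ.length-drop k (take l xs)) (cong (ℕ._∸ k) (trans (Listₚ.length-take l xs) (ℕₚ.m≤n⇒m⊓n≡m l≤)))

  -- The bound `m` on the length is strict, so that `ZeroSumFree S (length xs)` says that a zero-sum
  -- sequence `xs` is a shortest one.
  ZeroSumFree : (Fin n → Set) → ℕ → Set
  ZeroSumFree S m = ∀ xs → 1 ≤ length xs → length xs < m → All S xs → ¬ (n ∣ total xs)

  -- A shortest zero-sum sequence over S, read as a closed walk in ℤ/n with steps in S, has no chords.
  module MinimalWalk (S : Fin n → Set) (xs : List (Fin n)) (xs∈ : All S xs) (n∣xs : n ∣ total xs)
    (minimal : ZeroSumFree S (length xs)) where

    position : ℕ → ℕ
    position k = total (take k xs)

    vertex : Fin (length xs) → Fin n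
    vertex l = residue (position (toℕ l))

    private
      -- The segment between two visits of the same vertex would be a shorter closed walk.
      no-repeat : ∀ {k l} → k < l → l < length xs → position l % n ≢ position k % n
      no-repeat {k} {l} k<l l<m eq = minimal (drop k (take l xs))
        (subst (1 ≤_) (sym (length-segment k xs (ℕₚ.<⇒≤ l<m))) (ℕₚ.m<n⇒0<n∸m k<l))
        (subst (_< length xs) (sym (length-segment k xs (ℕₚ.<⇒≤ l<m))) (ℕₚ.≤-<-trans (ℕₚ.m∸n≤m l k) l<m))
        (Allₚ.drop⁺ k (Allₚ.take⁺ l xs∈))
        (mod-cancel (position k) _ (trans (cong (_% n) (total-segment xs (ℕₚ.<⇒≤ k<l))) eq))

    vertex-injective : ∀ {k l} → vertex k ≡ vertex l → k ≡ l
    vertex-injective {k} {l} eq with ℕₚ.<-cmp (toℕ k) (toℕ l)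
    ... | tri< k<l _ _ = contradiction (sym (residue-≡ eq)) (no-repeat k<l (Finₚ.toℕ<n l))
    ... | tri≈ _ k≡l _ = Finₚ.toℕ-injective k≡l
    ... | tri> _ _ l<k = contradiction (residue-≡ eq) (no-repeat l<k (Finₚ.toℕ<n k))

    -- For l ≤ k the step i closes the segment from l to k; for l > k it replaces the segment from k
    -- to l. Either closed walk is shorter than `xs` unless l = k + 1, or k is the last place and l
    -- = 0. In these cases i is congruent to the step of the walk itself.
    chordless : ∀ k l i → S i → residue (toℕ (vertex k) ℕ.+ toℕ i) ≡ vertex l → i ≡ List.lookup xs k
    chordless k l i i∈ eq = Finₚ.toℕ-injective same
      where
      edge : (position (toℕ k) ℕ.+ toℕ i) % n ≡ position (toℕ l) % n
      edge = trans (sym (mod-+ˡ (toℕ i) (trans (cong (_% n) (toℕ-residue (position (toℕ k)))) (m%n%n≡m%n (position (toℕ k)) n)))) (residue-≡ eq)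
      back : toℕ l ≤ toℕ k → ¬ (suc (toℕ k ℕ.∸ toℕ l) < length xs)
      back l≤k short = minimal (drop (toℕ l) (take (toℕ k) xs) ++ i ∷ [])
        (subst (1 ≤_) (sym len) (s≤s z≤n)) (subst (_< length xs) (sym len) short)
        (Allₚ.++⁺ (Allₚ.drop⁺ (toℕ l) (Allₚ.take⁺ (toℕ k) xs∈)) (i∈ ∷ []))
        (mod-cancel (position (toℕ l)) _ (trans (cong (_% n) tot) edge))
        where
        seg = drop (toℕ l) (take (toℕ k) xs)
        len : length (seg ++ i ∷ []) ≡ suc (toℕ k ℕ.∸ toℕ l)
        len = trans (Listₚ.length-++ seg) (trans (ℕₚ.+-comm (length seg) 1) (cong suc (length-segment (toℕ l) xs (ℕₚ.<⇒≤ (Finₚ.toℕ<n k)))))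
        tot : position (toℕ l) ℕ.+ total (seg ++ i ∷ []) ≡ position (toℕ k) ℕ.+ toℕ i
        tot = trans (cong (position (toℕ l) ℕ.+_) (trans (total-++ seg (i ∷ [])) (cong (total seg ℕ.+_) (ℕₚ.+-identityʳ (toℕ i)))))
          (trans (sym (ℕₚ.+-assoc (position (toℕ l)) (total seg) (toℕ i))) (cong (ℕ._+ toℕ i) (total-segment xs l≤k)))
      forward : ¬ (suc (toℕ k) ℕ.+ (length xs ℕ.∸ toℕ l) < length xs)
      forward short = minimal (take (toℕ k) xs ++ i ∷ drop (toℕ l) xs)
        (subst (1 ≤_) (sym len) (s≤s z≤n)) (subst (_< length xs) (sym len) short)
        (Allₚ.++⁺ (Allₚ.take⁺ (toℕ k) xs∈) (i∈ ∷ Allₚ.drop⁺ (toℕ l) xs∈))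
        (∣.m%n≡0⇒n∣m _ n (begin
          total (take (toℕ k) xs ++ i ∷ drop (toℕ l) xs) % n
            ≡⟨ cong (_% n) (trans (total-++ (take (toℕ k) xs) (i ∷ drop (toℕ l) xs)) (sym (ℕₚ.+-assoc (position (toℕ k)) (toℕ i) _))) ⟩
          ((position (toℕ k) ℕ.+ toℕ i) ℕ.+ total (drop (toℕ l) xs)) % n ≡⟨ mod-+ˡ (total (drop (toℕ l) xs)) edge ⟩
          (position (toℕ l) ℕ.+ total (drop (toℕ l) xs)) % n ≡⟨ cong (_% n) (total-take-drop (toℕ l) xs) ⟩
          total xs % n ≡⟨ ∣.n∣m⇒m%n≡0 (total xs) n n∣xs ⟩
          0 ∎))
        where
        open ≡-Reasoning
        len : length (take (toℕ k) xs ++ i ∷ drop (toℕ l) xs) ≡ suc (toℕ k) ℕ.+ (length xs ℕ.∸ toℕ l)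
        len = trans (Listₚ.length-++ (take (toℕ k) xs)) (trans (cong₂ ℕ._+_ (trans (Listₚ.length-take (toℕ k) xs) (ℕₚ.m≤n⇒m⊓n≡m (ℕₚ.<⇒≤ (Finₚ.toℕ<n k)))) (cong suc (Listₚ.length-drop (toℕ l) xs)))
          (ℕₚ.+-suc (toℕ k) _))
      same : toℕ i ≡ toℕ (List.lookup xs k)
      same with toℕ l ℕₚ.≤? toℕ k
      -- Here k is the last place and l = 0; the total of `xs` is 0 modulo n, so the last step of
      -- the walk also leads to position 0.
      ... | yes l≤k = mod-unique (position (toℕ k)) (Finₚ.toℕ<n i) (Finₚ.toℕ<n (List.lookup xs k)) (begin
          (position (toℕ k) ℕ.+ toℕ i) % n ≡⟨ edge ⟩
          position (toℕ l) % n ≡⟨ cong (λ j → position j % n) l≡0 ⟩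
          0 % n ≡⟨ trans (m<n⇒m%n≡m (ℕ.>-nonZero⁻¹ n)) (sym (∣.n∣m⇒m%n≡0 (total xs) n n∣xs)) ⟩
          total xs % n ≡⟨ cong (_% n) (trans (sym (total-take-all xs)) (cong position (sym k+1≡m))) ⟩
          position (suc (toℕ k)) % n ≡⟨ cong (_% n) (total-take-suc xs k) ⟩
          (position (toℕ k) ℕ.+ toℕ (List.lookup xs k)) % n ∎)
        where
        open ≡-Reasoning
        m≤ : length xs ≤ suc (toℕ k ℕ.∸ toℕ l)
        m≤ = ℕₚ.≮⇒≥ (back l≤k)
        k+1≡m : suc (toℕ k) ≡ length xs
        k+1≡m = ℕₚ.≤-antisym (Finₚ.toℕ<n k) (ℕₚ.≤-trans m≤ (s≤s (ℕₚ.m∸n≤m (toℕ k) (toℕ l))))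
        l≡0 : toℕ l ≡ 0
        l≡0 = ℕₚ.n≤0⇒n≡0 (ℕₚ.+-cancelˡ-≤ (toℕ k) (toℕ l) 0 (ℕₚ.≤-trans
          (ℕₚ.+-monoˡ-≤ (toℕ l) (ℕₚ.≤-pred (ℕₚ.≤-trans (Finₚ.toℕ<n k) m≤)))
          (ℕₚ.≤-reflexive (trans (ℕₚ.m∸n+n≡m l≤k) (sym (ℕₚ.+-identityʳ _))))))
      ... | no l≰k = mod-unique (position (toℕ k)) (Finₚ.toℕ<n i) (Finₚ.toℕ<n (List.lookup xs k))
          (trans edge (trans (cong (λ j → position j % n) l≡k+1) (cong (_% n) (total-take-suc xs k))))
        where
        l≡k+1 : toℕ l ≡ suc (toℕ k)
        l≡k+1 = ℕₚ.≤-antisym (ℕₚ.≮⇒≥ λ k+1<l → forward (subst (suc (toℕ k) ℕ.+ (length xs ℕ.∸ toℕ l) <_)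
          (ℕₚ.m+[n∸m]≡n (ℕₚ.<⇒≤ (Finₚ.toℕ<n l))) (ℕₚ.+-monoˡ-< (length xs ℕ.∸ toℕ l) k+1<l))) (ℕₚ.≰⇒> l≰k)

  -- Linear maps with vanishing character sums

  φ-sum : ∀ i {k} (f : Fin k → Carrier) → φ i (sum f) ≡ sum (φ i ∘ f)
  φ-sum i {zero} f = φ-0# i
  φ-sum i {suc k} f = trans (φ-homo-+ i (f zero) (sum (f ∘ suc))) (cong (φ i (f zero) +_) (φ-sum i (f ∘ suc)))

  -- The map `vs` enumerates a set J of m exponents. If `f` is linear, the term at x = 0 is zero
  -- whatever `inv` is there, because m ≥ 1.
  Vanishing : (Carrier → Carrier) → Set
  Vanishing f = ∀ m → 1 ≤ m → m < n → (vs : Fin m → Fin n) → (∀ {k l} → vs k ≡ vs l → k ≡ l) →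
    ∑F (λ x → ∏ (λ l → φ (toℕ (vs l)) (f x * inv x))) ≡ 0#

  module _ (a : Fin n → Carrier) (vanishing : Vanishing (L a)) where

    Support : Fin n → Set
    Support i = a i ≢ 0#

    module Expansion (xs : List (Fin n)) (1≤m : 1 ≤ length xs) (m<n : length xs < n) (xs∈ : All Support xs)
                     (n∣xs : n ∣ total xs) (minimal : ZeroSumFree Support (length xs)) where
      open MinimalWalk Support xs xs∈ n∣xs minimal

      m = length xs

      private
        v : Fin m → ℕ
        v l = toℕ (vertex l)

        first : Fin m
        first = Fin.fromℕ< 1≤m

      factor : Fin m → Fin n → Carrier → Carrier
      factor l i x = φ (v l) (φ (toℕ i) x) * φ (v l) (inv x)

      -- For x ≠ 0 this is x to the power Σ_l (q^(v l + w l) - q^(v l)), a character of the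
      -- multiplicative group.
      χ : Vec (Fin n) m → Carrier → Carrier
      χ w x = ∏ (λ l → factor l (Vec.lookup w l) x)

      coefficient : Vec (Fin n) m → Carrier
      coefficient w = ∏ (λ l → φ (v l) (a (Vec.lookup w l)))

      factor-expand : ∀ l x → φ (v l) (L a x * inv x) ≡ sum (λ i → φ (v l) (a i) * factor l i x)
      factor-expand l x = begin
        φ (v l) (L a x * inv x) ≡⟨ cong (φ (v l)) (ΣF.*-distribʳ-sum (inv x) (λ i → a i * φ (toℕ i) x)) ⟩
        φ (v l) (sum (λ i → (a i * φ (toℕ i) x) * inv x)) ≡⟨ φ-sum (v l) (λ i → (a i * φ (toℕ i) x) * inv x) ⟩
        sum (λ i → φ (v l) ((a i * φ (toℕ i) x) * inv x)) ≡⟨ sum-cong {f = λ i → φ (v l) ((a i * φ (toℕ i) x) * inv x)} {λ i → φ (v l) (a i) * factor l i x}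
               (λ i → trans (φ-homo-* (v l) (a i * φ (toℕ i) x) (inv x)) (trans (cong (_* φ (v l) (inv x)) (φ-homo-* (v l) (a i) (φ (toℕ i) x)))
                 (*-assoc (φ (v l) (a i)) (φ (v l) (φ (toℕ i) x)) (φ (v l) (inv x))))) ⟩
        sum (λ i → φ (v l) (a i) * factor l i x) ∎ where open ≡-Reasoning

      expansion : ∑F (λ x → ∏ (λ l → φ (v l) (L a x * inv x))) ≡ ∑words m (λ w → coefficient w * ∑F (χ w))
      expansion = begin
        ∑F (λ x → ∏ (λ l → φ (v l) (L a x * inv x)))
          ≡⟨ ∑F-cong (λ x → trans (∏-cong {f = λ l → φ (v l) (L a x * inv x)} {λ l → sum (λ i → φ (v l) (a i) * factor l i x)} (λ l → factor-expand l x)) (∏-∑ (λ l i → φ (v l) (a i) * factor l i x))) ⟩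
        ∑F (λ x → ∑words m (λ w → ∏ (λ l → φ (v l) (a (Vec.lookup w l)) * factor l (Vec.lookup w l) x)))
          ≡⟨ ∑F-∑words m (λ w x → ∏ (λ l → φ (v l) (a (Vec.lookup w l)) * factor l (Vec.lookup w l) x)) ⟩
        ∑words m (λ w → ∑F (λ x → ∏ (λ l → φ (v l) (a (Vec.lookup w l)) * factor l (Vec.lookup w l) x)))
          ≡⟨ ∑words-cong m (λ w → trans (∑F-cong (λ x → ∏-* (λ l → φ (v l) (a (Vec.lookup w l))) (λ l → factor l (Vec.lookup w l) x)))
               (sym (ΣF.*-distribˡ-sum (coefficient w) (χ w ∘ el)))) ⟩
        ∑words m (λ w → coefficient w * ∑F (χ w)) ∎ where open ≡-Reasoning

      χ-character : ∀ w → Character (χ w)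
      χ-character w =
        ∏-has-0 (λ l → factor l (Vec.lookup w l) 0#) first (trans (cong (_* φ (v first) (inv 0#)) (trans (cong (φ (v first)) (φ-0# (toℕ (Vec.lookup w first)))) (φ-0# (v first)))) (zeroˡ (φ (v first) (inv 0#)))) ,
        λ x y x≢0 y≢0 → trans (∏-cong {f = λ l → factor l (Vec.lookup w l) (x * y)} {λ l → factor l (Vec.lookup w l) x * factor l (Vec.lookup w l) y} λ l → begin
          φ (v l) (φ (toℕ (Vec.lookup w l)) (x * y)) * φ (v l) (inv (x * y))
            ≡⟨ cong₂ _*_ (trans (cong (φ (v l)) (φ-homo-* (toℕ (Vec.lookup w l)) x y)) (φ-homo-* (v l) (φ (toℕ (Vec.lookup w l)) x) (φ (toℕ (Vec.lookup w l)) y)))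
                (trans (cong (φ (v l)) (inv-* x≢0 y≢0)) (φ-homo-* (v l) (inv x) (inv y))) ⟩
          (φ (v l) (φ (toℕ (Vec.lookup w l)) x) * φ (v l) (φ (toℕ (Vec.lookup w l)) y)) * (φ (v l) (inv x) * φ (v l) (inv y))
            ≡⟨ solve 4 (λ a b c d → (a :* b) :* (c :* d) := (a :* c) :* (b :* d)) refl
                (φ (v l) (φ (toℕ (Vec.lookup w l)) x)) (φ (v l) (φ (toℕ (Vec.lookup w l)) y)) (φ (v l) (inv x)) (φ (v l) (inv y)) ⟩
          factor l (Vec.lookup w l) x * factor l (Vec.lookup w l) y ∎) (∏-* (λ l → factor l (Vec.lookup w l) x) (λ l → factor l (Vec.lookup w l) y))
        where open ≡-Reasoning

      next : Vec (Fin n) m → Fin m → Fin n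
      next w l = residue (v l ℕ.+ toℕ (Vec.lookup w l))

      -- Multiplication by the monomial of the vertices clears the inverses, which turns triviality
      -- of `χ w` into an equality of two monomials.
      χ-scaled : ∀ w x → x ≢ 0# → χ w x * ∏ (λ l → φ (v l) x) ≡ ∏ (λ l → φ (toℕ (next w l)) x)
      χ-scaled w x x≢0 = trans (sym (∏-* (λ l → factor l (Vec.lookup w l) x) (λ l → φ (v l) x))) (∏-cong {f = λ l → factor l (Vec.lookup w l) x * φ (v l) x} {λ l → φ (toℕ (next w l)) x} λ l → begin
        (φ (v l) (φ (toℕ (Vec.lookup w l)) x) * φ (v l) (inv x)) * φ (v l) x ≡⟨ *-assoc (φ (v l) (φ (toℕ (Vec.lookup w l)) x)) (φ (v l) (inv x)) (φ (v l) x) ⟩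
        φ (v l) (φ (toℕ (Vec.lookup w l)) x) * (φ (v l) (inv x) * φ (v l) x) ≡⟨ cong₂ _*_ (φ-∘ (v l) (toℕ (Vec.lookup w l)) x) (trans (sym (φ-homo-* (v l) (inv x) x)) (trans (cong (φ (v l)) (inv-l x x≢0)) (φ-1# (v l)))) ⟩
        φ (v l ℕ.+ toℕ (Vec.lookup w l)) x * 1# ≡⟨ *-identityʳ (φ (v l ℕ.+ toℕ (Vec.lookup w l)) x) ⟩
        φ (v l ℕ.+ toℕ (Vec.lookup w l)) x ≡⟨ sym (φ-residue (v l ℕ.+ toℕ (Vec.lookup w l)) x) ⟩
        φ (toℕ (next w l)) x ∎)
        where open ≡-Reasoning

      ∏φ-0 : (ks : Fin m → Fin n) → ∏ (λ l → φ (toℕ (ks l)) 0#) ≡ 0#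
      ∏φ-0 ks = ∏-has-0 (λ l → φ (toℕ (ks l)) 0#) first (φ-0# (toℕ (ks first)))

      -- A nonzero sum makes the character trivial, so the end points of the steps and the vertices
      -- define the same monomial.
      χ-nonzero : ∀ w → ∑F (χ w) ≢ 0# → ∀ l → Σ[ l′ ∈ Fin m ] vertex l′ ≡ next w l
      χ-nonzero w ∑≢0 = monomial-support refl (next w) vertex vertex-injective 1≤m same
        where
        same : ∀ x → ∏ (λ l → φ (toℕ (next w l)) x) ≡ ∏ (λ l → φ (v l) x)
        same x with x ≟ 0#
        ... | yes refl = trans (∏φ-0 (next w)) (sym (∏φ-0 vertex))
        ... | no x≢0 = trans (sym (χ-scaled w x x≢0)) (trans (cong (_* ∏ (λ l → φ (v l) x)) (character-sum (χ-character w) ∑≢0 x x≢0)) (*-identityˡ (∏ (λ l → φ (v l) x))))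

      walk : Vec (Fin n) m
      walk = Vec.tabulate (List.lookup xs)

      -- If neither the coefficient nor the character sum vanishes, every letter of `w` is a step in
      -- the support that leads from a vertex to a vertex; without chords `w` is then the walk
      -- itself.
      other-term : ∀ w → w ≢ walk → coefficient w * ∑F (χ w) ≡ 0#
      other-term w w≢ with Finₚ.any? (λ l → a (Vec.lookup w l) ≟ 0#) | ∑F (χ w) ≟ 0#
      ... | yes (l , a≡0) | _ = trans (cong (_* ∑F (χ w)) (∏-has-0 (λ l → φ (v l) (a (Vec.lookup w l))) l (trans (cong (φ (v l)) a≡0) (φ-0# (v l))))) (zeroˡ (∑F (χ w)))
      ... | no _ | yes ∑≡0 = trans (cong (coefficient w *_) ∑≡0) (zeroʳ (coefficient w))
      ... | no none | no ∑≢0 = contradiction (lookup-ext λ l → trans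
            (chordless l (proj₁ (χ-nonzero w ∑≢0 l)) (Vec.lookup w l) (λ a≡0 → none (l , a≡0)) (sym (proj₂ (χ-nonzero w ∑≢0 l))))
            (sym (Vecₚ.lookup∘tabulate (List.lookup xs) l))) w≢

      -- The end points are the vertices moved by one place, and the last of them is the starting
      -- vertex because n divides the total. The extra factor x is the contribution of position 0 on
      -- one side and of position m on the other.
      cyclic : ∀ x → x ≢ 0# → ∏ (λ l → φ (toℕ (next walk l)) x) ≡ ∏ (λ l → φ (v l) x)
      cyclic x x≢0 = *-cancelˡ x x≢0 (begin
        x * ∏ (λ l → φ (toℕ (next walk l)) x) ≡⟨ cong₂ _*_ (sym (φ-zero x)) (∏-cong {f = λ l → φ (toℕ (next walk l)) x} {λ l → φ (position (suc (toℕ l))) x} next≡) ⟩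
        ∏ {suc m} (λ l → φ (position (toℕ l)) x) ≡⟨ ΠF.sum-init-last {m} (λ l → φ (position (toℕ l)) x) ⟩
        ∏ {m} (λ l → φ (position (toℕ (inject₁ l))) x) * φ (position (toℕ (fromℕ m))) x
          ≡⟨ cong₂ _*_ (∏-cong {f = λ l → φ (position (toℕ (inject₁ l))) x} {λ l → φ (v l) x}
                 (λ l → trans (cong (λ j → φ (position j) x) (Finₚ.toℕ-inject₁ l)) (sym (φ-residue (position (toℕ l)) x))))
               (trans (cong (λ j → φ (position j) x) (Finₚ.toℕ-fromℕ m)) (φ-∣ x (subst (n ∣_) (sym (total-take-all xs)) n∣xs))) ⟩
        ∏ (λ l → φ (v l) x) * x ≡⟨ *-comm (∏ (λ l → φ (v l) x)) x ⟩
        x * ∏ (λ l → φ (v l) x) ∎)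
        where
        open ≡-Reasoning
        next≡ : ∀ l → φ (toℕ (next walk l)) x ≡ φ (position (suc (toℕ l))) x
        next≡ l = begin
          φ (toℕ (next walk l)) x ≡⟨ φ-residue (v l ℕ.+ toℕ (Vec.lookup walk l)) x ⟩
          φ (v l ℕ.+ toℕ (Vec.lookup walk l)) x ≡⟨ sym (φ-∘ (v l) (toℕ (Vec.lookup walk l)) x) ⟩
          φ (v l) (φ (toℕ (Vec.lookup walk l)) x) ≡⟨ φ-residue (position (toℕ l)) (φ (toℕ (Vec.lookup walk l)) x) ⟩
          φ (position (toℕ l)) (φ (toℕ (Vec.lookup walk l)) x) ≡⟨ φ-∘ (position (toℕ l)) (toℕ (Vec.lookup walk l)) x ⟩
          φ (position (toℕ l) ℕ.+ toℕ (Vec.lookup walk l)) x ≡⟨ cong (λ i → φ (position (toℕ l) ℕ.+ toℕ i) x) (Vecₚ.lookup∘tabulate (List.lookup xs) l) ⟩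
          φ (position (toℕ l) ℕ.+ toℕ (List.lookup xs l)) x ≡⟨ cong (λ j → φ j x) (sym (total-take-suc xs l)) ⟩
          φ (position (suc (toℕ l))) x ∎

      ∏φ-≢0 : ∀ {x} → x ≢ 0# → ∏ (λ l → φ (v l) x) ≢ 0#
      ∏φ-≢0 {x} x≢0 = ∏-≢0 (λ l → φ (v l) x) λ l → φ-≢0 (v l) x≢0

      χ-walk : ∀ x → x ≢ 0# → χ walk x ≡ 1#
      χ-walk x x≢0 = *-cancelˡ (∏ (λ l → φ (v l) x)) (∏φ-≢0 x≢0)
        (trans (*-comm (∏ (λ l → φ (v l) x)) (χ walk x)) (trans (χ-scaled walk x x≢0) (trans (cyclic x x≢0) (sym (*-identityʳ (∏ (λ l → φ (v l) x)))))))

      impossible : ⊥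
      impossible = *-≢0 coefficient≢0 (trivial-sum (proj₁ (χ-character walk)) χ-walk)
        (trans (sym (∑words-single m (λ w → coefficient w * ∑F (χ w)) walk other-term))
          (trans (sym expansion) (vanishing m 1≤m m<n vertex vertex-injective)))
        where
        coefficient≢0 : coefficient walk ≢ 0#
        coefficient≢0 = ∏-≢0 (λ l → φ (v l) (a (Vec.lookup walk l))) λ l → φ-≢0 (v l) (subst Support (sym (Vecₚ.lookup∘tabulate (List.lookup xs) l)) (All.lookup xs∈ (∈-lookup l)))

    -- Induction on the length supplies the minimality under which `Expansion` gives a
    -- contradiction.
    support-zero-sum-free : ZeroSumFree Support n
    support-zero-sum-free xs = go xs (<-wellFounded (length xs))
      where
      go : ∀ xs → Acc _<_ (length xs) → 1 ≤ length xs → length xs < n → All Support xs → ¬ (n ∣ total xs)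
      go xs (acc rs) 1≤m m<n xs∈ n∣xs = Expansion.impossible xs 1≤m m<n xs∈ n∣xs
        λ ys 1≤k k<m → go ys (rs k<m) 1≤k (ℕₚ.<-trans k<m m<n)

    total-replicate : ∀ k s → total (replicate k s) ≡ k ℕ.* toℕ s
    total-replicate zero s = refl
    total-replicate (suc k) s = cong (toℕ s ℕ.+_) (total-replicate k s)

    All-replicate : ∀ k {s} → Support s → All Support (replicate k s)
    All-replicate zero s∈ = []
    All-replicate (suc k) s∈ = s∈ ∷ All-replicate k s∈

    multiples : ∀ {s} → Support s → ∀ k → 1 ≤ k → k < n → ¬ (n ∣ k ℕ.* toℕ s)
    multiples {s} s∈ k 1≤k k<n n∣ = support-zero-sum-free (replicate k s)
      (subst (1 ≤_) (sym (Listₚ.length-replicate k)) 1≤k) (subst (_< n) (sym (Listₚ.length-replicate k)) k<n)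
      (All-replicate k s∈) (subst (n ∣_) (sym (total-replicate k s)) n∣)

    support-admissible : ∀ {s} → Support s → Admissible (toℕ s)
    support-admissible {s} s∈ = 1≤s , Finₚ.toℕ<n s , gcd≡1
      where
      1≤s : 1 ≤ toℕ s
      1≤s with toℕ s in s≡
      ... | suc _ = s≤s z≤n
      ... | zero = contradiction (subst (λ j → n ∣ 1 ℕ.* j) (sym s≡) (divides 0 refl)) (multiples s∈ 1 ℕₚ.≤-refl (ℕₚ.<-trans (ℕₚ.n<1+n 1) 3≤n))
      gcd≡1 : gcd (toℕ s) n ≡ 1
      gcd≡1 with gcd (toℕ s) n in g≡ | gcd[m,n]∣m (toℕ s) n | gcd[m,n]∣n (toℕ s) n
      ... | zero | _ | _ = contradiction (gcd[m,n]≡0⇒n≡0 (toℕ s) g≡) (ℕ.≢-nonZero⁻¹ n)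
      ... | suc zero | _ | _ = refl
      ... | g@(suc (suc _)) | divides b s≡ | divides zero n≡0 = contradiction n≡0 (ℕ.≢-nonZero⁻¹ n)
      -- For a common divisor g > 1 and c = n / g < n, the multiple c s equals b n.
      ... | g@(suc (suc g′)) | divides b s≡ | divides c@(suc _) n≡cg = contradiction
        (divides b (trans (cong (c ℕ.*_) s≡) (trans (sym (ℕₚ.*-assoc c b g)) (trans (cong (ℕ._* g) (ℕₚ.*-comm c b)) (trans (ℕₚ.*-assoc b c g) (cong (b ℕ.*_) (sym n≡cg)))))))
        (multiples s∈ c (s≤s z≤n) (subst (c <_) (sym n≡cg) (ℕₚ.m<m*n c g (s≤s (s≤s z≤n)))))

    -- The multiples of s exhaust ℤ/n, so t + k s ≡ 0 for some k < n. This zero-sum sequence has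
    -- length k + 1, which must be n, and t ≡ -(n-1) s ≡ s follows.
    support-unique : ∀ {s t} → Support s → Support t → t ≡ s
    support-unique {s} {t} s∈ t∈ = Finₚ.toℕ-injective (mod-unique (toℕ k ℕ.* toℕ s) (Finₚ.toℕ<n t) (Finₚ.toℕ<n s) (trans ks+t≡0 (sym ks+s≡0)))
      where
      open ≡-Reasoning
      multiple : Fin n → Fin n
      multiple k = residue (toℕ k ℕ.* toℕ s)
      distinct : ∀ {k l : Fin n} → toℕ k < toℕ l → (toℕ k ℕ.* toℕ s) % n ≢ (toℕ l ℕ.* toℕ s) % n
      distinct {k} {l} k<l eq = multiples s∈ (toℕ l ℕ.∸ toℕ k) (ℕₚ.m<n⇒0<n∸m k<l) (ℕₚ.≤-<-trans (ℕₚ.m∸n≤m (toℕ l) (toℕ k)) (Finₚ.toℕ<n l))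
        (mod-cancel (toℕ k ℕ.* toℕ s) _ (trans (cong (_% n) (trans (sym (ℕₚ.*-distribʳ-+ (toℕ s) (toℕ k) _)) (cong (ℕ._* toℕ s) (ℕₚ.m+[n∸m]≡n (ℕₚ.<⇒≤ k<l))))) (sym eq)))
      multiple-injective : ∀ {k l} → multiple k ≡ multiple l → k ≡ l
      multiple-injective {k} {l} eq with ℕₚ.<-cmp (toℕ k) (toℕ l)
      ... | tri< k<l _ _ = contradiction (residue-≡ eq) (distinct k<l)
      ... | tri≈ _ k≡l _ = Finₚ.toℕ-injective k≡l
      ... | tri> _ _ l<k = contradiction (sym (residue-≡ eq)) (distinct l<k)
      hit = injective⇒surjective (↔-id _) (↔-id _)
        multiple multiple-injective (residue (n ℕ.∸ toℕ t))
      k = proj₁ hit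
      ks+t≡0 : (toℕ k ℕ.* toℕ s ℕ.+ toℕ t) % n ≡ 0
      ks+t≡0 = begin
        (toℕ k ℕ.* toℕ s ℕ.+ toℕ t) % n ≡⟨ mod-+ˡ (toℕ t) (residue-≡ (proj₂ hit)) ⟩
        (n ℕ.∸ toℕ t ℕ.+ toℕ t) % n ≡⟨ cong (_% n) (ℕₚ.m∸n+n≡m (ℕₚ.<⇒≤ (Finₚ.toℕ<n t))) ⟩
        n % n ≡⟨ n%n≡0 n ⟩
        0 ∎
      k+1≡n : suc (toℕ k) ≡ n
      k+1≡n = ℕₚ.≤-antisym (Finₚ.toℕ<n k) (ℕₚ.≮⇒≥ λ k+1<n → support-zero-sum-free (t ∷ replicate (toℕ k) s)
        (s≤s z≤n) (subst (_< n) (cong suc (sym (Listₚ.length-replicate (toℕ k)))) k+1<n) (t∈ ∷ All-replicate (toℕ k) s∈)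
        (subst (n ∣_) (trans (ℕₚ.+-comm _ (toℕ t)) (cong (toℕ t ℕ.+_) (sym (total-replicate (toℕ k) s)))) (∣.m%n≡0⇒n∣m _ n ks+t≡0)))
      ks+s≡0 : (toℕ k ℕ.* toℕ s ℕ.+ toℕ s) % n ≡ 0
      ks+s≡0 = trans (cong (_% n) (trans (ℕₚ.+-comm _ (toℕ s)) (cong (ℕ._* toℕ s) k+1≡n))) (∣.n∣m⇒m%n≡0 _ n (∣.m∣m*n (toℕ s)))

  L-single : ∀ (a : Fin n → Carrier) s → (∀ t → t ≢ s → a t ≡ 0#) → ∀ x → L a x ≡ a s * φ (toℕ s) x
  L-single a s a≡0 x = sum-single +-commutativeMonoid (λ i → a i * φ (toℕ i) x) s λ t t≢s → trans (cong (_* φ (toℕ t) x) (a≡0 t t≢s)) (zeroˡ _)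

  -- Payne's theorem on translation ovals is the case q = 2.
  vanishing⇒monomial : ∀ {f} → FqLinear f → Vanishing f → (Σ[ x ∈ Carrier ] f x ≢ 0#) →
    Σ[ c ∈ Carrier ] Σ[ s ∈ ℕ ] (Admissible s × c ≢ 0# × (∀ x → f x ≡ c * φ s x))
  vanishing⇒monomial {f} lin van (y , fy≢0) with q-polynomial lin
  ... | a , f≡ with Finₚ.any? (λ i → ¬? (a i ≟ 0#))
  ... | no none = contradiction (trans (f≡ y) (sum-ε +-commutativeMonoid _ λ i → trans (cong (_* φ (toℕ i) y) (zero-coefficient i)) (zeroˡ _))) fy≢0
    where
    zero-coefficient : ∀ i → a i ≡ 0#
    zero-coefficient i with a i ≟ 0#
    ... | yes eq = eq
    ... | no neq = contradiction (i , neq) none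
  ... | yes (s , as≢0) = a s , toℕ s , support-admissible a vanishing as≢0 , as≢0 , λ x → trans (f≡ x) (L-single a s others x)
    where
    vanishing : Vanishing (L a)
    vanishing m 1≤m m<n vs inj = trans (∑F-cong λ x → ∏-cong λ l → cong (λ z → φ (toℕ (vs l)) (z * inv x)) (sym (f≡ x))) (van m 1≤m m<n vs inj)
    others : ∀ t → t ≢ s → a t ≡ 0#
    others t t≢s with a t ≟ 0#
    ... | yes eq = eq
    ... | no at≢0 = contradiction (support-unique a vanishing as≢0 at≢0) t≢s

  -- Vectors and lines of PG(3, q^n)

  V4-≡ : ∀ {u v} → c0 u ≡ c0 v → c1 u ≡ c1 v → c2 u ≡ c2 v → c3 u ≡ c3 v → u ≡ v
  V4-≡ = go
    where
    go : ∀ {a b c d a′ b′ c′ d′} → a ≡ a′ → b ≡ b′ → c ≡ c′ → d ≡ d′ → ⟨ a , b , c , d ⟩ ≡ ⟨ a′ , b′ , c′ , d′ ⟩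
    go refl refl refl refl = refl

  _⊖_ : V4 → V4 → V4
  u ⊖ v = u ⊕ ((- 1#) · v)

  comb : Carrier → V4 → Carrier → V4 → V4
  comb α u β v = (α · u) ⊕ (β · v)

  ⊕-identityˡ : ∀ u → 𝟎 ⊕ u ≡ u
  ⊕-identityˡ u = V4-≡ (+-identityˡ _) (+-identityˡ _) (+-identityˡ _) (+-identityˡ _)

  ⊕-identityʳ : ∀ u → u ⊕ 𝟎 ≡ u
  ⊕-identityʳ u = V4-≡ (+-identityʳ _) (+-identityʳ _) (+-identityʳ _) (+-identityʳ _)

  ·-zeroʳ : ∀ a → a · 𝟎 ≡ 𝟎
  ·-zeroʳ a = V4-≡ (zeroʳ a) (zeroʳ a) (zeroʳ a) (zeroʳ a)

  ·-zeroˡ : ∀ u → 0# · u ≡ 𝟎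
  ·-zeroˡ u = V4-≡ (zeroˡ _) (zeroˡ _) (zeroˡ _) (zeroˡ _)

  ·-identity : ∀ u → 1# · u ≡ u
  ·-identity u = V4-≡ (*-identityˡ _) (*-identityˡ _) (*-identityˡ _) (*-identityˡ _)

  ·-assoc : ∀ a b u → (a * b) · u ≡ a · (b · u)
  ·-assoc a b u = V4-≡ (*-assoc a b _) (*-assoc a b _) (*-assoc a b _) (*-assoc a b _)

  ·-⊕ : ∀ a u v → a · (u ⊕ v) ≡ (a · u) ⊕ (a · v)
  ·-⊕ a u v = V4-≡ (distribˡ a _ _) (distribˡ a _ _) (distribˡ a _ _) (distribˡ a _ _)

  ·-cancel : ∀ {a u} → a ≢ 0# → inv a · (a · u) ≡ u
  ·-cancel {a} {u} a≢0 = trans (sym (·-assoc (inv a) a u)) (trans (cong (_· u) (inv-l a a≢0)) (·-identity u))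

  ·-≡𝟎 : ∀ {a u} → a ≢ 0# → a · u ≡ 𝟎 → u ≡ 𝟎
  ·-≡𝟎 {a} {u} a≢0 eq = trans (sym (·-cancel a≢0)) (trans (cong (inv a ·_) eq) (·-zeroʳ _))

  ·-≡𝟎⇒scalar : ∀ {a u} → u ≢ 𝟎 → a · u ≡ 𝟎 → a ≡ 0#
  ·-≡𝟎⇒scalar {a} u≢𝟎 eq with a ≟ 0#
  ... | yes a≡0 = a≡0
  ... | no a≢0 = contradiction (·-≡𝟎 a≢0 eq) u≢𝟎

  ⊖-≡𝟎 : ∀ {u v} → u ⊖ v ≡ 𝟎 → u ≡ v
  ⊖-≡𝟎 eq = V4-≡ (x-1*y≡0⇒x≡y (cong c0 eq)) (x-1*y≡0⇒x≡y (cong c1 eq)) (x-1*y≡0⇒x≡y (cong c2 eq)) (x-1*y≡0⇒x≡y (cong c3 eq))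

  ⊖-self : ∀ u → u ⊖ u ≡ 𝟎
  ⊖-self u = V4-≡ (x≡y⇒x-1*y≡0 refl) (x≡y⇒x-1*y≡0 refl) (x≡y⇒x-1*y≡0 refl) (x≡y⇒x-1*y≡0 refl)

  private
    comb-comb-coordinate : ∀ x α a β b y γ δ → x * (α * a + β * b) + y * (γ * a + δ * b) ≡ (x * α + y * γ) * a + (x * β + y * δ) * b
    comb-comb-coordinate = solve 8 (λ x α a β b y γ δ → x :* (α :* a :+ β :* b) :+ y :* (γ :* a :+ δ :* b) := (x :* α :+ y :* γ) :* a :+ (x :* β :+ y :* δ) :* b) refl

  comb-comb : ∀ x y α β γ δ a b → comb x (comb α a β b) y (comb γ a δ b) ≡ comb (x * α + y * γ) a (x * β + y * δ) b
  comb-comb x y α β γ δ a b = V4-≡ (e (c0 a) (c0 b)) (e (c1 a) (c1 b)) (e (c2 a) (c2 b)) (e (c3 a) (c3 b))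
    where e = λ a b → comb-comb-coordinate x α a β b y γ δ

  ·-comb : ∀ x α β a b → x · comb α a β b ≡ comb (x * α) a (x * β) b
  ·-comb x α β a b = trans (·-⊕ x _ _) (cong₂ _⊕_ (sym (·-assoc x α a)) (sym (·-assoc x β b)))

  comb-⊖ : ∀ α β γ δ a b → comb α a β b ⊖ comb γ a δ b ≡ comb (α + (- 1#) * γ) a (β + (- 1#) * δ) b
  comb-⊖ α β γ δ a b = V4-≡ (e (c0 a) (c0 b)) (e (c1 a) (c1 b)) (e (c2 a) (c2 b)) (e (c3 a) (c3 b))
    where
    e : ∀ x y → (α * x + β * y) + (- 1#) * (γ * x + δ * y) ≡ (α + (- 1#) * γ) * x + (β + (- 1#) * δ) * y
    e x y = solve 6 (λ α x β y γ δ → (α :* x :+ β :* y) :+ :-1 :* (γ :* x :+ δ :* y) := (α :+ :-1 :* γ) :* x :+ (β :+ :-1 :* δ) :* y) refl α x β y γ δ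

  module _ (ℓ : Line) where
    open Line ℓ

    onLine-comb : ∀ {u v} x y → onLine ℓ u → onLine ℓ v → onLine ℓ (comb x u y v)
    onLine-comb x y (α , β , refl) (γ , δ , refl) = x * α + y * γ , x * β + y * δ , comb-comb x y α β γ δ a b

    onLine-⊕ : ∀ {u v} → onLine ℓ u → onLine ℓ v → onLine ℓ (u ⊕ v)
    onLine-⊕ {u} {v} u∈ v∈ = subst (onLine ℓ) (cong₂ _⊕_ (·-identity u) (·-identity v)) (onLine-comb 1# 1# u∈ v∈)

    onLine-· : ∀ {u} x → onLine ℓ u → onLine ℓ (x · u)
    onLine-· x (α , β , refl) = x * α , x * β , ·-comb x α β a b

    onLine-𝟎 : onLine ℓ 𝟎
    onLine-𝟎 = 0# , 0# , sym (trans (cong₂ _⊕_ (·-zeroˡ a) (·-zeroˡ b)) (⊕-identityˡ 𝟎))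

    onLine-a : onLine ℓ a
    onLine-a = 1# , 0# , sym (trans (cong₂ _⊕_ (·-identity a) (·-zeroˡ b)) (⊕-identityʳ a))

    onLine-b : onLine ℓ b
    onLine-b = 0# , 1# , sym (trans (cong₂ _⊕_ (·-zeroˡ a) (·-identity b)) (⊕-identityˡ b))

    coordinates-unique : ∀ {α β γ δ} → comb α a β b ≡ comb γ a δ b → α ≡ γ × β ≡ δ
    coordinates-unique {α} {β} {γ} {δ} eq =
      let p , q = indep _ _ (trans (sym (comb-⊖ α β γ δ a b)) (trans (cong (_⊖ comb γ a δ b) eq) (⊖-self _)))
      in x-1*y≡0⇒x≡y p , x-1*y≡0⇒x≡y q

  card² : (Carrier × Carrier) ↔ Fin (Q ℕ.* Q)
  card² = ×-card cardF cardF

  -- The change of coordinates `T` from m to ℓ is injective, hence onto by finiteness; no matrix has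
  -- to be inverted.
  two-points⇒SameLine : ∀ ℓ m → onLine ℓ (Line.a m) → onLine ℓ (Line.b m) → SameLine ℓ m
  two-points⇒SameLine ℓ m (α , β , a≡) (γ , δ , b≡) v = ⊆ , ⊇
    where
    open Line
    ⊇ : onLine m v → onLine ℓ v
    ⊇ (x , y , refl) = onLine-comb ℓ x y (α , β , a≡) (γ , δ , b≡)
    T : Carrier × Carrier → Carrier × Carrier
    T (x , y) = x * α + y * γ , x * β + y * δ
    T-comb : ∀ x y → comb x (a m) y (b m) ≡ comb (proj₁ (T (x , y))) (a ℓ) (proj₂ (T (x , y))) (b ℓ)
    T-comb x y = trans (cong₂ (λ u v → comb x u y v) a≡ b≡) (comb-comb x y α β γ δ (a ℓ) (b ℓ))
    T-injective : ∀ {p r} → T p ≡ T r → p ≡ r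
    T-injective {x , y} {x′ , y′} eq =
      let p , q = coordinates-unique m (trans (T-comb x y) (trans (cong (λ z → comb (proj₁ z) (a ℓ) (proj₂ z) (b ℓ)) eq) (sym (T-comb x′ y′))))
      in cong₂ _,_ p q
    ⊆ : onLine ℓ v → onLine m v
    ⊆ (x , y , refl) =
      let (x′ , y′) , eq = injective⇒surjective card² card² T T-injective (x , y)
      in x′ , y′ , trans (cong (λ z → comb (proj₁ z) (a ℓ) (proj₂ z) (b ℓ)) (sym eq)) (sym (T-comb x′ y′))

  SameLine-sym : ∀ {ℓ m} → SameLine ℓ m → SameLine m ℓ
  SameLine-sym same v = proj₂ (same v) , proj₁ (same v)

  SameLine-trans : ∀ {ℓ m k} → SameLine ℓ m → SameLine m k → SameLine ℓ k
  SameLine-trans s t v = proj₁ (t v) ∘ proj₁ (s v) , proj₂ (s v) ∘ proj₂ (t v)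

  IndependentPair : V4 → V4 → Set
  IndependentPair u v = ∀ α β → (α · u) ⊕ (β · v) ≡ 𝟎 → α ≡ 0# × β ≡ 0#

  line : ∀ u v → IndependentPair u v → Line
  line u v ind = record { a = u ; b = v ; indep = ind }

  -- If v = α a + β b, then v is independent of b when α ≠ 0 and of a when β ≠ 0. This gives two
  -- lines through a common point the same first base vector.
  rebase : ∀ ℓ v → v ≢ 𝟎 → onLine ℓ v → Σ[ w ∈ V4 ] Σ[ ind ∈ IndependentPair v w ] SameLine ℓ (line v w ind)
  rebase ℓ v v≢𝟎 v∈@(α , β , v≡) with α ≟ 0#
  ... | no α≢0 = b , ind , two-points⇒SameLine ℓ (line v b ind) v∈ (onLine-b ℓ)
    where
    open Line ℓ
    ind : IndependentPair v b
    ind x y eq = x≡0 , trans (sym (trans (cong (λ z → z * β + y * 1#) x≡0) (solve 2 (λ β y → :0 :* β :+ y :* :1 := y) refl β y))) (proj₂ zeros)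
      where
      zeros : x * α + y * 0# ≡ 0# × x * β + y * 1# ≡ 0#
      zeros = indep _ _ (trans (sym (comb-comb x y α β 0# 1# a b)) (trans (cong₂ (λ u w → comb x u y w) (sym v≡) (sym (proj₂ (proj₂ (onLine-b ℓ))))) eq))
      x≡0 : x ≡ 0#
      x≡0 = *-zero-product α α≢0 (trans (solve 3 (λ x α y → α :* x := x :* α :+ y :* :0) refl x α y) (proj₁ zeros))
  ... | yes α≡0 with β ≟ 0#
  ... | yes β≡0 = contradiction (trans v≡ (trans (cong₂ (λ x y → comb x (Line.a ℓ) y (Line.b ℓ)) α≡0 β≡0) (sym (proj₂ (proj₂ (onLine-𝟎 ℓ)))))) v≢𝟎
  ... | no β≢0 = a , ind , two-points⇒SameLine ℓ (line v a ind) v∈ (onLine-a ℓ)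
    where
    open Line ℓ
    ind : IndependentPair v a
    ind x y eq = x≡0 , trans (sym (trans (cong (λ z → z * α + y * 1#) x≡0) (solve 2 (λ α y → :0 :* α :+ y :* :1 := y) refl α y))) (proj₁ zeros)
      where
      zeros : x * α + y * 1# ≡ 0# × x * β + y * 0# ≡ 0#
      zeros = indep _ _ (trans (sym (comb-comb x y α β 1# 0# a b)) (trans (cong₂ (λ u w → comb x u y w) (sym v≡) (sym (proj₂ (proj₂ (onLine-a ℓ))))) eq))
      x≡0 : x ≡ 0#
      x≡0 = *-zero-product β β≢0 (trans (solve 3 (λ x β y → β :* x := x :* β :+ y :* :0) refl x β y) (proj₂ zeros))

  -- F_q-subspaces

  subspace-⊖ : ∀ {U} → IsFqSubspace U → ∀ {u v} → U u → U v → U (u ⊖ v)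
  subspace-⊖ (_ , U⊕ , U·) u∈ v∈ = U⊕ _ _ u∈ (U· _ _ (inFq-neg inFq-1) v∈)

  ∩-subspace : ∀ {U} ℓ → IsFqSubspace U → IsFqSubspace (onLine ℓ ∩ U)
  ∩-subspace ℓ (U𝟎 , U⊕ , U·) = (onLine-𝟎 ℓ , U𝟎) , (λ u v (p , r) (p′ , r′) → onLine-⊕ ℓ p p′ , U⊕ u v r r′) ,
    (λ c u c∈ (p , r) → onLine-· ℓ c p , U· c u c∈ r)

  -- Both u and c u are F_q-multiples `d₀ · w` and `e₀ · w` of one vector which spans ⟨u⟩ ∩ U over
  -- F_q, so c = e₀ / d₀.
  scattered-scalar : ∀ {U} → Scattered U → ∀ {u} c → U u → u ≢ 𝟎 → U (c · u) → InFq c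
  scattered-scalar {U} scat {u} c u∈ u≢𝟎 cu∈ =
    let b , _ , _ , span = scat u u∈ u≢𝟎
        d , d∈ , u≡ = span u ((1# , sym (·-identity u)) , u∈)
        e , e∈ , cu≡ = span (c · u) ((c , refl) , cu∈)
        w = b zero
        d₀ = d zero
        e₀ = e zero
        u≡′ : u ≡ d₀ · w
        u≡′ = trans u≡ (⊕-identityʳ _)
        w≢𝟎 : w ≢ 𝟎
        w≢𝟎 w≡𝟎 = u≢𝟎 (trans u≡′ (trans (cong (d₀ ·_) w≡𝟎) (·-zeroʳ d₀)))
        d₀≢0 : d₀ ≢ 0#
        d₀≢0 d₀≡0 = u≢𝟎 (trans u≡′ (trans (cong (_· w) d₀≡0) (·-zeroˡ w)))
        cd≡e : c * d₀ ≡ e₀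
        cd≡e = x-1*y≡0⇒x≡y (·-≡𝟎⇒scalar w≢𝟎 (trans (sub (c * d₀) e₀ w)
          (trans (cong₂ _⊖_ (trans (·-assoc c d₀ w) (trans (cong (c ·_) (sym u≡′)) (trans cu≡ (⊕-identityʳ _)))) refl) (⊖-self _))))
    in subst InFq (trans (cong (_* inv d₀) (sym cd≡e)) (trans (*-assoc c d₀ (inv d₀)) (trans (cong (c *_) (inv-r d₀ d₀≢0)) (*-identityʳ c))))
         (inFq-* (e∈ zero) (inFq-inv d₀≢0 (d∈ zero)))
    where
    sub : ∀ x y w → (x + (- 1#) * y) · w ≡ (x · w) ⊖ (y · w)
    sub x y w = V4-≡ (s (c0 w)) (s (c1 w)) (s (c2 w)) (s (c3 w))
      where
      s : ∀ z → (x + (- 1#) * y) * z ≡ x * z + (- 1#) * (y * z)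
      s z = solve 3 (λ x y z → (x :+ :-1 :* y) :* z := x :* z :+ :-1 :* (y :* z)) refl x y z

  scattered-intro : ∀ {U} → (∀ u c → U u → u ≢ 𝟎 → U (c · u) → InFq c) → Scattered U
  scattered-intro H u u∈ u≢𝟎 = (λ _ → u) , (λ _ → (1# , sym (·-identity u)) , u∈) ,
    (λ c c∈ eq → λ { zero → ·-≡𝟎⇒scalar u≢𝟎 (trans (sym (⊕-identityʳ _)) eq) }) ,
    (λ { v ((c , refl) , cu∈) → (λ _ → c) , (λ _ → H u c u∈ u≢𝟎 cu∈) , sym (⊕-identityʳ _) })

  lincomb-cong : ∀ {k} {c d : Fin k → Carrier} {b e : Fin k → V4} → (∀ i → c i ≡ d i) → (∀ i → b i ≡ e i) → lincomb c b ≡ lincomb d e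
  lincomb-cong {zero} _ _ = refl
  lincomb-cong {suc k} c≡ b≡ = cong₂ _⊕_ (cong₂ _·_ (c≡ zero) (b≡ zero)) (lincomb-cong (c≡ ∘ suc) (b≡ ∘ suc))

  lincomb-⊖ : ∀ {k} (c d : Fin k → Carrier) b → lincomb (λ i → c i + (- 1#) * d i) b ≡ lincomb c b ⊖ lincomb d b
  lincomb-⊖ {zero} c d b = sym (⊖-self 𝟎)
  lincomb-⊖ {suc k} c d b = trans (cong (((c zero + (- 1#) * d zero) · b zero) ⊕_) (lincomb-⊖ (c ∘ suc) (d ∘ suc) (b ∘ suc)))
    (V4-≡ (e _ _ _) (e _ _ _) (e _ _ _) (e _ _ _))
    where
    e : ∀ x y z → (c zero + (- 1#) * d zero) * x + (y + (- 1#) * z) ≡ (c zero * x + y) + (- 1#) * (d zero * x + z)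
    e = solve 5 (λ c d x y z → (c :+ :-1 :* d) :* x :+ (y :+ :-1 :* z) := (c :* x :+ y) :+ :-1 :* (d :* x :+ z)) refl (c zero) (d zero)

  lincomb-closed : ∀ {S} → IsFqSubspace S → ∀ {k} (c : Fin k → Carrier) (b : Fin k → V4) → (∀ i → InFq (c i)) → (∀ i → S (b i)) → S (lincomb c b)
  lincomb-closed (S𝟎 , _) {zero} c b _ _ = S𝟎
  lincomb-closed sub@(_ , S⊕ , S·) {suc k} c b c∈ b∈ = S⊕ _ _ (S· _ _ (c∈ zero) (b∈ zero)) (lincomb-closed sub (c ∘ suc) (b ∘ suc) (c∈ ∘ suc) (b∈ ∘ suc))

  lincomb-injective : ∀ {k} {b : Fin k → V4} → (∀ c → (∀ i → InFq (c i)) → lincomb c b ≡ 𝟎 → ∀ i → c i ≡ 0#) →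
    ∀ {v w} → lincomb (fqs v) b ≡ lincomb (fqs w) b → v ≡ w
  lincomb-injective {b = b} ind {v} {w} eq = fqs-injective λ i → x-1*y≡0⇒x≡y
    (ind (λ i → fqs v i + (- 1#) * fqs w i) (λ i → inFq-sub (fq-inFq _) (fq-inFq _))
      (trans (lincomb-⊖ (fqs v) (fqs w) b) (trans (cong (_⊖ lincomb (fqs w) b) eq) (⊖-self _))) i)

  FqLinearMap : (Carrier → V4) → Set
  FqLinearMap g = (∀ x y → g (x + y) ≡ g x ⊕ g y) × (∀ c x → InFq c → g (c * x) ≡ c · g x)

  module _ {g : Carrier → V4} (lin : FqLinearMap g) where
    map-0 : g 0# ≡ 𝟎
    map-0 = trans (cong g (sym (zeroˡ 0#))) (trans (proj₂ lin 0# 0# inFq-0) (·-zeroˡ _))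

    map-scal : ∀ {k} (c b : Fin k → Carrier) → (∀ i → InFq (c i)) → g (scal c b) ≡ lincomb c (g ∘ b)
    map-scal {zero} c b _ = map-0
    map-scal {suc k} c b c∈ = trans (proj₁ lin _ _) (cong₂ _⊕_ (proj₂ lin _ _ (c∈ zero)) (map-scal (c ∘ suc) (b ∘ suc) (c∈ ∘ suc)))

    -- The map `g` carries the F_q-basis of the field to a basis of S.
    image-dimension : ∀ {S} → (∀ x → g x ≡ 𝟎 → x ≡ 0#) → (∀ x → S (g x)) → (∀ v → S v → Σ[ x ∈ Carrier ] v ≡ g x) → HasDimFq S n
    image-dimension inj into onto = g ∘ basis , (λ i → into (basis i)) ,
      (λ c c∈ eq → basis-independent c c∈ (inj _ (trans (map-scal c basis c∈) eq))) ,
      (λ v v∈ → let x , v≡ = onto v v∈ in fqs (coords x) , (λ i → fq-inFq _) ,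
         trans v≡ (trans (cong g (sym (scal-coords x))) (map-scal (fqs (coords x)) basis (λ _ → fq-inFq _))))

  lincomb-split : ∀ m {k} (c : Fin (m ℕ.+ k) → Carrier) b → lincomb c b ≡ lincomb (c ∘ (Fin._↑ˡ k)) (b ∘ (Fin._↑ˡ k)) ⊕ lincomb (c ∘ (m Fin.↑ʳ_)) (b ∘ (m Fin.↑ʳ_))
  lincomb-split zero c b = sym (⊕-identityˡ _)
  lincomb-split (suc m) c b = trans (cong ((c zero · b zero) ⊕_) (lincomb-split m (c ∘ suc) (b ∘ suc))) (V4-≡ (sym (+-assoc _ _ _)) (sym (+-assoc _ _ _)) (sym (+-assoc _ _ _)) (sym (+-assoc _ _ _)))

  direct-sum-dimension : ∀ {S T R : Pred} {m k} → IsFqSubspace S → IsFqSubspace T → HasDimFq S m → HasDimFq T k →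
    (∀ u v → S u → T v → u ⊕ v ≡ 𝟎 → u ≡ 𝟎 × v ≡ 𝟎) → (∀ u → S u → R u) → (∀ u → T u → R u) →
    (∀ v → R v → Σ[ u ∈ V4 ] Σ[ w ∈ V4 ] (S u × T w × v ≡ u ⊕ w)) → HasDimFq R (m ℕ.+ k)
  direct-sum-dimension {S} {T} {R} {m} {k} subS subT (b , b∈ , indB , spanB) (e , e∈ , indE , spanE) disjoint S⊆R T⊆R split =
    f , (λ i → f∈ (Fin.splitAt m i)) , independent , spanning
    where
    f′ : Fin m ⊎ Fin k → V4
    f′ = [ b , e ]′
    f : Fin (m ℕ.+ k) → V4
    f i = f′ (Fin.splitAt m i)
    f∈ : ∀ s → R (f′ s)
    f∈ (inj₁ i) = S⊆R _ (b∈ i)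
    f∈ (inj₂ i) = T⊆R _ (e∈ i)
    lincomb-f : ∀ c → lincomb c f ≡ lincomb (c ∘ (Fin._↑ˡ k)) b ⊕ lincomb (c ∘ (m Fin.↑ʳ_)) e
    lincomb-f c = trans (lincomb-split m c f) (cong₂ _⊕_
      (lincomb-cong {c = c ∘ (Fin._↑ˡ k)} (λ _ → refl) λ i → cong f′ (Finₚ.splitAt-↑ˡ m i k))
      (lincomb-cong {c = c ∘ (m Fin.↑ʳ_)} (λ _ → refl) λ i → cong f′ (Finₚ.splitAt-↑ʳ m k i)))
    independent : ∀ c → (∀ i → InFq (c i)) → lincomb c f ≡ 𝟎 → ∀ i → c i ≡ 0#
    independent c c∈ eq i =
      let p , r = disjoint _ _ (lincomb-closed subS (c ∘ (Fin._↑ˡ k)) b (λ i → c∈ _) b∈) (lincomb-closed subT (c ∘ (m Fin.↑ʳ_)) e (λ i → c∈ _) e∈) (trans (sym (lincomb-f c)) eq)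
      in subst (λ j → c j ≡ 0#) (Finₚ.join-splitAt m k i) (go p r (Fin.splitAt m i))
      where
      go : lincomb (c ∘ (Fin._↑ˡ k)) b ≡ 𝟎 → lincomb (c ∘ (m Fin.↑ʳ_)) e ≡ 𝟎 → ∀ s → c (Fin.join m k s) ≡ 0#
      go p r (inj₁ i) = indB _ (λ i → c∈ _) p i
      go p r (inj₂ i) = indE _ (λ i → c∈ _) r i
    spanning : ∀ v → R v → Σ[ c ∈ (Fin (m ℕ.+ k) → Carrier) ] ((∀ i → InFq (c i)) × v ≡ lincomb c f)
    spanning v v∈ =
      let u , w , u∈ , w∈ , v≡ = split v v∈
          x , x∈ , u≡ = spanB u u∈
          y , y∈ , w≡ = spanE w w∈
          g = [ x , y ]′
          c = g ∘ Fin.splitAt m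
      in c , (λ i → all x y x∈ y∈ (Fin.splitAt m i)) , trans v≡ (trans (cong₂ _⊕_
           (trans u≡ (lincomb-cong {b = b} (λ i → sym (cong g (Finₚ.splitAt-↑ˡ m i k))) (λ _ → refl)))
           (trans w≡ (lincomb-cong {b = e} (λ i → sym (cong g (Finₚ.splitAt-↑ʳ m k i))) (λ _ → refl)))) (sym (lincomb-f c)))
      where
      all : ∀ (x : Fin m → Carrier) (y : Fin k → Carrier) → (∀ i → InFq (x i)) → (∀ i → InFq (y i)) → ∀ s → InFq ([ x , y ]′ s)
      all x y x∈ y∈ (inj₁ i) = x∈ i
      all x y x∈ y∈ (inj₂ i) = y∈ i

  -- Long lines

  -- Weight at least n, in the form which the counting arguments use.
  Long : Pred → Line → Set
  Long U ℓ = Σ[ g ∈ (Carrier → V4) ] ((∀ {x y} → g x ≡ g y → x ≡ y) × (∀ x → onLine ℓ (g x)) × (∀ x → U (g x)))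

  LongLine⇒Long : ∀ {U ℓ} → IsFqSubspace U → LongLine U ℓ → Long U ℓ
  LongLine⇒Long {U} {ℓ} sub (b , b∈ , ind , _) = g ,
    (λ {x} {y} eq → trans (sym (scal-coords x)) (trans (cong (λ v → scal (fqs v) basis) (lincomb-injective ind {coords x} {coords y} eq)) (scal-coords y))) ,
    (λ x → proj₁ (g∈ x)) , (λ x → proj₂ (g∈ x))
    where
    g : Carrier → V4
    g x = lincomb (fqs (coords x)) b
    g∈ : ∀ x → (onLine ℓ ∩ U) (g x)
    g∈ x = lincomb-closed (∩-subspace ℓ sub) (fqs (coords x)) b (λ _ → fq-inFq _) b∈

  opaque
    outside-Fq : Σ[ x ∈ Carrier ] ¬ InFq x
    outside-Fq with ∃? cardF (λ x → ¬? (inFq? x))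
    ... | yes found = found
    ... | no none = contradiction (injective⇒card≤ cardF (↔-id _) (λ x → fq-index x (all x))
          (λ {x} {y} eq → trans (sym (fq-fq-index x (all x))) (trans (cong fq eq) (fq-fq-index y (all y)))))
          (ℕₚ.<⇒≱ (subst (_< Q) (ℕₚ.*-identityʳ q) (q^-< {1} (ℕₚ.≤-trans (s≤s (s≤s z≤n)) 3≤n))))
      where
      all : ∀ x → InFq x
      all x with inFq? x
      ... | yes x∈ = x∈
      ... | no x∉ = contradiction (x , x∉) none

  V4≟𝟎 : ∀ u → Dec (u ≡ 𝟎)
  V4≟𝟎 u with c0 u ≟ 0# | c1 u ≟ 0# | c2 u ≟ 0# | c3 u ≟ 0#
  ... | yes a | yes b | yes c | yes d = yes (V4-≡ a b c d)
  ... | no a | _ | _ | _ = no (a ∘ cong c0)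
  ... | _ | no a | _ | _ = no (a ∘ cong c1)
  ... | _ | _ | no a | _ = no (a ∘ cong c2)
  ... | _ | _ | _ | no a = no (a ∘ cong c3)

  onLine? : ∀ ℓ v → Dec (onLine ℓ v)
  onLine? ℓ v = map′ (λ (α , β , eq) → α , β , ⊖-≡𝟎 eq) (λ { (α , β , refl) → α , β , ⊖-self v })
    (∃? cardF λ α → ∃? cardF λ β → V4≟𝟎 (v ⊖ comb α (Line.a ℓ) β (Line.b ℓ)))

  comb₃ : Carrier → V4 → Carrier → V4 → Carrier → V4 → V4
  comb₃ x u y v z w = (comb x u y v) ⊕ (z · w)

  -- Two long lines in a common plane would give, for λ ∉ F_q, an injection of F^4 into F^3 × F_q × F_q,
  -- namely (u₁ , u₂ , v₁ , v₂) ↦ u₁ + u₂ − λ (v₁ + v₂), completed by two traces which detect the common point.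
  module CommonPoint {U : Pred} (sub : IsFqSubspace U) (scat : Scattered U) (e₀ e₁ e₂ : V4)
    (ind₁ : IndependentPair e₀ e₁) (ind₂ : IndependentPair e₀ e₂)
    (long₁ : Long U (line e₀ e₁ ind₁)) (long₂ : Long U (line e₀ e₂ ind₂))
    (different : ¬ SameLine (line e₀ e₁ ind₁) (line e₀ e₂ ind₂)) where

    ℓ₁ = line e₀ e₁ ind₁
    ℓ₂ = line e₀ e₂ ind₂

    private
      g h : Carrier → V4
      g = proj₁ long₁
      h = proj₁ long₂
      g-injective : ∀ {x y} → g x ≡ g y → x ≡ y
      g-injective = proj₁ (proj₂ long₁)
      h-injective : ∀ {x y} → h x ≡ h y → x ≡ y
      h-injective = proj₁ (proj₂ long₂)
      α β γ δ : Carrier → Carrier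
      α x = proj₁ (proj₁ (proj₂ (proj₂ long₁)) x)
      β x = proj₁ (proj₂ (proj₁ (proj₂ (proj₂ long₁)) x))
      γ x = proj₁ (proj₁ (proj₂ (proj₂ long₂)) x)
      δ x = proj₁ (proj₂ (proj₁ (proj₂ (proj₂ long₂)) x))
      g≡ : ∀ x → g x ≡ comb (α x) e₀ (β x) e₁
      g≡ x = proj₂ (proj₂ (proj₁ (proj₂ (proj₂ long₁)) x))
      h≡ : ∀ x → h x ≡ comb (γ x) e₀ (δ x) e₂
      h≡ x = proj₂ (proj₂ (proj₁ (proj₂ (proj₂ long₂)) x))
      g∈ : ∀ x → U (g x)
      g∈ = proj₂ (proj₂ (proj₂ long₁))
      h∈ : ∀ x → U (h x)
      h∈ = proj₂ (proj₂ (proj₂ long₂))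
      t : Carrier
      t = proj₁ outside-Fq
      t∉ : ¬ InFq t
      t∉ = proj₂ outside-Fq

    -- The x with x e₀ in U form an F_q-space of dimension at most 1. As it may be zero, only its
    -- inclusion in F_q ζ is asked for, which lets both cases share one count.
    module Counting (ζ : Carrier) (ζ≢0 : ζ ≢ 0#) (multiple : ∀ x → U (x · e₀) → Σ[ c ∈ Carrier ] (InFq c × x ≡ c * ζ)) where
      cardq : Fin q ↔ Fin q
      cardq = ↔-id _
      -- Chosen so that the functional x ↦ trace (μ x) is nonzero at ζ, and hence injective on F_q
      -- ζ.
      μ : Carrier
      μ = proj₁ trace-nonzero * inv ζ
      trace-μζ : trace (μ * ζ) ≢ 0#
      trace-μζ eq = proj₂ trace-nonzero (trans (cong trace (sym (trans (*-assoc _ _ _) (trans (cong (proj₁ trace-nonzero *_) (inv-l ζ ζ≢0)) (*-identityʳ _))))) eq)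
      κ : Carrier → Fin q
      κ x = fq-index (trace (μ * α x)) (trace-inFq _)
      κ-trace : ∀ {x y} → κ x ≡ κ y → trace (μ * α x) ≡ trace (μ * α y)
      κ-trace {x} {y} eq = trans (sym (fq-fq-index _ (trace-inFq (μ * α x)))) (trans (cong fq eq) (fq-fq-index _ (trace-inFq (μ * α y))))

      p₀ p₁ p₂ : Carrier → Carrier → Carrier → Carrier → Carrier
      p₀ w x y z = (α w + γ x) + (- (t * (α y + γ z)))
      p₁ w x y z = β w + (- (t * β y))
      p₂ w x y z = δ x + (- (t * δ z))

      Φ : Carrier × (Carrier × (Carrier × Carrier)) → (Carrier × (Carrier × Carrier)) × (Fin q × Fin q)
      Φ (w , x , y , z) = (p₀ w x y z , p₁ w x y z , p₂ w x y z) , (κ w , κ y)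

      image : Carrier → Carrier → Carrier → Carrier → V4
      image w x y z = (g w ⊕ h x) ⊕ ((- t) · (g y ⊕ h z))

      image≡ : ∀ w x y z → image w x y z ≡ comb₃ (p₀ w x y z) e₀ (p₁ w x y z) e₁ (p₂ w x y z) e₂
      image≡ w x y z = trans (cong₂ (λ a b → a ⊕ ((- t) · b)) (cong₂ _⊕_ (g≡ w) (h≡ x)) (cong₂ _⊕_ (g≡ y) (h≡ z)))
        (V4-≡ (e (c0 e₀) (c0 e₁) (c0 e₂)) (e (c1 e₀) (c1 e₁) (c1 e₂)) (e (c2 e₀) (c2 e₁) (c2 e₂)) (e (c3 e₀) (c3 e₁) (c3 e₂)))
        where
        e : ∀ a b c → ((α w * a + β w * b) + (γ x * a + δ x * c)) + (- t) * ((α y * a + β y * b) + (γ z * a + δ z * c))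
                    ≡ (p₀ w x y z * a + p₁ w x y z * b) + p₂ w x y z * c
        e a b c = solve 12 (λ a b c t α β γ δ α′ β′ γ′ δ′ →
            ((α :* a :+ β :* b) :+ (γ :* a :+ δ :* c)) :+ (:- t) :* ((α′ :* a :+ β′ :* b) :+ (γ′ :* a :+ δ′ :* c))
            := ((((α :+ γ) :+ (:- (t :* (α′ :+ γ′)))) :* a) :+ ((β :+ (:- (t :* β′))) :* b)) :+ ((δ :+ (:- (t :* δ′))) :* c)) refl
          a b c t (α w) (β w) (γ x) (δ x) (α y) (β y) (γ z) (δ z)

      difference : ∀ w x w′ x′ → V4
      difference w x w′ x′ = (g w ⊖ g w′) ⊕ (h x ⊖ h x′)

      difference∈ : ∀ w x w′ x′ → U (difference w x w′ x′)
      difference∈ w x w′ x′ = proj₁ (proj₂ sub) _ _ (subspace-⊖ sub (g∈ w) (g∈ w′)) (subspace-⊖ sub (h∈ x) (h∈ x′))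

      -- If the two differences cancel, each is a multiple of the common vector e₀, because the
      -- lines are distinct. By `multiple` the factor A lies in F_q ζ, where equality of the traces
      -- `κ` forces it to be zero.
      separate : ∀ w x w′ x′ → difference w x w′ x′ ≡ 𝟎 → κ w ≡ κ w′ → w ≡ w′ × x ≡ x′
      separate w x w′ x′ diff≡𝟎 κ≡ = g-injective (⊖-≡𝟎 g-diff) , h-injective (⊖-≡𝟎 h-diff)
        where
        A B C D : Carrier
        A = α w + (- 1#) * α w′
        B = β w + (- 1#) * β w′
        C = γ x + (- 1#) * γ x′
        D = δ x + (- 1#) * δ x′
        g-comb : g w ⊖ g w′ ≡ comb A e₀ B e₁
        g-comb = trans (cong₂ _⊖_ (g≡ w) (g≡ w′)) (comb-⊖ _ _ _ _ e₀ e₁)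
        h-comb : h x ⊖ h x′ ≡ comb C e₀ D e₂
        h-comb = trans (cong₂ _⊖_ (h≡ x) (h≡ x′)) (comb-⊖ _ _ _ _ e₀ e₂)
        relation : comb A e₀ B e₁ ⊕ comb C e₀ D e₂ ≡ 𝟎
        relation = trans (sym (cong₂ _⊕_ g-comb h-comb)) diff≡𝟎
        Be₁ : B · e₁ ≡ comb (- (A + C)) e₀ (- D) e₂
        Be₁ = V4-≡ (e _ _ _ (cong c0 relation)) (e _ _ _ (cong c1 relation)) (e _ _ _ (cong c2 relation)) (e _ _ _ (cong c3 relation))
          where
          e : ∀ a b c → (A * a + B * b) + (C * a + D * c) ≡ 0# → B * b ≡ (- (A + C)) * a + (- D) * c
          e a b c eq = x-y≡0⇒x≡y (trans (solve 7 (λ A B C D a b c → B :* b :+ (:- ((:- (A :+ C)) :* a :+ (:- D) :* c)) := (A :* a :+ B :* b) :+ (C :* a :+ D :* c)) refl A B C D a b c) eq)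
        B≡0 : B ≡ 0#
        -- Otherwise e₁ could be solved for in terms of e₀ and e₂, and the lines would coincide.
        B≡0 = decidable-stable (B ≟ 0#) λ B≢0 → different (SameLine-sym {ℓ₂} {ℓ₁} (two-points⇒SameLine ℓ₂ ℓ₁ (onLine-a ℓ₂)
            (subst (onLine ℓ₂) (·-cancel B≢0) (onLine-· ℓ₂ (inv B) (- (A + C) , - D , Be₁)))))
        g-multiple : g w ⊖ g w′ ≡ A · e₀
        g-multiple = trans g-comb (trans (cong (λ z → comb A e₀ z e₁) B≡0) (trans (cong ((A · e₀) ⊕_) (·-zeroˡ e₁)) (⊕-identityʳ _)))
        c = proj₁ (multiple A (subst U g-multiple (subspace-⊖ sub (g∈ w) (g∈ w′))))
        c∈ : InFq c
        c∈ = proj₁ (proj₂ (multiple A (subst U g-multiple (subspace-⊖ sub (g∈ w) (g∈ w′)))))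
        A≡cζ : A ≡ c * ζ
        A≡cζ = proj₂ (proj₂ (multiple A (subst U g-multiple (subspace-⊖ sub (g∈ w) (g∈ w′)))))
        c≡0 : c ≡ 0#
        c≡0 = *-zero-product (trace (μ * ζ)) trace-μζ (begin
          trace (μ * ζ) * c ≡⟨ *-comm _ c ⟩
          c * trace (μ * ζ) ≡⟨ sym (tr-scale n (μ * ζ) c∈) ⟩
          trace (c * (μ * ζ)) ≡⟨ cong trace (solve 3 (λ c μ ζ → c :* (μ :* ζ) := μ :* (c :* ζ)) refl c μ ζ) ⟩
          trace (μ * (c * ζ)) ≡⟨ cong (λ z → trace (μ * z)) (sym A≡cζ) ⟩
          trace (μ * (α w + (- 1#) * α w′)) ≡⟨ cong trace (solve 3 (λ μ a b → μ :* (a :+ :-1 :* b) := μ :* a :+ :-1 :* (μ :* b)) refl μ (α w) (α w′)) ⟩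
          trace (μ * α w + (- 1#) * (μ * α w′)) ≡⟨ tr-homo-+ n _ _ ⟩
          trace (μ * α w) + trace ((- 1#) * (μ * α w′)) ≡⟨ cong (trace (μ * α w) +_) (tr-scale n _ (inFq-neg inFq-1)) ⟩
          trace (μ * α w) + (- 1#) * trace (μ * α w′) ≡⟨ x≡y⇒x-1*y≡0 (κ-trace κ≡) ⟩
          0# ∎) where open ≡-Reasoning
        A≡0 : A ≡ 0#
        A≡0 = trans A≡cζ (trans (cong (_* ζ) c≡0) (zeroˡ ζ))
        g-diff : g w ⊖ g w′ ≡ 𝟎
        g-diff = trans g-multiple (trans (cong (_· e₀) A≡0) (·-zeroˡ e₀))
        h-diff : h x ⊖ h x′ ≡ 𝟎
        h-diff = trans (sym (⊕-identityˡ _)) (trans (cong (_⊕ (h x ⊖ h x′)) (sym g-diff)) diff≡𝟎)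

      -- Equal images give `upper ≡ t · lower` with both vectors in U. Since t is not in F_q,
      -- scatteredness makes `lower` zero, and then `upper` is zero as well.
      Φ-injective : ∀ {p r} → Φ p ≡ Φ r → p ≡ r
      Φ-injective {w , x , y , z} {w′ , x′ , y′ , z′} eq =
        cong₂ _,_ (proj₁ wx) (cong₂ _,_ (proj₂ wx) (cong₂ _,_ (proj₁ yz) (proj₂ yz)))
        where
        image-eq : image w x y z ≡ image w′ x′ y′ z′
        image-eq = trans (image≡ w x y z) (trans (cong (λ p → comb₃ (proj₁ (proj₁ p)) e₀ (proj₁ (proj₂ (proj₁ p))) e₁ (proj₂ (proj₂ (proj₁ p))) e₂) eq) (sym (image≡ w′ x′ y′ z′)))
        upper lower : V4
        upper = difference w x w′ x′
        lower = difference y z y′ z′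
        upper≡ : upper ≡ t · lower
        upper≡ = V4-≡ (e _ _ _ _ _ _ _ _ (cong c0 image-eq)) (e _ _ _ _ _ _ _ _ (cong c1 image-eq)) (e _ _ _ _ _ _ _ _ (cong c2 image-eq)) (e _ _ _ _ _ _ _ _ (cong c3 image-eq))
          where
          e : ∀ a b c d a′ b′ c′ d′ → (a + b) + (- t) * (c + d) ≡ (a′ + b′) + (- t) * (c′ + d′) →
              (a + (- 1#) * a′) + (b + (- 1#) * b′) ≡ t * ((c + (- 1#) * c′) + (d + (- 1#) * d′))
          e a b c d a′ b′ c′ d′ eq = x-y≡0⇒x≡y (trans (solve 9 (λ t a b c d a′ b′ c′ d′ →
              ((a :+ :-1 :* a′) :+ (b :+ :-1 :* b′)) :+ (:- (t :* ((c :+ :-1 :* c′) :+ (d :+ :-1 :* d′))))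
              := ((a :+ b) :+ (:- t) :* (c :+ d)) :+ (:- ((a′ :+ b′) :+ (:- t) :* (c′ :+ d′)))) refl t a b c d a′ b′ c′ d′) (x≡y⇒x-y≡0 eq))
        lower≡𝟎 : lower ≡ 𝟎
        lower≡𝟎 = decidable-stable (V4≟𝟎 lower) λ neq →
          t∉ (scattered-scalar scat t (difference∈ y z y′ z′) neq (subst U upper≡ (difference∈ w x w′ x′)))
        wx = separate w x w′ x′ (trans upper≡ (trans (cong (t ·_) lower≡𝟎) (·-zeroʳ t))) (cong (λ p → proj₁ (proj₂ p)) eq)
        yz = separate y z y′ z′ lower≡𝟎 (cong (λ p → proj₂ (proj₂ p)) eq)

      -- The injection gives Q^4 ≤ Q^3 q^2, whereas q^2 < q^n = Q.
      too-many : ⊥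
      too-many = ℕₚ.<⇒≱ (subst (_< Q) (cong (q ℕ.*_) (ℕₚ.*-identityʳ q)) (q^-< {2} 3≤n))
        (ℕₚ.*-cancelˡ-≤ (Q ℕ.* (Q ℕ.* Q)) {{ℕₚ.m*n≢0 Q (Q ℕ.* Q) {{Q≢0}} {{ℕₚ.m*n≢0 Q Q}}}}
          (subst (_≤ (Q ℕ.* (Q ℕ.* Q)) ℕ.* (q ℕ.* q)) (ℕₚ.*-comm Q (Q ℕ.* (Q ℕ.* Q)))
            (injective⇒card≤ (×-card cardF (×-card cardF card²)) (×-card (×-card cardF card²) (×-card cardq cardq)) Φ Φ-injective)))

    -- A nonzero x with x e₀ in U could serve as ζ, by scatteredness, and is excluded by the count.
    -- So e₀ has no nonzero multiple in U, and then ζ = 1 is a valid choice.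
    impossible : e₀ ≢ 𝟎 → ⊥
    impossible e₀≢𝟎 = Counting.too-many 1# 1≢0 λ x x∈ → 0# , inFq-0 , trans (vanish x x∈) (sym (zeroˡ 1#))
      where
      vanish : ∀ x → U (x · e₀) → x ≡ 0#
      vanish x x∈ = decidable-stable (x ≟ 0#) λ x≢0 → Counting.too-many x x≢0 λ y y∈ → y * inv x ,
          scattered-scalar scat (y * inv x) x∈ (λ eq → e₀≢𝟎 (·-≡𝟎 x≢0 eq)) (subst U (trans (cong (_· e₀) (sym (ratio x≢0 y))) (·-assoc (y * inv x) x e₀)) y∈) ,
          sym (ratio x≢0 y)
        where
        ratio : x ≢ 0# → ∀ y → (y * inv x) * x ≡ y
        ratio x≢0 y = trans (*-assoc y (inv x) x) (trans (cong (y *_) (inv-l x x≢0)) (*-identityʳ y))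

  Long-SameLine : ∀ {U ℓ m} → SameLine ℓ m → Long U ℓ → Long U m
  Long-SameLine same (g , inj , on , g∈) = g , inj , (λ x → proj₁ (same (g x)) (on x)) , g∈

  long-lines-disjoint : ∀ {U} → IsFqSubspace U → Scattered U → ∀ {ℓ m} → Long U ℓ → Long U m → ¬ SameLine ℓ m → ¬ Meet ℓ m
  long-lines-disjoint {U} sub scat {ℓ} {m} long₁ long₂ different (e₀ , e₀≢𝟎 , e₀∈ℓ , e₀∈m) =
    let e₁ , ind₁ , same₁ = rebase ℓ e₀ e₀≢𝟎 e₀∈ℓ
        e₂ , ind₂ , same₂ = rebase m e₀ e₀≢𝟎 e₀∈m
        ℓ₁ = line e₀ e₁ ind₁
        ℓ₂ = line e₀ e₂ ind₂
    in CommonPoint.impossible sub scat e₀ e₁ e₂ ind₁ ind₂ (Long-SameLine {U} {ℓ} {ℓ₁} same₁ long₁) (Long-SameLine {U} {m} {ℓ₂} same₂ long₂)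
         (λ same → different (SameLine-trans {ℓ} {ℓ₁} {m} same₁ (SameLine-trans {ℓ₁} {ℓ₂} {m} same (SameLine-sym {m} {ℓ₂} same₂)))) e₀≢𝟎

  -- The sets U_{s,t}

  φ-fixed-multiple : ∀ k {s x} → φ s x ≡ x → φ (k ℕ.* s) x ≡ x
  φ-fixed-multiple zero _ = φ-zero _
  φ-fixed-multiple (suc k) {s} {x} eq = trans (sym (φ-∘ s (k ℕ.* s) x)) (trans (cong (φ s) (φ-fixed-multiple k {s} eq)) eq)

  -- By Bézout, 1 is an integral combination of s and n, and x is fixed by the Frobenius powers of
  -- both. The two clauses of `go` correspond to the two signs.
  φ-fixed⇒inFq : ∀ {s} → Admissible s → ∀ x → φ s x ≡ x → InFq x
  φ-fixed⇒inFq {s} (_ , _ , gcd≡1) x eq = trans (sym (φ1≡pow x)) (go (subst (λ d → Bézout.Identity d s n) gcd≡1 (Bézout.identity (gcd-GCD s n))))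
    where
    go : Bézout.Identity 1 s n → φ 1 x ≡ x
    go (Bézout.+- k l 1+ln≡ks) = begin
      φ 1 x ≡⟨ cong (φ 1) (sym (φ-*n l x)) ⟩
      φ 1 (φ (l ℕ.* n) x) ≡⟨ φ-∘ 1 (l ℕ.* n) x ⟩
      φ (1 ℕ.+ l ℕ.* n) x ≡⟨ cong (λ i → φ i x) 1+ln≡ks ⟩
      φ (k ℕ.* s) x ≡⟨ φ-fixed-multiple k {s} eq ⟩
      x ∎ where open ≡-Reasoning
    go (Bézout.-+ k l 1+ks≡ln) = begin
      φ 1 x ≡⟨ cong (φ 1) (sym (φ-fixed-multiple k {s} eq)) ⟩
      φ 1 (φ (k ℕ.* s) x) ≡⟨ φ-∘ 1 (k ℕ.* s) x ⟩
      φ (1 ℕ.+ k ℕ.* s) x ≡⟨ cong (λ i → φ i x) 1+ks≡ln ⟩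
      φ (l ℕ.* n) x ≡⟨ φ-*n l x ⟩
      x ∎ where open ≡-Reasoning

  x*1+y*0 : ∀ x y → x ≡ x * 1# + y * 0#
  x*1+y*0 = solve 2 (λ x y → x := x :* :1 :+ y :* :0) refl
  x*0+y*1 : ∀ x y → y ≡ x * 0# + y * 1#
  x*0+y*1 = solve 2 (λ x y → y := x :* :0 :+ y :* :1) refl
  x*0+y*0 : ∀ x y → x * 0# + y * 0# ≡ 0#
  x*0+y*0 = solve 2 (λ x y → x :* :0 :+ y :* :0 := :0) refl

  -- The two axes, and U_{s,t} as a scattered subspace of rank 2n

  axis₁ : Line
  axis₁ = line ⟨ 1# , 0# , 0# , 0# ⟩ ⟨ 0# , 1# , 0# , 0# ⟩ λ α β eq →
    trans (x*1+y*0 α β) (cong c0 eq) ,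
    trans (x*0+y*1 α β) (cong c1 eq)

  axis₂ : Line
  axis₂ = line ⟨ 0# , 0# , 1# , 0# ⟩ ⟨ 0# , 0# , 0# , 1# ⟩ λ α β eq →
    trans (x*1+y*0 α β) (cong c2 eq) ,
    trans (x*0+y*1 α β) (cong c3 eq)

  axis₁-X₂X₃ : IsLineX2X3 axis₁
  axis₁-X₂X₃ v = (λ { (α , β , refl) → x*0+y*0 α β , x*0+y*0 α β }) ,
    λ (e₂ , e₃) → c0 v , c1 v , V4-≡ (x*1+y*0 _ _) (x*0+y*1 _ _) (trans e₂ (sym (x*0+y*0 _ _))) (trans e₃ (sym (x*0+y*0 _ _)))

  axis₂-X₀X₁ : IsLineX0X1 axis₂
  axis₂-X₀X₁ v = (λ { (α , β , refl) → x*0+y*0 α β , x*0+y*0 α β }) ,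
    λ (e₀ , e₁) → c2 v , c3 v , V4-≡ (trans e₀ (sym (x*0+y*0 _ _))) (trans e₁ (sym (x*0+y*0 _ _))) (x*1+y*0 _ _) (x*0+y*1 _ _)

  module _ (s t : ℕ) where
    point : Carrier → Carrier → V4
    point x y = ⟨ x , φ s x , y , φ t y ⟩

    point₁ point₂ : Carrier → V4
    point₁ x = ⟨ x , φ s x , 0# , 0# ⟩
    point₂ y = ⟨ 0# , 0# , y , φ t y ⟩

    Ust-subspace : IsFqSubspace (Ust s t)
    Ust-subspace =
      (0# , 0# , V4-≡ refl (sym (φ-0# s)) refl (sym (φ-0# t))) ,
      (λ { u v (x , y , refl) (x′ , y′ , refl) → x + x′ , y + y′ , V4-≡ refl (sym (φ-homo-+ s x x′)) refl (sym (φ-homo-+ t y y′)) }) ,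
      (λ { c u c∈ (x , y , refl) → c * x , c * y ,
         V4-≡ refl (sym (trans (φ-homo-* s c x) (cong (_* φ s x) (inFq-φ c∈ s)))) refl (sym (trans (φ-homo-* t c y) (cong (_* φ t y) (inFq-φ c∈ t)))) })

    point₁-linear : FqLinearMap point₁
    point₁-linear = (λ x y → V4-≡ refl (φ-homo-+ s x y) (sym (+-identityˡ _)) (sym (+-identityˡ _))) ,
      (λ c x c∈ → V4-≡ refl (trans (φ-homo-* s c x) (cong (_* φ s x) (inFq-φ c∈ s))) (sym (zeroʳ c)) (sym (zeroʳ c)))

    point₂-linear : FqLinearMap point₂
    point₂-linear = (λ x y → V4-≡ (sym (+-identityˡ _)) (sym (+-identityˡ _)) refl (φ-homo-+ t x y)) ,
      (λ c x c∈ → V4-≡ (sym (zeroʳ c)) (sym (zeroʳ c)) refl (trans (φ-homo-* t c x) (cong (_* φ t x) (inFq-φ c∈ t))))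

    axis₁-long : LongLine (Ust s t) axis₁
    axis₁-long = image-dimension point₁-linear (λ x → cong c0)
      (λ x → proj₂ (axis₁-X₂X₃ (point₁ x)) (refl , refl) , x , 0# , V4-≡ refl refl refl (sym (φ-0# t)))
      λ { v (v∈ , x , y , refl) → x , V4-≡ refl refl (proj₁ (proj₁ (axis₁-X₂X₃ v) v∈)) (proj₂ (proj₁ (axis₁-X₂X₃ v) v∈)) }

    axis₂-long : LongLine (Ust s t) axis₂
    axis₂-long = image-dimension point₂-linear (λ x → cong c2)
      (λ y → proj₂ (axis₂-X₀X₁ (point₂ y)) (refl , refl) , 0# , y , V4-≡ refl (sym (φ-0# s)) refl refl)
      λ { v (v∈ , x , y , refl) → y , V4-≡ (proj₁ (proj₁ (axis₂-X₀X₁ v) v∈)) (proj₂ (proj₁ (axis₂-X₀X₁ v) v∈)) refl refl }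

    Ust-dimension : HasDimFq (Ust s t) (2 ℕ.* n)
    Ust-dimension = direct-sum-dimension {S} {T} {Ust s t} (∩-subspace axis₁ Ust-subspace) (∩-subspace axis₂ Ust-subspace)
      axis₁-long (subst (HasDimFq T) (sym (ℕₚ.+-identityʳ n)) axis₂-long) disjoint (λ _ → proj₂) (λ _ → proj₂) split
      where
      S T : Pred
      S = onLine axis₁ ∩ Ust s t
      T = onLine axis₂ ∩ Ust s t
      disjoint : ∀ u v → S u → T v → u ⊕ v ≡ 𝟎 → u ≡ 𝟎 × v ≡ 𝟎
      disjoint u v (u∈ , _) (v∈ , _) eq =
        let u₂ , u₃ = proj₁ (axis₁-X₂X₃ u) u∈
            v₀ , v₁ = proj₁ (axis₂-X₀X₁ v) v∈
        in V4-≡ (left v₀ (cong c0 eq)) (left v₁ (cong c1 eq)) u₂ u₃ , V4-≡ v₀ v₁ (right u₂ (cong c2 eq)) (right u₃ (cong c3 eq))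
        where
        left : ∀ {x y} → y ≡ 0# → x + y ≡ 0# → x ≡ 0#
        left refl e = trans (sym (+-identityʳ _)) e
        right : ∀ {x y} → x ≡ 0# → x + y ≡ 0# → y ≡ 0#
        right refl e = trans (sym (+-identityˡ _)) e
      split : ∀ v → Ust s t v → Σ[ u ∈ V4 ] Σ[ w ∈ V4 ] (S u × T w × v ≡ u ⊕ w)
      split v (x , y , refl) = point₁ x , point₂ y ,
        (proj₂ (axis₁-X₂X₃ (point₁ x)) (refl , refl) , x , 0# , V4-≡ refl refl refl (sym (φ-0# t))) ,
        (proj₂ (axis₂-X₀X₁ (point₂ y)) (refl , refl) , 0# , y , V4-≡ refl (sym (φ-0# s)) refl refl) ,
        V4-≡ (sym (+-identityʳ _)) (sym (+-identityʳ _)) (sym (+-identityˡ _)) (sym (+-identityˡ _))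

    -- If c x = x' and c x^(q^r) = x'^(q^r) with x ≠ 0, then c^(q^r) = c. This applies to one of the
    -- two coordinate pairs of u, as u is nonzero.
    Ust-scattered : Admissible s → Admissible t → Scattered (Ust s t)
    Ust-scattered ad-s ad-t = scattered-intro H
      where
      scalar : ∀ {r} → Admissible r → ∀ c x x′ → c * x ≡ x′ → c * φ r x ≡ φ r x′ → x ≢ 0# → InFq c
      scalar {r} ad c x _ refl eq x≢0 = φ-fixed⇒inFq {r} ad c (*-cancelˡ (φ r x) (φ-≢0 r x≢0)
        (trans (*-comm _ _) (trans (sym (φ-homo-* r c x)) (trans (sym eq) (*-comm _ _)))))
      H : ∀ u c → Ust s t u → u ≢ 𝟎 → Ust s t (c · u) → InFq c
      H u c (x , y , refl) u≢𝟎 (x′ , y′ , eq) = decidable-stable (inFq? c) λ c∉ →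
        u≢𝟎 (V4-≡ (zero-x c∉) (trans (cong (φ s) (zero-x c∉)) (φ-0# s)) (zero-y c∉) (trans (cong (φ t) (zero-y c∉)) (φ-0# t)))
        where
        zero-x : ¬ InFq c → x ≡ 0#
        zero-x c∉ = decidable-stable (x ≟ 0#) (c∉ ∘ scalar {s} ad-s c x x′ (cong c0 eq) (trans (cong c1 eq) refl))
        zero-y : ¬ InFq c → y ≡ 0#
        zero-y c∉ = decidable-stable (y ≟ 0#) (c∉ ∘ scalar {t} ad-t c y y′ (cong c2 eq) (trans (cong c3 eq) refl))

  -- Comparing coefficients of q-polynomials

  δ : Fin n → Fin n → Carrier
  δ k i with i Finₚ.≟ k
  ... | yes _ = 1#
  ... | no _ = 0#

  δ-refl : ∀ k → δ k k ≡ 1#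
  δ-refl k with k Finₚ.≟ k
  ... | yes _ = refl
  ... | no k≢k = contradiction refl k≢k

  δ-≢ : ∀ {k i} → i ≢ k → δ k i ≡ 0#
  δ-≢ {k} {i} i≢k with i Finₚ.≟ k
  ... | yes i≡k = contradiction i≡k i≢k
  ... | no _ = refl

  L-δ : ∀ c k x → L (λ i → c * δ k i) x ≡ c * φ (toℕ k) x
  L-δ c k x = trans (L-single (λ i → c * δ k i) k (λ t t≢k → trans (cong (c *_) (δ-≢ t≢k)) (zeroʳ c)) x)
    (cong (_* φ (toℕ k) x) (trans (cong (c *_) (δ-refl k)) (*-identityʳ c)))

  L-cong : ∀ {a b : Fin n → Carrier} x → (∀ i → a i ≡ b i) → L a x ≡ L b x
  L-cong {a} {b} x eq = sum-cong {f = λ i → a i * φ (toℕ i) x} {λ i → b i * φ (toℕ i) x} λ i → cong (_* φ (toℕ i) x) (eq i)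

  L-+ : ∀ (a b : Fin n → Carrier) x → L (λ i → a i + b i) x ≡ L a x + L b x
  L-+ a b x = trans (L-cong x λ i → cong (a i +_) (sym (*-identityˡ (b i))))
    (trans (scal-affine a b (λ i → φ (toℕ i) x) 1#) (cong (L a x +_) (*-identityˡ (L b x))))

  -- In the difference of the two sides the exponents i and j occur once each, and all coefficients
  -- vanish by independence of the Frobenius maps.
  two-monomials : ∀ {i j k l : Fin n} {A B C D : Carrier} → i ≢ j → i ≢ k → i ≢ l → j ≢ k → j ≢ l →
    (∀ x → A * φ (toℕ i) x + B * φ (toℕ j) x ≡ C * φ (toℕ k) x + D * φ (toℕ l) x) → A ≡ 0# × B ≡ 0#
  two-monomials {i} {j} {k} {l} {A} {B} {C} {D} i≢j i≢k i≢l j≢k j≢l eq =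
    trans (sym (at-i)) (L-independent a ℕₚ.≤-refl L≡0 i) , trans (sym (at-j)) (L-independent a ℕₚ.≤-refl L≡0 j)
    where
    a : Fin n → Carrier
    a r = (A * δ i r + B * δ j r) + ((- C) * δ k r + (- D) * δ l r)
    L≡0 : ∀ x → L a x ≡ 0#
    L≡0 x = begin
      L a x
        ≡⟨ L-+ (λ r → A * δ i r + B * δ j r) (λ r → (- C) * δ k r + (- D) * δ l r) x ⟩
      L (λ r → A * δ i r + B * δ j r) x + L (λ r → (- C) * δ k r + (- D) * δ l r) x
        ≡⟨ cong₂ _+_ (L-+ (λ r → A * δ i r) (λ r → B * δ j r) x) (L-+ (λ r → (- C) * δ k r) (λ r → (- D) * δ l r) x) ⟩
      (L (λ r → A * δ i r) x + L (λ r → B * δ j r) x) + (L (λ r → (- C) * δ k r) x + L (λ r → (- D) * δ l r) x)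
        ≡⟨ cong₂ _+_ (cong₂ _+_ (L-δ A i x) (L-δ B j x)) (cong₂ _+_ (L-δ (- C) k x) (L-δ (- D) l x)) ⟩
      (A * φ (toℕ i) x + B * φ (toℕ j) x) + ((- C) * φ (toℕ k) x + (- D) * φ (toℕ l) x)
        ≡⟨ cong (_+ ((- C) * φ (toℕ k) x + (- D) * φ (toℕ l) x)) (eq x) ⟩
      (C * φ (toℕ k) x + D * φ (toℕ l) x) + ((- C) * φ (toℕ k) x + (- D) * φ (toℕ l) x)
        ≡⟨ solve 4 (λ C D y z → (C :* y :+ D :* z) :+ ((:- C) :* y :+ (:- D) :* z) := :0) refl C D (φ (toℕ k) x) (φ (toℕ l) x) ⟩
      0# ∎ where open ≡-Reasoning
    at-i : a i ≡ A
    at-i = trans (cong₂ _+_ (cong₂ (λ x y → A * x + B * y) (δ-refl i) (δ-≢ i≢j)) (cong₂ (λ x y → (- C) * x + (- D) * y) (δ-≢ i≢k) (δ-≢ i≢l)))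
      (solve 4 (λ A B C D → (A :* :1 :+ B :* :0) :+ ((:- C) :* :0 :+ (:- D) :* :0) := A) refl A B C D)
    at-j : a j ≡ B
    at-j = trans (cong₂ _+_ (cong₂ (λ x y → A * x + B * y) (δ-≢ (i≢j ∘ sym)) (δ-refl j)) (cong₂ (λ x y → (- C) * x + (- D) * y) (δ-≢ j≢k) (δ-≢ j≢l)))
      (solve 4 (λ A B C D → (A :* :0 :+ B :* :1) :+ ((:- C) :* :0 :+ (:- D) :* :0) := B) refl A B C D)

  -- A long line which misses both axes is the graph of an F-linear map ⟨ X₀ , X₁ ⟩ ↦ ⟨ X₂ , X₃ ⟩ with matrix (A B ; C D),
  -- and then (A x + B x^(q^s))^(q^t) = C x + D x^(q^s) for all x.
  module Graph {s t : ℕ} (ad-s : Admissible s) (ad-t : Admissible t) (s≢t : s ≢ t) (s≢n∸t : s ≢ n ℕ.∸ t)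
    (ℓ : Line) (long : Long (Ust s t) ℓ) (off₁ : ¬ Meet ℓ axis₁) (off₂ : ¬ Meet ℓ axis₂) where
    open Line ℓ

    private
      g : Carrier → V4
      g = proj₁ long
      g-on : ∀ x → onLine ℓ (g x)
      g-on = proj₁ (proj₂ (proj₂ long))
      g∈ : ∀ x → Ust s t (g x)
      g∈ = proj₂ (proj₂ (proj₂ long))

    determined : ∀ {u} → onLine ℓ u → c0 u ≡ 0# → c1 u ≡ 0# → u ≡ 𝟎
    determined {u} u∈ u₀ u₁ = decidable-stable (V4≟𝟎 u) λ u≢𝟎 → off₂ (u , u≢𝟎 , u∈ , proj₂ (axis₂-X₀X₁ u) (u₀ , u₁))

    onLine-⊖ : ∀ {u v} → onLine ℓ u → onLine ℓ v → onLine ℓ (u ⊖ v)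
    onLine-⊖ u∈ v∈ = onLine-⊕ ℓ u∈ (onLine-· ℓ (- 1#) v∈)

    private
      project : Carrier × Carrier → Carrier × Carrier
      project (x , y) = c0 (comb x a y b) , c1 (comb x a y b)

      project-injective : ∀ {p r} → project p ≡ project r → p ≡ r
      project-injective {x , y} {x′ , y′} eq =
        let p , r = coordinates-unique ℓ (⊖-≡𝟎 (determined (onLine-⊖ (x , y , refl) (x′ , y′ , refl))
                      (x≡y⇒x-1*y≡0 (cong proj₁ eq)) (x≡y⇒x-1*y≡0 (cong proj₂ eq))))
        in cong₂ _,_ p r

      lift : ∀ p → Σ[ z ∈ Carrier × Carrier ] project z ≡ p
      lift = injective⇒surjective card² card² project project-injective

      column : Carrier × Carrier → V4
      column p = comb (proj₁ (proj₁ (lift p))) a (proj₂ (proj₁ (lift p))) b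

      column-on : ∀ p → onLine ℓ (column p)
      column-on p = proj₁ (proj₁ (lift p)) , proj₂ (proj₁ (lift p)) , refl

      -- The points of the line above (1, 0) and (0, 1); their last two coordinates are the columns
      -- of the matrix.
      u w : V4
      u = column (1# , 0#)
      w = column (0# , 1#)

    A B C D : Carrier
    A = c2 u
    B = c2 w
    C = c3 u
    D = c3 w

    on-graph : ∀ {v} → onLine ℓ v → v ≡ comb (c0 v) u (c1 v) w
    on-graph {v} v∈ = ⊖-≡𝟎 (determined (onLine-⊖ v∈ (onLine-comb ℓ (c0 v) (c1 v) (column-on _) (column-on _)))
      (x≡y⇒x-1*y≡0 (trans (x*1+y*0 (c0 v) (c1 v)) (sym (cong₂ (λ x y → c0 v * x + c1 v * y) (cong proj₁ (proj₂ (lift (1# , 0#)))) (cong proj₁ (proj₂ (lift (0# , 1#))))))))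
      (x≡y⇒x-1*y≡0 (trans (x*0+y*1 (c0 v) (c1 v)) (sym (cong₂ (λ x y → c0 v * x + c1 v * y) (cong proj₂ (proj₂ (lift (1# , 0#)))) (cong proj₂ (proj₂ (lift (0# , 1#)))))))))

    c1≡ : ∀ {v} → Ust s t v → c1 v ≡ φ s (c0 v)
    c1≡ (x , y , refl) = refl

    c3≡ : ∀ {v} → Ust s t v → c3 v ≡ φ t (c2 v)
    c3≡ (x , y , refl) = refl

    -- A vector `g z` is determined by X₀, since X₁ = X₀^(q^s) and the line is a graph. Hence X₀ is
    -- injective in z and takes every value, so that the functional equation holds for all x.
    first-coordinate : ∀ x → Σ[ z ∈ Carrier ] c0 (g z) ≡ x
    first-coordinate = injective⇒surjective cardF cardF (λ z → c0 (g z)) λ {x} {y} eq →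
      proj₁ (proj₂ long) (trans (on-graph (g-on x)) (trans (cong₂ (λ p r → comb p u r w) eq
        (trans (c1≡ (g∈ x)) (trans (cong (φ s) eq) (sym (c1≡ (g∈ y)))))) (sym (on-graph (g-on y)))))

    second : ∀ z → c2 (g z) ≡ c0 (g z) * A + φ s (c0 (g z)) * B
    second z = trans (cong c2 (on-graph (g-on z))) (cong (λ p → c0 (g z) * A + p * B) (c1≡ (g∈ z)))

    third : ∀ z → c3 (g z) ≡ c0 (g z) * C + φ s (c0 (g z)) * D
    third z = trans (cong c3 (on-graph (g-on z))) (cong (λ p → c0 (g z) * C + p * D) (c1≡ (g∈ z)))

    functional : ∀ x → φ t (x * A + φ s x * B) ≡ x * C + φ s x * D
    functional x = subst (λ y → φ t (y * A + φ s y * B) ≡ y * C + φ s y * D) (proj₂ (first-coordinate x))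
      (trans (cong (φ t) (sym (second z))) (trans (sym (c3≡ (g∈ z))) (third z)))
      where z = proj₁ (first-coordinate x)

    private
      index : ∀ {r} → Admissible r → Fin n
      index (_ , r<n , _) = Fin.fromℕ< r<n
      toℕ-index : ∀ {r} (ad : Admissible r) → toℕ (index {r} ad) ≡ r
      toℕ-index (_ , r<n , _) = Finₚ.toℕ-fromℕ< r<n
      -- The exponents t and t + s come from the left side of the functional equation, 0 and s from
      -- the right side.
      i j k l : Fin n
      i = index {t} ad-t
      j = residue (t ℕ.+ s)
      k = Fin.fromℕ< (ℕ.>-nonZero⁻¹ n)
      l = index {s} ad-s
      toℕ-k : toℕ k ≡ 0
      toℕ-k = Finₚ.toℕ-fromℕ< (ℕ.>-nonZero⁻¹ n)
      t<n = proj₁ (proj₂ ad-t)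
      s<n = proj₁ (proj₂ ad-s)
      different : ∀ {x y : Fin n} → toℕ x ≢ toℕ y → x ≢ y
      different neq refl = neq refl
      s≢0 : s ≢ 0
      s≢0 = ℕₚ.m<n⇒n≢0 (proj₁ ad-s)
      t≢0 : t ≢ 0
      t≢0 = ℕₚ.m<n⇒n≢0 (proj₁ ad-t)
      0<n : 0 < n
      0<n = ℕ.>-nonZero⁻¹ n
      t≢t+s : t ≢ (t ℕ.+ s) % n
      t≢t+s eq = s≢0 (mod-unique t s<n 0<n (trans (sym eq) (trans (sym (m<n⇒m%n≡m t<n)) (cong (_% n) (sym (ℕₚ.+-identityʳ t))))))
      s≢t+s : s ≢ (t ℕ.+ s) % n
      s≢t+s eq = t≢0 (mod-unique s t<n 0<n (trans (cong (_% n) (ℕₚ.+-comm s t)) (trans (sym eq) (trans (sym (m<n⇒m%n≡m s<n)) (cong (_% n) (sym (ℕₚ.+-identityʳ s)))))))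
      -- This uses s ≠ n - t; the assumption s ≠ t separates i from l.
      0≢t+s : (t ℕ.+ s) % n ≢ 0
      0≢t+s eq = s≢n∸t (mod-unique t s<n (ℕₚ.∸-monoʳ-< (proj₁ ad-t) (ℕₚ.<⇒≤ t<n)) (trans eq (sym (trans (cong (_% n) (ℕₚ.m+[n∸m]≡n (ℕₚ.<⇒≤ t<n))) (n%n≡0 n)))))

      identity : ∀ x → φ t A * φ (toℕ i) x + φ t B * φ (toℕ j) x ≡ C * φ (toℕ k) x + D * φ (toℕ l) x
      identity x = begin
        φ t A * φ (toℕ i) x + φ t B * φ (toℕ j) x
          ≡⟨ cong₂ (λ y z → φ t A * y + φ t B * z) (cong (λ r → φ r x) (toℕ-index {t} ad-t)) (trans (φ-residue (t ℕ.+ s) x) (sym (φ-∘ t s x))) ⟩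
        φ t A * φ t x + φ t B * φ t (φ s x)
          ≡⟨ cong₂ _+_ (trans (*-comm _ _) (sym (φ-homo-* t x A))) (trans (*-comm _ _) (sym (φ-homo-* t (φ s x) B))) ⟩
        φ t (x * A) + φ t (φ s x * B)
          ≡⟨ sym (φ-homo-+ t (x * A) (φ s x * B)) ⟩
        φ t (x * A + φ s x * B)
          ≡⟨ functional x ⟩
        x * C + φ s x * D
          ≡⟨ cong₂ _+_ (trans (*-comm x C) (cong (C *_) (trans (sym (φ-zero x)) (cong (λ r → φ r x) (sym toℕ-k))))) (trans (*-comm (φ s x) D) (cong (λ r → D * φ r x) (sym (toℕ-index {s} ad-s)))) ⟩
        C * φ (toℕ k) x + D * φ (toℕ l) x ∎ where open ≡-Reasoning

      zeros : φ t A ≡ 0# × φ t B ≡ 0#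
      zeros = two-monomials {i} {j} {k} {l} {φ t A} {φ t B} {C} {D}
        (different (subst₂ _≢_ (sym (toℕ-index {t} ad-t)) (sym (toℕ-residue (t ℕ.+ s))) t≢t+s))
        (different (subst₂ _≢_ (sym (toℕ-index {t} ad-t)) (sym toℕ-k) t≢0))
        (different (subst₂ _≢_ (sym (toℕ-index {t} ad-t)) (sym (toℕ-index {s} ad-s)) (s≢t ∘ sym)))
        (different (subst₂ _≢_ (sym (toℕ-residue (t ℕ.+ s))) (sym toℕ-k) 0≢t+s))
        (different (subst₂ _≢_ (sym (toℕ-residue (t ℕ.+ s))) (sym (toℕ-index {s} ad-s)) (s≢t+s ∘ sym)))
        identity

    -- With A = B = 0 the point above X₀ = 1 has X₂ = 0, hence X₃ = X₂^(q^t) = 0, and lies on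
    -- `axis₁`.
    impossible : ⊥
    impossible = off₁ (g z , (λ gz≡𝟎 → 1≢0 (trans (sym z≡) (cong c0 gz≡𝟎))) , g-on z , proj₂ (axis₁-X₂X₃ (g z)) (c2≡0 , trans (c3≡ (g∈ z)) (trans (cong (φ t) c2≡0) (φ-0# t))))
      where
      z = proj₁ (first-coordinate 1#)
      z≡ : c0 (g z) ≡ 1#
      z≡ = proj₂ (first-coordinate 1#)
      A≡0 : A ≡ 0#
      A≡0 = pow-≡0 (q ℕ.^ t) (proj₁ zeros)
      B≡0 : B ≡ 0#
      B≡0 = pow-≡0 (q ℕ.^ t) (proj₂ zeros)
      c2≡0 : c2 (g z) ≡ 0#
      c2≡0 = trans (second z) (trans (cong₂ (λ x y → c0 (g z) * x + φ s (c0 (g z)) * y) A≡0 B≡0) (x*0+y*0 _ _))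

  module _ {s t : ℕ} (ad-s : Admissible s) (ad-t : Admissible t) (s≢t : s ≢ t) (s≢n∸t : s ≢ n ℕ.∸ t) where

    -- Equality with an axis is tested on the two base points. If both tests fail, the line is
    -- disjoint from both axes and the argument on graphs excludes it.
    long⇒axis : ∀ ℓ → LongLine (Ust s t) ℓ → IsLineX2X3 ℓ ⊎ IsLineX0X1 ℓ
    long⇒axis ℓ long = decide (onLine? axis₁ (Line.a ℓ)) (onLine? axis₁ (Line.b ℓ)) (onLine? axis₂ (Line.a ℓ)) (onLine? axis₂ (Line.b ℓ))
      where
      on-axis₁ : onLine axis₁ (Line.a ℓ) → onLine axis₁ (Line.b ℓ) → IsLineX2X3 ℓ
      on-axis₁ a∈ b∈ v = (λ v∈ → proj₁ (axis₁-X₂X₃ v) (proj₂ (same v) v∈)) , (λ e → proj₁ (same v) (proj₂ (axis₁-X₂X₃ v) e))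
        where same = two-points⇒SameLine axis₁ ℓ a∈ b∈
      on-axis₂ : onLine axis₂ (Line.a ℓ) → onLine axis₂ (Line.b ℓ) → IsLineX0X1 ℓ
      on-axis₂ a∈ b∈ v = (λ v∈ → proj₁ (axis₂-X₀X₁ v) (proj₂ (same v) v∈)) , (λ e → proj₁ (same v) (proj₂ (axis₂-X₀X₁ v) e))
        where same = two-points⇒SameLine axis₂ ℓ a∈ b∈
      neither : ¬ (onLine axis₁ (Line.a ℓ) × onLine axis₁ (Line.b ℓ)) → ¬ (onLine axis₂ (Line.a ℓ) × onLine axis₂ (Line.b ℓ)) → ⊥
      neither ¬₁ ¬₂ = Graph.impossible {s} {t} ad-s ad-t s≢t s≢n∸t ℓ ℓ-long
        (long-lines-disjoint sub scat {ℓ} {axis₁} ℓ-long (LongLine⇒Long {Ust s t} {axis₁} sub (axis₁-long s t)) (λ same → ¬₁ (proj₁ (same (Line.a ℓ)) (onLine-a ℓ) , proj₁ (same (Line.b ℓ)) (onLine-b ℓ))))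
        (long-lines-disjoint sub scat {ℓ} {axis₂} ℓ-long (LongLine⇒Long {Ust s t} {axis₂} sub (axis₂-long s t)) (λ same → ¬₂ (proj₁ (same (Line.a ℓ)) (onLine-a ℓ) , proj₁ (same (Line.b ℓ)) (onLine-b ℓ))))
        where
        sub = Ust-subspace s t
        scat = Ust-scattered s t ad-s ad-t
        ℓ-long : Long (Ust s t) ℓ
        ℓ-long = LongLine⇒Long {Ust s t} {ℓ} sub long
      decide : Dec (onLine axis₁ (Line.a ℓ)) → Dec (onLine axis₁ (Line.b ℓ)) → Dec (onLine axis₂ (Line.a ℓ)) → Dec (onLine axis₂ (Line.b ℓ)) → IsLineX2X3 ℓ ⊎ IsLineX0X1 ℓ
      decide (yes a∈) (yes b∈) _ _ = inj₁ (on-axis₁ a∈ b∈)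
      decide _ _ (yes a∈) (yes b∈) = inj₂ (on-axis₂ a∈ b∈)
      decide (no a∉) _ (no a∉′) _ = ⊥-elim (neither (a∉ ∘ proj₁) (a∉′ ∘ proj₁))
      decide (no a∉) _ (yes _) (no b∉′) = ⊥-elim (neither (a∉ ∘ proj₁) (b∉′ ∘ proj₂))
      decide (yes _) (no b∉) (no a∉′) _ = ⊥-elim (neither (b∉ ∘ proj₂) (a∉′ ∘ proj₁))
      decide (yes _) (no b∉) (yes _) (no b∉′) = ⊥-elim (neither (b∉ ∘ proj₂) (b∉′ ∘ proj₂))

    only-axes : OnlyLongLinesAreAxes (Ust s t)
    only-axes = (axis₁ , axis₁-X₂X₃ , axis₁-long s t) , (axis₂ , axis₂-X₀X₁ , axis₂-long s t) , long⇒axis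

  -- Pseudoregulus type

  -- The only units modulo 3 or 4 are 1 and -1.
  two-units : ∀ n s t → 3 ≤ n → n < 5 → 1 ≤ s × s < n × gcd s n ≡ 1 → 1 ≤ t × t < n × gcd t n ≡ 1 → s ≡ t ⊎ s ≡ n ℕ.∸ t
  two-units 1 _ _ (s≤s ())
  two-units 2 _ _ (s≤s (s≤s ()))
  two-units 3 1 1 _ _ _ _ = inj₁ refl
  two-units 3 1 2 _ _ _ _ = inj₂ refl
  two-units 3 2 1 _ _ _ _ = inj₂ refl
  two-units 3 2 2 _ _ _ _ = inj₁ refl
  two-units 3 (suc (suc (suc _))) _ _ _ (_ , s≤s (s≤s (s≤s ())) , _) _
  two-units 3 _ (suc (suc (suc _))) _ _ _ (_ , s≤s (s≤s (s≤s ())) , _)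
  two-units 4 1 1 _ _ _ _ = inj₁ refl
  two-units 4 1 3 _ _ _ _ = inj₂ refl
  two-units 4 3 1 _ _ _ _ = inj₂ refl
  two-units 4 3 3 _ _ _ _ = inj₁ refl
  two-units 4 2 _ _ _ (_ , _ , ()) _
  two-units 4 _ 2 _ _ _ (_ , _ , ())
  two-units 4 (suc (suc (suc (suc _)))) _ _ _ (_ , s≤s (s≤s (s≤s (s≤s ()))) , _) _
  two-units 4 _ (suc (suc (suc (suc _)))) _ _ _ (_ , s≤s (s≤s (s≤s (s≤s ()))) , _)
  two-units (suc (suc (suc (suc (suc _))))) _ _ _ (s≤s (s≤s (s≤s (s≤s (s≤s ()))))) _ _

  a≢𝟎 : ∀ ℓ → Line.a ℓ ≢ 𝟎
  a≢𝟎 ℓ eq = 1≢0 (proj₁ (Line.indep ℓ 1# 0# (trans (cong₂ _⊕_ (trans (·-identity _) eq) (·-zeroˡ _)) (⊕-identityˡ 𝟎))))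

  -- Otherwise every long line is one of two axes, so two of any three of the pairwise disjoint
  -- lines would coincide.
  pseudoregulus⇒ : ∀ {s t} → Admissible s → Admissible t → PseudoregulusType (Ust s t) → s ≡ t ⊎ s ≡ n ℕ.∸ t
  pseudoregulus⇒ {s} {t} ad-s ad-t (_ , _ , _ , lines , long , disjoint , _) with s ℕₚ.≟ t | s ℕₚ.≟ n ℕ.∸ t
  ... | yes eq | _ = inj₁ eq
  ... | no _ | yes eq = inj₂ eq
  ... | no s≢t | no s≢n∸t = ⊥-elim (clash (kind (# zero)) (kind (# (suc zero))) (kind (# (suc (suc zero)))))
    where
    3≤ : 3 ≤ suc Q
    3≤ = s≤s (ℕₚ.≤-trans 2≤q (subst (_≤ Q) (ℕₚ.*-identityʳ q) (ℕₚ.<⇒≤ (q^-< {1} (ℕₚ.≤-trans (s≤s (s≤s z≤n)) 3≤n)))))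
    # : Fin 3 → Fin (suc Q)
    # i = Fin.inject≤ i 3≤
    distinct : ∀ {i j} → i ≢ j → # i ≢ # j
    distinct i≢j eq = i≢j (Finₚ.inject≤-injective 3≤ 3≤ _ _ eq)
    kind : ∀ i → IsLineX2X3 (lines i) ⊎ IsLineX0X1 (lines i)
    kind i = long⇒axis {s} {t} ad-s ad-t s≢t s≢n∸t (lines i) (long i)
    same₁ : ∀ {i j} → i ≢ j → IsLineX2X3 (lines i) → IsLineX2X3 (lines j) → ⊥
    same₁ {i} {j} i≢j p r = disjoint i j i≢j (Line.a (lines i) , a≢𝟎 (lines i) , onLine-a (lines i) , proj₂ (r _) (proj₁ (p _) (onLine-a (lines i))))
    same₂ : ∀ {i j} → i ≢ j → IsLineX0X1 (lines i) → IsLineX0X1 (lines j) → ⊥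
    same₂ {i} {j} i≢j p r = disjoint i j i≢j (Line.a (lines i) , a≢𝟎 (lines i) , onLine-a (lines i) , proj₂ (r _) (proj₁ (p _) (onLine-a (lines i))))
    Kind : Fin (suc Q) → Set
    Kind i = IsLineX2X3 (lines i) ⊎ IsLineX0X1 (lines i)
    clash : Kind (# zero) → Kind (# (suc zero)) → Kind (# (suc (suc zero))) → ⊥
    clash (inj₁ a) (inj₁ b) _ = same₁ (distinct λ ()) a b
    clash (inj₁ a) _ (inj₁ c) = same₁ (distinct λ ()) a c
    clash _ (inj₁ b) (inj₁ c) = same₁ (distinct λ ()) b c
    clash (inj₂ a) (inj₂ b) _ = same₂ (distinct λ ()) a b
    clash (inj₂ a) _ (inj₂ c) = same₂ (distinct λ ()) a c
    clash _ (inj₂ b) (inj₂ c) = same₂ (distinct λ ()) b c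

  -- The pseudoregulus of U_{s,s} and its transversals

  module Regulus (s : ℕ) (ad : Admissible s) where

    -- The graph of (X₀, X₁) ↦ (b X₀, b^(q^s) X₁), which contains the vectors of U_{s,s} with y = x
    -- b.
    slope : Carrier → Line
    slope b = line ⟨ 1# , 0# , b , 0# ⟩ ⟨ 0# , 1# , 0# , φ s b ⟩ λ α β eq →
      trans (x*1+y*0 α β) (cong c0 eq) , trans (x*0+y*1 α β) (cong c1 eq)

    on-slope : ∀ {b v} → onLine (slope b) v → c2 v ≡ c0 v * b × c3 v ≡ c1 v * φ s b
    on-slope {b} (α , β , refl) =
      solve 3 (λ α β b → α :* b :+ β :* :0 := (α :* :1 :+ β :* :0) :* b) refl α β b ,
      solve 3 (λ α β b → α :* :0 :+ β :* b := (α :* :0 :+ β :* :1) :* b) refl α β (φ s b)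

    slope-on : ∀ {b v} → c2 v ≡ c0 v * b → c3 v ≡ c1 v * φ s b → onLine (slope b) v
    slope-on {b} {v} e₂ e₃ = c0 v , c1 v , V4-≡
      (x*1+y*0 (c0 v) (c1 v))
      (x*0+y*1 (c0 v) (c1 v))
      (trans e₂ (solve 3 (λ α β b → α :* b := α :* b :+ β :* :0) refl (c0 v) (c1 v) b))
      (trans e₃ (solve 3 (λ α β b → β :* b := α :* :0 :+ β :* b) refl (c0 v) (c1 v) (φ s b)))

    slope-long : ∀ b → LongLine (Ust s s) (slope b)
    slope-long b = image-dimension g-linear (λ x → cong c0)
      (λ x → slope-on refl (φ-homo-* s x b) , x , x * b , refl)
      λ { v (v∈ , x , y , refl) → x , V4-≡ refl refl (proj₁ (on-slope v∈)) (cong (φ s) (proj₁ (on-slope v∈))) }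
      where
      g : Carrier → V4
      g x = point s s x (x * b)
      g-linear : FqLinearMap g
      g-linear = (λ x y → V4-≡ refl (φ-homo-+ s x y) (distribʳ b x y) (trans (cong (φ s) (distribʳ b x y)) (φ-homo-+ s (x * b) (y * b)))) ,
        (λ c x c∈ → V4-≡ refl (trans (φ-homo-* s c x) (cong (_* φ s x) (inFq-φ c∈ s))) (*-assoc c x b)
          (trans (cong (φ s) (*-assoc c x b)) (trans (φ-homo-* s c (x * b)) (cong (_* φ s (x * b)) (inFq-φ c∈ s)))))

    -- The second axis plays the part of slope infinity; slope 0 is the first axis.
    spread : Fin (suc Q) → Line
    spread zero = axis₂
    spread (suc i) = slope (el i)

    spread-long : ∀ i → LongLine (Ust s s) (spread i)
    spread-long zero = axis₂-long s s
    spread-long (suc i) = slope-long (el i)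

    slope-axis₂ : ∀ {b v} → onLine (slope b) v → onLine axis₂ v → v ≡ 𝟎
    slope-axis₂ {b} {v} v∈ v∈′ =
      let e₀ , e₁ = proj₁ (axis₂-X₀X₁ v) v∈′
          e₂ , e₃ = on-slope {b} v∈
      in V4-≡ e₀ e₁ (trans e₂ (trans (cong (_* b) e₀) (zeroˡ b))) (trans e₃ (trans (cong (_* φ s b) e₁) (zeroˡ (φ s b))))

    slopes-disjoint : ∀ {b b′ v} → b ≢ b′ → onLine (slope b) v → onLine (slope b′) v → v ≡ 𝟎
    slopes-disjoint {b} {b′} {v} b≢b′ v∈ v∈′ =
      slope-axis₂ {b} v∈ (proj₂ (axis₂-X₀X₁ v) (vanish b≢b′ (trans (sym (proj₁ (on-slope {b} v∈))) (proj₁ (on-slope {b′} v∈′))) ,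
        vanish (b≢b′ ∘ φ-injective s) (trans (sym (proj₂ (on-slope {b} v∈))) (proj₂ (on-slope {b′} v∈′)))))
      where
      vanish : ∀ {x y z} → y ≢ z → x * y ≡ x * z → x ≡ 0#
      vanish {x} y≢z eq = decidable-stable (x ≟ 0#) λ x≢0 → y≢z (*-cancelˡ x x≢0 eq)

    spread-disjoint : ∀ i j → i ≢ j → ¬ Meet (spread i) (spread j)
    spread-disjoint zero zero i≢j _ = i≢j refl
    spread-disjoint zero (suc j) _ (v , v≢𝟎 , v∈ , v∈′) = v≢𝟎 (slope-axis₂ {el j} v∈′ v∈)
    spread-disjoint (suc i) zero _ (v , v≢𝟎 , v∈ , v∈′) = v≢𝟎 (slope-axis₂ {el i} v∈ v∈′)
    spread-disjoint (suc i) (suc j) i≢j (v , v≢𝟎 , v∈ , v∈′) = v≢𝟎 (slopes-disjoint {el i} {el j} (i≢j ∘ cong suc ∘ el-injective) v∈ v∈′)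

    -- All first base points of the slopes lie on `T₁`, all second ones on `T₂`.
    T₁ T₂ : Line
    T₁ = line ⟨ 1# , 0# , 0# , 0# ⟩ ⟨ 0# , 0# , 1# , 0# ⟩ λ α β eq →
      trans (x*1+y*0 α β) (cong c0 eq) ,
      trans (x*0+y*1 α β) (cong c2 eq)
    T₂ = line ⟨ 0# , 1# , 0# , 0# ⟩ ⟨ 0# , 0# , 0# , 1# ⟩ λ α β eq →
      trans (x*1+y*0 α β) (cong c1 eq) ,
      trans (x*0+y*1 α β) (cong c3 eq)

    on-T₁ : ∀ {v} → onLine T₁ v → c1 v ≡ 0# × c3 v ≡ 0#
    on-T₁ (α , β , refl) = x*0+y*0 α β , x*0+y*0 α β

    on-T₂ : ∀ {v} → onLine T₂ v → c0 v ≡ 0# × c2 v ≡ 0#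
    on-T₂ (α , β , refl) = x*0+y*0 α β , x*0+y*0 α β

    T₁-on : ∀ {v} → c1 v ≡ 0# → c3 v ≡ 0# → onLine T₁ v
    T₁-on {v} e₁ e₃ = c0 v , c2 v , V4-≡
      (x*1+y*0 (c0 v) (c2 v)) (trans e₁ (sym (x*0+y*0 _ _)))
      (x*0+y*1 (c0 v) (c2 v)) (trans e₃ (sym (x*0+y*0 _ _)))

    T₂-on : ∀ {v} → c0 v ≡ 0# → c2 v ≡ 0# → onLine T₂ v
    T₂-on {v} e₀ e₂ = c1 v , c3 v , V4-≡ (trans e₀ (sym (x*0+y*0 _ _)))
      (x*1+y*0 (c1 v) (c3 v)) (trans e₂ (sym (x*0+y*0 _ _)))
      (x*0+y*1 (c1 v) (c3 v))

    Good : Line → Set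
    Good T = DisjointFromL (Ust s s) T × (∀ i → Meet T (spread i))

    T₁-good : Good T₁
    T₁-good = (λ { v v∈ (x , y , refl) →
        let x≡0 = pow-≡0 (q ℕ.^ s) (proj₁ (on-T₁ v∈))
            y≡0 = pow-≡0 (q ℕ.^ s) (proj₂ (on-T₁ v∈))
        in V4-≡ x≡0 (proj₁ (on-T₁ v∈)) y≡0 (proj₂ (on-T₁ v∈)) }) ,
      λ { zero → ⟨ 0# , 0# , 1# , 0# ⟩ , 1≢0 ∘ cong c2 , T₁-on refl refl , proj₂ (axis₂-X₀X₁ _) (refl , refl)
        ; (suc i) → ⟨ 1# , 0# , el i , 0# ⟩ , 1≢0 ∘ cong c0 , T₁-on refl refl , onLine-a (slope (el i)) }

    T₂-good : Good T₂
    T₂-good = (λ { v v∈ (x , y , refl) →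
        let x≡0 = proj₁ (on-T₂ v∈)
            y≡0 = proj₂ (on-T₂ v∈)
        in V4-≡ x≡0 (trans (cong (φ s) x≡0) (φ-0# s)) y≡0 (trans (cong (φ s) y≡0) (φ-0# s)) }) ,
      λ { zero → ⟨ 0# , 0# , 0# , 1# ⟩ , 1≢0 ∘ cong c3 , T₂-on refl refl , proj₂ (axis₂-X₀X₁ _) (refl , refl)
        ; (suc i) → ⟨ 0# , 1# , 0# , φ s (el i) ⟩ , 1≢0 ∘ cong c1 , T₂-on refl refl , onLine-b (slope (el i)) }

    T₁≢T₂ : ¬ SameLine T₁ T₂
    T₁≢T₂ same = 1≢0 (proj₁ (on-T₂ (proj₁ (same _) (onLine-a T₁))))

    private
      combination-𝟎 : ∀ {P P′ α β} → α ≡ 0# → β ≡ 0# → comb α P β P′ ≡ 𝟎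
      combination-𝟎 {P} {P′} α≡0 β≡0 = trans (cong₂ (λ α β → comb α P β P′) α≡0 β≡0) (trans (cong₂ _⊕_ (·-zeroˡ P) (·-zeroˡ P′)) (⊕-identityˡ 𝟎))

    -- T meets the lines of slope 0 and ∞ in P and P′, hence equals PP′; meeting the slope b for all b leaves only T₁ and T₂.
    module Transversal (T : Line) (meets : ∀ b → Meet T (slope b)) (P P′ : V4) (P≢𝟎 : P ≢ 𝟎) (P′≢𝟎 : P′ ≢ 𝟎) (P∈ : onLine T P) (P′∈ : onLine T P′)
      (P-0 : c2 P ≡ 0# × c3 P ≡ 0#) (P′-0 : c0 P′ ≡ 0# × c1 P′ ≡ 0#) where

      z z′ y y′ : Carrier
      z = c0 P
      z′ = c1 P
      y = c2 P′
      y′ = c3 P′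

      ind : IndependentPair P P′
      ind α β eq =
        ·-≡𝟎⇒scalar P≢𝟎 (V4-≡ (left (proj₁ P′-0) (cong c0 eq)) (left (proj₂ P′-0) (cong c1 eq)) (zero-at (proj₁ P-0)) (zero-at (proj₂ P-0))) ,
        ·-≡𝟎⇒scalar P′≢𝟎 (V4-≡ (zero-at (proj₁ P′-0)) (zero-at (proj₂ P′-0)) (right (proj₁ P-0) (cong c2 eq)) (right (proj₂ P-0) (cong c3 eq)))
        where
        zero-at : ∀ {a x} → x ≡ 0# → a * x ≡ 0#
        zero-at {a} refl = zeroʳ a
        left : ∀ {a b x w} → w ≡ 0# → a * x + b * w ≡ 0# → a * x ≡ 0#
        left {a} {b} {x} refl e = trans (solve 3 (λ a b x → a :* x := a :* x :+ b :* :0) refl a b x) e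
        right : ∀ {a b x w} → x ≡ 0# → a * x + b * w ≡ 0# → b * w ≡ 0#
        right {a} {b} {w = w} refl e = trans (solve 3 (λ a b w → b :* w := a :* :0 :+ b :* w) refl a b w) e

      PP′ : Line
      PP′ = line P P′ ind

      same : SameLine T PP′
      same = two-points⇒SameLine T PP′ P∈ P′∈

      -- P lives in the first two coordinates and P′ in the last two, so the condition that α P + β
      -- P′ lies on the slope b splits into two equations, one for X₂ and one for X₃.
      intersection : ∀ b → Σ[ α ∈ Carrier ] Σ[ β ∈ Carrier ] (¬ (α ≡ 0# × β ≡ 0#) × β * y ≡ (α * z) * b × β * y′ ≡ (α * z′) * φ s b)
      intersection b =
        let v , v≢𝟎 , v∈T , v∈slope = meets b
            α , β , v≡ = proj₁ (same v) v∈T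
            e₂ , e₃ = on-slope {b} (subst (onLine (slope b)) v≡ v∈slope)
        in α , β , (λ (α≡0 , β≡0) → v≢𝟎 (trans v≡ (combination-𝟎 {P} {P′} α≡0 β≡0))) ,
           clean α β (proj₁ P-0) (proj₁ P′-0) e₂ , clean α β (proj₂ P-0) (proj₂ P′-0) e₃
        where
        clean : ∀ α β {x w k m b} → k ≡ 0# → m ≡ 0# → α * k + β * w ≡ (α * x + β * m) * b → β * w ≡ (α * x) * b
        clean α β {x} {w} {b = b} refl refl e = trans (solve 3 (λ α β w → β :* w := α :* :0 :+ β :* w) refl α β w)
          (trans e (solve 4 (λ α β x b → (α :* x :+ β :* :0) :* b := (α :* x) :* b) refl α β x b))

      α₁ β₁ : Carrier
      α₁ = proj₁ (intersection 1#)
      β₁ = proj₁ (proj₂ (intersection 1#))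

      nontrivial : ¬ (α₁ ≡ 0# × β₁ ≡ 0#)
      nontrivial = proj₁ (proj₂ (proj₂ (intersection 1#)))

      eq₁ : β₁ * y ≡ α₁ * z
      eq₁ = trans (proj₁ (proj₂ (proj₂ (proj₂ (intersection 1#))))) (*-identityʳ _)

      eq₁′ : β₁ * y′ ≡ α₁ * z′
      eq₁′ = trans (proj₂ (proj₂ (proj₂ (proj₂ (intersection 1#))))) (trans (cong ((α₁ * z′) *_) (φ-1# s)) (*-identityʳ _))

      zero-product : ∀ {x w} → x ≢ 0# → w * x ≡ 0# → w ≡ 0#
      zero-product x≢0 e = *-zero-product _ x≢0 (trans (*-comm _ _) e)

      β₁≢0 : (z ≢ 0# ⊎ z′ ≢ 0#) → β₁ ≢ 0#
      β₁≢0 (inj₁ z≢0) β≡0 = nontrivial (zero-product z≢0 (trans (sym eq₁) (trans (cong (_* y) β≡0) (zeroˡ y))) , β≡0)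
      β₁≢0 (inj₂ z′≢0) β≡0 = nontrivial (zero-product z′≢0 (trans (sym eq₁′) (trans (cong (_* y′) β≡0) (zeroˡ y′))) , β≡0)

      same-T₁ : z ≢ 0# → z′ ≡ 0# → SameLine T T₁
      same-T₁ z≢0 z′≡0 = SameLine-trans {T} {PP′} {T₁} same (SameLine-sym {T₁} {PP′} (two-points⇒SameLine T₁ PP′ (T₁-on z′≡0 (proj₂ P-0)) (T₁-on (proj₂ P′-0) y′≡0)))
        where
        y′≡0 : y′ ≡ 0#
        y′≡0 = *-zero-product β₁ (β₁≢0 (inj₁ z≢0)) (trans eq₁′ (trans (cong (α₁ *_) z′≡0) (zeroʳ α₁)))

      same-T₂ : z ≡ 0# → z′ ≢ 0# → SameLine T T₂
      same-T₂ z≡0 z′≢0 = SameLine-trans {T} {PP′} {T₂} same (SameLine-sym {T₂} {PP′} (two-points⇒SameLine T₂ PP′ (T₂-on z≡0 (proj₁ P-0)) (T₂-on (proj₁ P′-0) y≡0)))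
        where
        y≡0 : y ≡ 0#
        y≡0 = *-zero-product β₁ (β₁≢0 (inj₂ z′≢0)) (trans eq₁ (trans (cong (α₁ *_) z≡0) (zeroʳ α₁)))

      -- Comparing the slopes b and 1 eliminates the coordinates of P and P′: the two equations
      -- become (α β₁) c = α₁ β with c = b and with c = b^(q^s). Then b is fixed by `φ s`, which
      -- fails for b outside F_q.
      not-both : z ≢ 0# → z′ ≢ 0# → ⊥
      not-both z≢0 z′≢0 = b∉ (φ-fixed⇒inFq {s} ad b (*-cancelˡ (α * β₁) (*-≢0 α≢0 (β₁≢0 (inj₁ z≢0))) (trans (ratio y′≢0 eq₁′ eqb′) (sym (ratio y≢0 eq₁ eqb)))))
        where
        b = proj₁ outside-Fq
        b∉ = proj₂ outside-Fq
        α β : Carrier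
        α = proj₁ (intersection b)
        β = proj₁ (proj₂ (intersection b))
        eqb : β * y ≡ (α * z) * b
        eqb = proj₁ (proj₂ (proj₂ (proj₂ (intersection b))))
        eqb′ : β * y′ ≡ (α * z′) * φ s b
        eqb′ = proj₂ (proj₂ (proj₂ (proj₂ (intersection b))))
        α₁≢0 : α₁ ≢ 0#
        α₁≢0 α₁≡0 = P′≢𝟎 (V4-≡ (proj₁ P′-0) (proj₂ P′-0)
          (*-zero-product β₁ (β₁≢0 (inj₁ z≢0)) (trans eq₁ (trans (cong (_* z) α₁≡0) (zeroˡ z))))
          (*-zero-product β₁ (β₁≢0 (inj₁ z≢0)) (trans eq₁′ (trans (cong (_* z′) α₁≡0) (zeroˡ z′)))))
        y≢0 : y ≢ 0#
        y≢0 y≡0 = *-≢0 α₁≢0 z≢0 (trans (sym eq₁) (trans (cong (β₁ *_) y≡0) (zeroʳ β₁)))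
        y′≢0 : y′ ≢ 0#
        y′≢0 y′≡0 = *-≢0 α₁≢0 z′≢0 (trans (sym eq₁′) (trans (cong (β₁ *_) y′≡0) (zeroʳ β₁)))
        α≢0 : α ≢ 0#
        α≢0 α≡0 = proj₁ (proj₂ (proj₂ (intersection b))) (α≡0 , zero-product y≢0 (trans eqb (trans (cong (λ a → (a * z) * b) α≡0) (solve 2 (λ z b → (:0 :* z) :* b := :0) refl z b))))
        ratio : ∀ {y z c} → y ≢ 0# → β₁ * y ≡ α₁ * z → β * y ≡ (α * z) * c → (α * β₁) * c ≡ α₁ * β
        ratio {y} {z} {c} y≢0 e e′ = *-cancelˡ y y≢0 (begin
          y * ((α * β₁) * c) ≡⟨ solve 4 (λ y α β c → y :* ((α :* β) :* c) := (α :* c) :* (β :* y)) refl y α β₁ c ⟩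
          (α * c) * (β₁ * y) ≡⟨ cong ((α * c) *_) e ⟩
          (α * c) * (α₁ * z) ≡⟨ solve 4 (λ α c α₁ z → (α :* c) :* (α₁ :* z) := α₁ :* ((α :* z) :* c)) refl α c α₁ z ⟩
          α₁ * ((α * z) * c) ≡⟨ cong (α₁ *_) (sym e′) ⟩
          α₁ * (β * y) ≡⟨ solve 3 (λ α β y → α :* (β :* y) := y :* (α :* β)) refl α₁ β y ⟩
          y * (α₁ * β) ∎) where open ≡-Reasoning

      classify : SameLine T T₁ ⊎ SameLine T T₂
      classify = decide (z ≟ 0#) (z′ ≟ 0#)
        where
        decide : Dec (z ≡ 0#) → Dec (z′ ≡ 0#) → SameLine T T₁ ⊎ SameLine T T₂
        decide (yes e) (yes e′) = contradiction (V4-≡ e e′ (proj₁ P-0) (proj₂ P-0)) P≢𝟎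
        decide (yes e) (no e′) = inj₂ (same-T₂ e e′)
        decide (no e) (yes e′) = inj₁ (same-T₁ e e′)
        decide (no e) (no e′) = ⊥-elim (not-both e e′)

    transversals : ∀ T → Good T → SameLine T T₁ ⊎ SameLine T T₂
    transversals T (_ , meets) =
      let P , P≢𝟎 , P∈ , P∈slope = meets-slope 0#
          P′ , P′≢𝟎 , P′∈ , P′∈axis = meets zero
          e₂ , e₃ = on-slope {0#} P∈slope
      in Transversal.classify T meets-slope P P′ P≢𝟎 P′≢𝟎 P∈ P′∈ (trans e₂ (zeroʳ _) , trans e₃ (trans (cong (c1 P *_) (φ-0# s)) (zeroʳ _)))
           (proj₁ (axis₂-X₀X₁ P′) P′∈axis)
      where
      meets-slope : ∀ b → Meet T (slope b)
      meets-slope b = subst (λ b → Meet T (slope b)) (el-to b) (meets (suc (cardF.to b)))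

    pseudoregulus : PseudoregulusType (Ust s s)
    pseudoregulus = Ust-subspace s s , Ust-scattered s s ad ad , Ust-dimension s s , spread , spread-long , spread-disjoint ,
      T₁ , T₂ , T₁≢T₂ , T₁-good , T₂-good , transversals

  -- Exchange of the last two coordinates

  swap : V4 → V4
  swap v = ⟨ c0 v , c1 v , c3 v , c2 v ⟩

  swapLine : Line → Line
  swapLine ℓ = line (swap (Line.a ℓ)) (swap (Line.b ℓ)) λ α β eq → Line.indep ℓ α β (cong swap eq)

  on-swap : ∀ ℓ {v} → onLine ℓ v → onLine (swapLine ℓ) (swap v)
  on-swap ℓ (α , β , refl) = α , β , refl

  swap-on : ∀ ℓ {v} → onLine (swapLine ℓ) v → onLine ℓ (swap v)
  swap-on ℓ (α , β , refl) = α , β , refl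

  lincomb-swap : ∀ {k} (c : Fin k → Carrier) b → lincomb c (swap ∘ b) ≡ swap (lincomb c b)
  lincomb-swap {zero} c b = refl
  lincomb-swap {suc k} c b = cong ((c zero · swap (b zero)) ⊕_) (lincomb-swap (c ∘ suc) (b ∘ suc))

  swap-dimension : ∀ {S R : Pred} {k} → (∀ v → S v → R (swap v)) → (∀ v → R v → S (swap v)) → HasDimFq S k → HasDimFq R k
  swap-dimension to from (b , b∈ , ind , span) = swap ∘ b , (λ i → to _ (b∈ i)) ,
    (λ c c∈ eq → ind c c∈ (cong swap (trans (sym (lincomb-swap c b)) eq))) ,
    (λ v v∈ → let c , c∈ , v≡ = span (swap v) (from v v∈) in c , c∈ , trans (cong swap v≡) (sym (lincomb-swap c b)))

  swap-pseudoregulus : ∀ {U R : Pred} → (∀ v → U v → R (swap v)) → (∀ v → R v → U (swap v)) →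
    IsFqSubspace R → Scattered R → HasDimFq R (2 ℕ.* n) → PseudoregulusType U → PseudoregulusType R
  swap-pseudoregulus {U} {R} to from sub scat dim (_ , _ , _ , lines , long , disjoint , T₁ , T₂ , T₁≢T₂ , good₁ , good₂ , only) =
    sub , scat , dim , swapLine ∘ lines ,
    (λ i → swap-dimension (λ v (v∈ , u) → on-swap (lines i) v∈ , to v u) (λ v (v∈ , u) → swap-on (lines i) v∈ , from v u) (long i)) ,
    (λ i j i≢j (v , v≢𝟎 , v∈ , v∈′) → disjoint i j i≢j (swap v , v≢𝟎 ∘ cong swap , swap-on (lines i) v∈ , swap-on (lines j) v∈′)) ,
    swapLine T₁ , swapLine T₂ ,
    (λ same → T₁≢T₂ λ v → (λ v∈ → swap-on T₂ (proj₁ (same (swap v)) (on-swap T₁ v∈))) , (λ v∈ → swap-on T₁ (proj₂ (same (swap v)) (on-swap T₂ v∈)))) ,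
    good T₁ good₁ , good T₂ good₂ ,
    λ T (off , meets) → [ inj₁ ∘ back T T₁ , inj₂ ∘ back T T₂ ]′ (only (swapLine T)
      ((λ v v∈ u → cong swap (off (swap v) (swap-on T v∈) (to v u))) ,
       (λ i → let v , v≢𝟎 , v∈ , v∈′ = meets i in swap v , v≢𝟎 ∘ cong swap , on-swap T v∈ , swap-on (lines i) v∈′)))
    where
    good : ∀ T → DisjointFromL U T × (∀ i → Meet T (lines i)) → DisjointFromL R (swapLine T) × (∀ i → Meet (swapLine T) (swapLine (lines i)))
    good T (off , meets) = (λ v v∈ u → cong swap (off (swap v) (swap-on T v∈) (from v u))) ,
      (λ i → let v , v≢𝟎 , v∈ , v∈′ = meets i in swap v , v≢𝟎 ∘ cong swap , on-swap T v∈ , on-swap (lines i) v∈′)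
    back : ∀ T T′ → SameLine (swapLine T) T′ → SameLine T (swapLine T′)
    back T T′ same v = (λ v∈ → on-swap T′ (proj₁ (same (swap v)) (on-swap T v∈))) ,
      (λ v∈ → swap-on T (proj₂ (same (swap v)) (swap-on T′ v∈)))

  -- If s + t = n and z = y^(q^s), then y = z^(q^t); so exchanging X₂ and X₃ carries U_{s,s} onto
  -- U_{s,t}.
  pseudoregulus⇐ : ∀ {s t} → Admissible s → Admissible t → s ≡ t ⊎ s ≡ n ℕ.∸ t → PseudoregulusType (Ust s t)
  pseudoregulus⇐ {s} ad-s ad-t (inj₁ refl) = Regulus.pseudoregulus s ad-s
  pseudoregulus⇐ {s} {t} ad-s ad-t (inj₂ s≡n∸t) = swap-pseudoregulus {Ust s s} {Ust s t} to from
    (Ust-subspace s t) (Ust-scattered s t ad-s ad-t) (Ust-dimension s t) (Regulus.pseudoregulus s ad-s)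
    where
    t+s≡n : t ℕ.+ s ≡ n
    t+s≡n = trans (cong (t ℕ.+_) s≡n∸t) (ℕₚ.m+[n∸m]≡n (ℕₚ.<⇒≤ (proj₁ (proj₂ ad-t))))
    φtφs : ∀ x → φ t (φ s x) ≡ x
    φtφs x = trans (φ-∘ t s x) (trans (cong (λ i → φ i x) t+s≡n) (φ-n x))
    φsφt : ∀ x → φ s (φ t x) ≡ x
    φsφt x = trans (φ-∘ s t x) (trans (cong (λ i → φ i x) (trans (ℕₚ.+-comm s t) t+s≡n)) (φ-n x))
    to : ∀ v → Ust s s v → Ust s t (swap v)
    to v (x , y , refl) = x , φ s y , V4-≡ refl refl refl (sym (φtφs y))
    from : ∀ v → Ust s t v → Ust s s (swap v)
    from v (x , y , refl) = x , φ t y , V4-≡ refl refl refl (sym (φsφt y))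

  -- Lines of pseudoregulus type

  -- From any one value, repeated successors reach every residue modulo n.
  successor-closed : ∀ {m} → 1 ≤ m → (vs : Fin m → Fin n) → (∀ l → Σ[ l′ ∈ Fin m ] vs l′ ≡ residue (suc (toℕ (vs l)))) → n ≤ m
  successor-closed {m} 1≤m vs closed = Finₚ.injective⇒≤ {f = λ i → proj₁ (hit i)} λ {i} {j} eq → trans (sym (proj₂ (hit i))) (trans (cong vs eq) (proj₂ (hit j)))
    where
    first = Fin.fromℕ< 1≤m
    v₀ = toℕ (vs first)
    orbit : ∀ k → Σ[ l ∈ Fin m ] toℕ (vs l) ≡ (v₀ ℕ.+ k) % n
    orbit zero = first , sym (trans (cong (_% n) (ℕₚ.+-identityʳ v₀)) (m<n⇒m%n≡m (Finₚ.toℕ<n (vs first))))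
    orbit (suc k) =
      let l , eq = orbit k
          l′ , eq′ = closed l
      in l′ , trans (cong toℕ eq′) (trans (toℕ-residue (suc (toℕ (vs l)))) (trans (cong (λ j → suc j % n) eq)
           (trans (cong (_% n) (ℕₚ.+-comm 1 ((v₀ ℕ.+ k) % n))) (trans (mod-+ˡ 1 (m%n%n≡m%n (v₀ ℕ.+ k) n))
             (cong (_% n) (trans (ℕₚ.+-comm (v₀ ℕ.+ k) 1) (sym (ℕₚ.+-suc v₀ k))))))))
    hit : ∀ i → Σ[ l ∈ Fin m ] vs l ≡ i
    -- Adding n - v₀ + i to v₀ gives n + i, which is i modulo n.
    hit i = let l , eq = orbit (n ℕ.∸ v₀ ℕ.+ toℕ i) in l , Finₚ.toℕ-injective (trans eq (begin
      (v₀ ℕ.+ (n ℕ.∸ v₀ ℕ.+ toℕ i)) % n ≡⟨ cong (_% n) (sym (ℕₚ.+-assoc v₀ (n ℕ.∸ v₀) (toℕ i))) ⟩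
      ((v₀ ℕ.+ (n ℕ.∸ v₀)) ℕ.+ toℕ i) % n ≡⟨ cong (λ j → (j ℕ.+ toℕ i) % n) (ℕₚ.m+[n∸m]≡n (ℕₚ.<⇒≤ (Finₚ.toℕ<n (vs first)))) ⟩
      (n ℕ.+ toℕ i) % n ≡⟨ trans (cong (_% n) (ℕₚ.+-comm n (toℕ i))) ([m+n]%n≡m%n (toℕ i) n) ⟩
      toℕ i % n ≡⟨ m<n⇒m%n≡m (Finₚ.toℕ<n i) ⟩
      toℕ i ∎))
      where open ≡-Reasoning

  -- Automorphisms with fixed field F_q

  module Automorphism (τ : Carrier → Carrier) (aut : IsAutFixingFq τ) where
    private
      τ-inj : ∀ {x y} → τ x ≡ τ y → x ≡ y
      τ-inj = proj₁ (proj₂ (proj₂ (proj₁ aut)))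

    τ-* : ∀ x y → τ (x * y) ≡ τ x * τ y
    τ-* = proj₁ (proj₂ (proj₁ aut))

    τ-fixed : ∀ x → τ x ≡ x → InFq x
    τ-fixed x = proj₁ (proj₂ aut x)

    τ-0 : τ 0# ≡ 0#
    τ-0 = proj₂ (proj₂ aut 0#) inFq-0

    τ-1 : τ 1# ≡ 1#
    τ-1 = proj₂ (proj₂ aut 1#) inFq-1

    τ-Fq : ∀ {x} → InFq x → τ x ≡ x
    τ-Fq {x} = proj₂ (proj₂ aut x)

    τ-≢0 : ∀ {x} → x ≢ 0# → τ x ≢ 0#
    τ-≢0 x≢0 eq = x≢0 (τ-inj (trans eq (sym τ-0)))

    τ-pow : ∀ x k → τ (pow x k) ≡ pow (τ x) k
    τ-pow x zero = τ-1
    τ-pow x (suc k) = trans (τ-* x (pow x k)) (cong (τ x *_) (τ-pow x k))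

    τ-∏ : ∀ {k} (f : Fin k → Carrier) → τ (∏ f) ≡ ∏ (τ ∘ f)
    τ-∏ {zero} f = τ-1
    τ-∏ {suc k} f = trans (τ-* (f zero) (∏ (f ∘ suc))) (cong (τ (f zero) *_) (τ-∏ (f ∘ suc)))

    module _ {m} (1≤m : 1 ≤ m) (m<n : m < n) (vs : Fin m → Fin n) (vs-injective : ∀ {k l} → vs k ≡ vs l → k ≡ l) where
      h χ : Carrier → Carrier
      h x = ∏ (λ l → φ (toℕ (vs l)) x)
      χ x = h (τ x * inv x)

      h-* : ∀ x y → h (x * y) ≡ h x * h y
      h-* x y = trans (∏-cong {f = λ l → φ (toℕ (vs l)) (x * y)} {λ l → φ (toℕ (vs l)) x * φ (toℕ (vs l)) y} (λ l → φ-homo-* (toℕ (vs l)) x y))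
        (∏-* (λ l → φ (toℕ (vs l)) x) (λ l → φ (toℕ (vs l)) y))

      h-0 : h 0# ≡ 0#
      h-0 = ∏-has-0 (λ l → φ (toℕ (vs l)) 0#) (Fin.fromℕ< 1≤m) (φ-0# (toℕ (vs (Fin.fromℕ< 1≤m))))

      τ-h : ∀ x → τ (h x) ≡ h (τ x)
      τ-h x = trans (τ-∏ (λ l → φ (toℕ (vs l)) x)) (∏-cong {f = λ l → τ (φ (toℕ (vs l)) x)} {λ l → φ (toℕ (vs l)) (τ x)} λ l → τ-pow x (q ℕ.^ toℕ (vs l)))

      χ-character : Character χ
      χ-character = trans (cong h (trans (cong (_* inv 0#) τ-0) (zeroˡ (inv 0#)))) h-0 , λ x y x≢0 y≢0 → begin
        h (τ (x * y) * inv (x * y)) ≡⟨ cong h (cong₂ _*_ (τ-* x y) (inv-* x≢0 y≢0)) ⟩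
        h ((τ x * τ y) * (inv x * inv y)) ≡⟨ cong h (solve 4 (λ a b c d → (a :* b) :* (c :* d) := (a :* c) :* (b :* d)) refl (τ x) (τ y) (inv x) (inv y)) ⟩
        h ((τ x * inv x) * (τ y * inv y)) ≡⟨ h-* (τ x * inv x) (τ y * inv y) ⟩
        χ x * χ y ∎
        where open ≡-Reasoning

      -- If χ were trivial, then h x would be fixed by τ, hence lie in F_q, so that the exponents of h would be stable under i ↦ i + 1.
      ∑χ≡0 : ∑F χ ≡ 0#
      ∑χ≡0 = decidable-stable (∑F χ ≟ 0#) λ ∑≢0 → ℕₚ.<⇒≱ m<n (successor-closed 1≤m vs
        (monomial-support refl (λ l → residue (suc (toℕ (vs l)))) vs vs-injective 1≤m (shifted ∑≢0)))
        where
        open ≡-Reasoning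
        h-fixed : ∑F χ ≢ 0# → ∀ x → x ≢ 0# → τ (h x) ≡ h x
        h-fixed ∑≢0 x x≢0 = begin
          τ (h x) ≡⟨ τ-h x ⟩
          h (τ x) ≡⟨ cong h (sym (trans (*-assoc (τ x) (inv x) x) (trans (cong (τ x *_) (inv-l x x≢0)) (*-identityʳ (τ x))))) ⟩
          h ((τ x * inv x) * x) ≡⟨ h-* (τ x * inv x) x ⟩
          χ x * h x ≡⟨ cong (_* h x) (character-sum χ-character ∑≢0 x x≢0) ⟩
          1# * h x ≡⟨ *-identityˡ (h x) ⟩
          h x ∎
        h-inFq : ∑F χ ≢ 0# → ∀ x → InFq (h x)
        h-inFq ∑≢0 x = decidable-stable (inFq? (h x)) λ ∉ → ∉ (τ-fixed (h x) (h-fixed ∑≢0 x λ x≡0 → ∉ (subst InFq (sym (trans (cong h x≡0) h-0)) inFq-0)))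
        φ1-∏ : ∀ {k} (f : Fin k → Carrier) → φ 1 (∏ f) ≡ ∏ (φ 1 ∘ f)
        φ1-∏ {zero} f = φ-1# 1
        φ1-∏ {suc k} f = trans (φ-homo-* 1 (f zero) (∏ (f ∘ suc))) (cong (φ 1 (f zero) *_) (φ1-∏ (f ∘ suc)))
        shifted : ∑F χ ≢ 0# → ∀ x → ∏ (λ l → φ (toℕ (residue (suc (toℕ (vs l))))) x) ≡ h x
        shifted ∑≢0 x = begin
          ∏ (λ l → φ (toℕ (residue (suc (toℕ (vs l))))) x)
            ≡⟨ ∏-cong {f = λ l → φ (toℕ (residue (suc (toℕ (vs l))))) x} {λ l → φ 1 (φ (toℕ (vs l)) x)}
                 (λ l → trans (φ-residue (suc (toℕ (vs l))) x) (sym (φ-∘ 1 (toℕ (vs l)) x))) ⟩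
          ∏ (λ l → φ 1 (φ (toℕ (vs l)) x)) ≡⟨ sym (φ1-∏ (λ l → φ (toℕ (vs l)) x)) ⟩
          φ 1 (h x) ≡⟨ φ1≡pow (h x) ⟩
          pow (h x) q ≡⟨ h-inFq ∑≢0 x ⟩
          h x ∎

    ψ : Carrier → Carrier
    ψ x = τ x * inv x

    τ≡ψ* : ∀ {x} → x ≢ 0# → τ x ≡ ψ x * x
    τ≡ψ* {x} x≢0 = sym (trans (*-assoc (τ x) (inv x) x) (trans (cong (τ x *_) (inv-l x x≢0)) (*-identityʳ (τ x))))

    ψ-≢0 : ∀ {x} → x ≢ 0# → ψ x ≢ 0#
    ψ-≢0 x≢0 = *-≢0 (τ-≢0 x≢0) (inv-≢0 x≢0)

    opaque
      -- One nonzero solution of τ x = z x, chosen from z alone; evaluated at `ψ x` it is therefore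
      -- the same for all F_q-multiples of x.
      representative : Carrier → Carrier
      representative z with ∃? cardF (λ x → ¬? (x ≟ 0#) ×-dec (τ x ≟ (z * x)))
      ... | yes (x , _) = x
      ... | no _ = 1#

      representative-spec : ∀ x → x ≢ 0# → representative (ψ x) ≢ 0# × τ (representative (ψ x)) ≡ ψ x * representative (ψ x)
      representative-spec x x≢0 with ∃? cardF (λ y → ¬? (y ≟ 0#) ×-dec (τ y ≟ (ψ x * y)))
      ... | yes (_ , spec) = spec
      ... | no none = contradiction (x , x≢0 , τ≡ψ* x≢0) none

    -- Both elements have the same quotient ψ, so τ fixes their ratio.
    representative-multiple : ∀ x → x ≢ 0# → Σ[ c ∈ Carrier ] (InFq c × x ≡ c * representative (ψ x))
    representative-multiple x x≢0 = c , τ-fixed c (*-cancelˡ (ψ x * r) (*-≢0 (ψ-≢0 x≢0) r≢0) (begin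
        (ψ x * r) * τ c ≡⟨ cong (_* τ c) (sym τr) ⟩
        τ r * τ c ≡⟨ trans (*-comm (τ r) (τ c)) (sym (τ-* c r)) ⟩
        τ (c * r) ≡⟨ cong τ (sym x≡) ⟩
        τ x ≡⟨ τ≡ψ* x≢0 ⟩
        ψ x * x ≡⟨ cong (ψ x *_) x≡ ⟩
        ψ x * (c * r) ≡⟨ solve 3 (λ p c r → p :* (c :* r) := (p :* r) :* c) refl (ψ x) c r ⟩
        (ψ x * r) * c ∎)) , x≡
      where
      open ≡-Reasoning
      r = representative (ψ x)
      r≢0 = proj₁ (representative-spec x x≢0)
      τr = proj₂ (representative-spec x x≢0)
      c = x * inv r
      x≡ : x ≡ c * r
      x≡ = sym (trans (*-assoc x (inv r) r) (trans (cong (x *_) (inv-l r r≢0)) (*-identityʳ x)))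

  NormalForm : Pred → Line → Set
  NormalForm U r = Σ[ w ∈ V4 ] Σ[ v ∈ V4 ] Σ[ ind ∈ IndependentPair w v ] Σ[ s ∈ ℕ ]
    (Admissible s × (∀ x → U (comb x w (φ s x) v)) × SameLine r (line w v ind))

  -- K λ is chosen with K λ · (λ w + ρ τ(λ) v) ∈ U and constant on the cosets of F_q^*, so that λ ↦ K λ · λ is injective.
  -- Hence U ∩ r is the graph of an F_q-linear f with f (K λ · λ) / (K λ · λ) = ρ τ(λ) / λ.
  module PseudoLine {U : Pred} (sub : IsFqSubspace U) (r : Line) (w v : V4) (ρ : Carrier) (τ : Carrier → Carrier)
    (w∈ : onLine r w) (v∈ : onLine r v) (ind : IndependentPair w v) (ρ≢0 : ρ ≢ 0#) (aut : IsAutFixingFq τ)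
    (points : ∀ x → onLine r x → x ≢ 𝟎 → Iff (PointOf U x)
       (Σ[ λ' ∈ Carrier ] (λ' ≢ 0# × Σ[ μ ∈ Carrier ] x ≡ μ · ((λ' · w) ⊕ ((ρ * τ λ') · v))))) where
    open Automorphism τ aut

    ℓ : Line
    ℓ = line w v ind

    private
      comb-on : ∀ x y → onLine r (comb x w y v)
      comb-on x y = onLine-comb r x y w∈ v∈

      comb-≢𝟎 : ∀ {x y} → x ≢ 0# → comb x w y v ≢ 𝟎
      comb-≢𝟎 x≢0 eq = x≢0 (proj₁ (ind _ _ eq))

      vector : Carrier → V4
      vector x = comb x w (ρ * τ x) v

      -- It is only the point spanned by `vector x` that is known to belong to the linear set; the
      -- vector itself need not lie in U.
      scaled : ∀ x → x ≢ 0# → Σ[ k ∈ Carrier ] (k ≢ 0# × U (k · vector x))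
      scaled x x≢0 =
        let u , u∈ , u≢𝟎 , a , x≡au = proj₂ (points (vector x) (comb-on _ _) (comb-≢𝟎 x≢0)) (x , x≢0 , 1# , sym (·-identity (vector x)))
            a≢0 : a ≢ 0#
            a≢0 a≡0 = comb-≢𝟎 x≢0 (trans x≡au (trans (cong (_· u) a≡0) (·-zeroˡ u)))
        in inv a , inv-≢0 a≢0 , subst U (sym (trans (cong (inv a ·_) x≡au) (·-cancel a≢0))) u∈

    opaque
      scale : Carrier → Carrier
      scale x with x ≟ 0#
      ... | yes _ = 1#
      ... | no x≢0 = proj₁ (scaled x x≢0)

      scale-spec : ∀ x → x ≢ 0# → scale x ≢ 0# × U (scale x · vector x)
      scale-spec x x≢0 with x ≟ 0#
      ... | yes x≡0 = contradiction x≡0 x≢0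
      ... | no x≢0′ = proj₂ (scaled x x≢0′)

    K G H : Carrier → Carrier
    K x = scale (representative (ψ x))
    G x = K x * x
    H x = K x * (ρ * τ x)

    K-≢0 : ∀ {x} → x ≢ 0# → K x ≢ 0#
    K-≢0 {x} x≢0 = proj₁ (scale-spec _ (proj₁ (representative-spec x x≢0)))

    -- If x = c y with c in F_q and y its representative, the vector in question is c times
    -- `scale y · vector y`.
    member≢0 : ∀ x → x ≢ 0# → U (comb (G x) w (H x) v)
    member≢0 x x≢0 =
      let c , c∈ , x≡ = representative-multiple x x≢0
          k = scale y
          c·∈ : U (c · (k · vector y))
          c·∈ = proj₂ (proj₂ sub) c _ c∈ (proj₂ (scale-spec y (proj₁ (representative-spec x x≢0))))
      in subst U (trans (cong (c ·_) (·-comb k y (ρ * τ y) w v)) (trans (·-comb c (k * y) (k * (ρ * τ y)) w v)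
           (cong₂ (λ a b → comb a w b v)
             (trans (solve 3 (λ c k y → c :* (k :* y) := k :* (c :* y)) refl c k y) (cong (k *_) (sym x≡)))
             (trans (solve 4 (λ c k ρ t → c :* (k :* (ρ :* t)) := k :* (ρ :* (c :* t))) refl c k ρ (τ y))
               (cong (λ t → k * (ρ * t)) (trans (cong (_* τ y) (sym (τ-Fq c∈))) (trans (sym (τ-* c y)) (cong τ (sym x≡)))))))))
         c·∈
      where y = representative (ψ x)

    G-0 : G 0# ≡ 0#
    G-0 = zeroʳ (K 0#)

    H-0 : H 0# ≡ 0#
    H-0 = trans (cong (λ t → K 0# * (ρ * t)) τ-0) (solve 2 (λ k ρ → k :* (ρ :* :0) := :0) refl (K 0#) ρ)

    member : ∀ x → U (comb (G x) w (H x) v)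
    member x = decide (x ≟ 0#)
      where
      decide : Dec (x ≡ 0#) → U (comb (G x) w (H x) v)
      decide (no x≢0) = member≢0 x x≢0
      decide (yes x≡0) = subst U (sym (trans (cong (λ x → comb (G x) w (H x) v) x≡0)
        (trans (cong₂ (λ a b → comb a w b v) G-0 H-0) (trans (cong₂ _⊕_ (·-zeroˡ w) (·-zeroˡ v)) (⊕-identityˡ 𝟎))))) (proj₁ sub)

    -- The parametrisation has λ ≠ 0 and so never yields the point ⟨v⟩. This is what makes U ∩ r a
    -- graph over the w-coordinate.
    off-v : ∀ y → U (comb 0# w y v) → y ≡ 0#
    off-v y y∈ = decidable-stable (y ≟ 0#) λ y≢0 → nonzero y≢0
      where
      nonzero : ¬ (y ≢ 0#)
      nonzero y≢0 =
        let u = comb 0# w y v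
            u≢𝟎 : u ≢ 𝟎
            u≢𝟎 eq = y≢0 (proj₂ (ind _ _ eq))
            x , x≢0 , μ , u≡ = proj₁ (points u (comb-on 0# y) u≢𝟎) (u , y∈ , u≢𝟎 , 1# , sym (·-identity u))
            0≡ , y≡ = coordinates-unique ℓ (trans u≡ (·-comb μ x (ρ * τ x) w v))
            μ≡0 = *-zero-product x x≢0 (trans (*-comm x μ) (sym 0≡))
        in y≢0 (trans y≡ (trans (cong (_* (ρ * τ x)) μ≡0) (zeroˡ _)))

    graph-unique : ∀ {x y z} → U (comb x w y v) → U (comb x w z v) → y ≡ z
    graph-unique {x} {y} {z} y∈ z∈ = x-1*y≡0⇒x≡y (off-v _ (subst U (trans (comb-⊖ x y x z w v) (cong (λ a → comb a w (y + (- 1#) * z) v) (x≡y⇒x-1*y≡0 refl))) (subspace-⊖ sub y∈ z∈)))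

    G-≢0 : ∀ {x} → x ≢ 0# → G x ≢ 0#
    G-≢0 x≢0 = *-≢0 (K-≢0 x≢0) x≢0

    -- On the graph, G x = G y gives H x = H y. As H x = ρ (G x) (ψ x) for x ≠ 0, also ψ x = ψ y,
    -- hence K x = K y, and this nonzero factor cancels.
    G-injective : ∀ {x y} → G x ≡ G y → x ≡ y
    G-injective {x} {y} eq = decide (x ≟ 0#) (y ≟ 0#)
      where
      H≡ : H x ≡ H y
      H≡ = graph-unique (member x) (subst (λ z → U (comb z w (H y) v)) (sym eq) (member y))
      decide : Dec (x ≡ 0#) → Dec (y ≡ 0#) → x ≡ y
      decide (yes x≡0) (yes y≡0) = trans x≡0 (sym y≡0)
      decide (yes x≡0) (no y≢0) = contradiction (trans (sym eq) (trans (cong G x≡0) G-0)) (G-≢0 y≢0)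
      decide (no x≢0) (yes y≡0) = contradiction (trans eq (trans (cong G y≡0) G-0)) (G-≢0 x≢0)
      decide (no x≢0) (no y≢0) = *-cancelˡ (K x) (K-≢0 x≢0) (trans eq (cong (λ z → scale (representative z) * y) (sym ψ≡)))
        where
        H-ψ : ∀ {x} → x ≢ 0# → H x ≡ (ρ * G x) * ψ x
        H-ψ {x} x≢0 = trans (cong (λ t → K x * (ρ * t)) (τ≡ψ* x≢0)) (solve 4 (λ k ρ p x → k :* (ρ :* (p :* x)) := (ρ :* (k :* x)) :* p) refl (K x) ρ (ψ x) x)
        ψ≡ : ψ x ≡ ψ y
        ψ≡ = *-cancelˡ (ρ * G x) (*-≢0 ρ≢0 (G-≢0 x≢0)) (trans (sym (H-ψ x≢0)) (trans H≡ (trans (H-ψ y≢0) (cong (λ g → (ρ * g) * ψ y) (sym eq)))))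

    opaque
      preimage : ∀ x → Σ[ y ∈ Carrier ] G y ≡ x
      preimage = injective⇒surjective cardF cardF G G-injective

    f : Carrier → Carrier
    f x = H (proj₁ (preimage x))

    on-graph : ∀ x → U (comb x w (f x) v)
    on-graph x = subst (λ z → U (comb z w (f x) v)) (proj₂ (preimage x)) (member (proj₁ (preimage x)))

    f-G : ∀ x → f (G x) ≡ H x
    f-G x = cong H (G-injective (proj₂ (preimage (G x))))

    -- Neither `G` nor `H` is known to be additive. Linearity comes from U: sums and F_q-multiples
    -- of vectors of the graph lie in U, hence on the graph.
    f-linear : FqLinear f
    f-linear =
      (λ x y → graph-unique (on-graph (x + y)) (subst U (V4-≡ (e _ _) (e _ _) (e _ _) (e _ _)) (proj₁ (proj₂ sub) _ _ (on-graph x) (on-graph y)))) ,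
      (λ c x c∈ → graph-unique (on-graph (c * x)) (subst U (·-comb c x (f x) w v) (proj₂ (proj₂ sub) c _ c∈ (on-graph x))))
      where
      e : ∀ {x y fx fy} a b → (x * a + fx * b) + (y * a + fy * b) ≡ (x + y) * a + (fx + fy) * b
      e {x} {y} {fx} {fy} a b = solve 6 (λ x y fx fy a b → (x :* a :+ fx :* b) :+ (y :* a :+ fy :* b) := (x :+ y) :* a :+ (fx :+ fy) :* b) refl x y fx fy a b

    f-nonzero : Σ[ x ∈ Carrier ] f x ≢ 0#
    f-nonzero = G 1# , λ eq → *-≢0 (K-≢0 1≢0) (*-≢0 ρ≢0 (τ-≢0 1≢0)) (trans (sym (f-G 1#)) eq)

    -- Reindexing by the permutation `G` turns f(x)/x into ρ ψ(x), and the monomial `h₀` is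
    -- multiplicative.
    f-vanishing : Vanishing f
    f-vanishing m 1≤m m<n vs inj = begin
      ∑F (λ x → h₀ (f x * inv x)) ≡⟨ sym (∑F-reindex (λ x → h₀ (f x * inv x)) G G-injective) ⟩
      ∑F (λ x → h₀ (f (G x) * inv (G x))) ≡⟨ ∑F-cong term ⟩
      ∑F (λ x → h₀ ρ * h₀ (ψ x)) ≡⟨ sym (ΣF.*-distribˡ-sum (h₀ ρ) (λ i → h₀ (ψ (el i)))) ⟩
      h₀ ρ * ∑F (λ x → h₀ (ψ x)) ≡⟨ cong (h₀ ρ *_) (∑χ≡0 1≤m m<n vs inj) ⟩
      h₀ ρ * 0# ≡⟨ zeroʳ (h₀ ρ) ⟩
      0# ∎
      where
      open ≡-Reasoning
      h₀ : Carrier → Carrier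
      h₀ = h 1≤m m<n vs inj
      h₀-* : ∀ x y → h₀ (x * y) ≡ h₀ x * h₀ y
      h₀-* = h-* 1≤m m<n vs inj
      h₀-0 : h₀ 0# ≡ 0#
      h₀-0 = h-0 1≤m m<n vs inj
      quotient : ∀ x → x ≢ 0# → f (G x) * inv (G x) ≡ ρ * ψ x
      quotient x x≢0 = *-cancelˡ (G x) (G-≢0 x≢0) (begin
        G x * (f (G x) * inv (G x)) ≡⟨ solve 3 (λ g f i → g :* (f :* i) := f :* (g :* i)) refl (G x) (f (G x)) (inv (G x)) ⟩
        f (G x) * (G x * inv (G x)) ≡⟨ trans (cong (f (G x) *_) (inv-r (G x) (G-≢0 x≢0))) (*-identityʳ (f (G x))) ⟩
        f (G x) ≡⟨ f-G x ⟩
        K x * (ρ * τ x) ≡⟨ cong (λ t → K x * (ρ * t)) (τ≡ψ* x≢0) ⟩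
        K x * (ρ * (ψ x * x)) ≡⟨ solve 4 (λ k ρ p x → k :* (ρ :* (p :* x)) := (k :* x) :* (ρ :* p)) refl (K x) ρ (ψ x) x ⟩
        G x * (ρ * ψ x) ∎)
      term : ∀ x → h₀ (f (G x) * inv (G x)) ≡ h₀ ρ * h₀ (ψ x)
      term x = decide (x ≟ 0#)
        where
        decide : Dec (x ≡ 0#) → h₀ (f (G x) * inv (G x)) ≡ h₀ ρ * h₀ (ψ x)
        decide (no x≢0) = trans (cong h₀ (quotient x x≢0)) (h₀-* ρ (ψ x))
        decide (yes x≡0) = trans (trans (cong h₀ (trans (cong (_* inv (G x)) (trans (f-G x) (trans (cong H x≡0) H-0))) (zeroˡ _))) h₀-0)
          (sym (trans (cong (h₀ ρ *_) (trans (cong h₀ (trans (cong (_* inv x) (trans (cong τ x≡0) τ-0)) (zeroˡ _))) h₀-0)) (zeroʳ _)))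

    normalForm : NormalForm U r
    normalForm =
      let c , s , ad , c≢0 , f≡ = vanishing⇒monomial f-linear f-vanishing f-nonzero
          ind′ : IndependentPair w (c · v)
          ind′ α β eq =
            let α≡0 , βc≡0 = ind α (β * c) (trans (cong ((α · w) ⊕_) (·-assoc β c v)) eq)
            in α≡0 , *-zero-product c c≢0 (trans (*-comm c β) βc≡0)
      -- The coefficient c is absorbed into the second base vector.
      in w , c · v , ind′ , s , ad ,
         (λ x → subst U (cong ((x · w) ⊕_) (trans (cong (_· v) (trans (f≡ x) (*-comm c (φ s x)))) (·-assoc (φ s x) c v))) (on-graph x)) ,
         two-points⇒SameLine r (line w (c · v) ind′) w∈ (onLine-· r c v∈)

  pseudoregulusLine⇒normalForm : ∀ {U} → IsFqSubspace U → ∀ r → PseudoregulusLine U r → NormalForm U r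
  pseudoregulusLine⇒normalForm sub r (w , v , ρ , τ , w∈ , v∈ , ind , ρ≢0 , aut , points) =
    PseudoLine.normalForm sub r w v ρ τ w∈ v∈ ind ρ≢0 aut points

  -- The classification

  -- A nontrivial relation would express a nonzero vector of one line as a vector of the other.
  frame-injective : ∀ {w v w′ v′} (ind : IndependentPair w v) (ind′ : IndependentPair w′ v′) → ¬ Meet (line w v ind) (line w′ v′ ind′) →
    ∀ α β γ δ → comb α w β v ⊕ comb γ w′ δ v′ ≡ 𝟎 → (α ≡ 0# × β ≡ 0#) × (γ ≡ 0# × δ ≡ 0#)
  frame-injective {w} {v} {w′} {v′} ind ind′ disjoint α β γ δ eq = ind α β u≡𝟎 ,
    ind′ γ δ (trans (sym (⊕-identityˡ _)) (trans (cong (_⊕ comb γ w′ δ v′) (sym u≡𝟎)) eq))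
    where
    negate : ∀ {a b} → a + b ≡ 0# → a ≡ (- 1#) * b
    negate {a} {b} e = x-y≡0⇒x≡y (trans (solve 2 (λ a b → a :+ (:- (:-1 :* b)) := a :+ b) refl a b) e)
    u≡ : comb α w β v ≡ (- 1#) · comb γ w′ δ v′
    u≡ = V4-≡ (negate (cong c0 eq)) (negate (cong c1 eq)) (negate (cong c2 eq)) (negate (cong c3 eq))
    u≡𝟎 : comb α w β v ≡ 𝟎
    u≡𝟎 = decidable-stable (V4≟𝟎 _) λ u≢𝟎 → disjoint (comb α w β v , u≢𝟎 , (α , β , refl) ,
      subst (onLine (line w′ v′ ind′)) (sym u≡) (onLine-· (line w′ v′ ind′) (- 1#) (γ , δ , refl)))

  cardV4 : V4 ↔ Fin (Q ℕ.* (Q ℕ.* (Q ℕ.* Q)))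
  cardV4 = ×-card cardF (×-card cardF card²) ↔-∘ mk↔ₛ′ (λ v → c0 v , c1 v , c2 v , c3 v) (λ (a , b , c , d) → ⟨ a , b , c , d ⟩) (λ _ → refl) (λ _ → refl)

  normalForm⇒Long : ∀ {U : Pred} {w v} (ind : IndependentPair w v) s → (∀ x → U (comb x w (φ s x) v)) → Long U (line w v ind)
  normalForm⇒Long {U} {w} {v} ind s w∈ = (λ x → comb x w (φ s x) v) , (λ eq → proj₁ (coordinates-unique (line w v ind) eq)) , (λ x → x , φ s x , refl) , w∈

  module Equivalence {U : Pred} (sub : IsFqSubspace U) (dim : HasDimFq U (2 ℕ.* n)) {s t : ℕ} (w v w′ v′ : V4)
    (ind : IndependentPair w v) (ind′ : IndependentPair w′ v′) (disjoint : ¬ Meet (line w v ind) (line w′ v′ ind′))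
    (w∈ : ∀ x → U (comb x w (φ s x) v)) (w′∈ : ∀ x → U (comb x w′ (φ t x) v′)) where

    Θ : V4 → V4
    Θ p = comb (c0 p) w (c1 p) v ⊕ comb (c2 p) w′ (c3 p) v′

    Θ-⊕ : ∀ p r → Θ (p ⊕ r) ≡ Θ p ⊕ Θ r
    Θ-⊕ p r = V4-≡ (e (c0 w) (c0 v) (c0 w′) (c0 v′)) (e (c1 w) (c1 v) (c1 w′) (c1 v′)) (e (c2 w) (c2 v) (c2 w′) (c2 v′)) (e (c3 w) (c3 v) (c3 w′) (c3 v′))
      where
      e : ∀ w v w′ v′ → ((c0 p + c0 r) * w + (c1 p + c1 r) * v) + ((c2 p + c2 r) * w′ + (c3 p + c3 r) * v′)
                      ≡ ((c0 p * w + c1 p * v) + (c2 p * w′ + c3 p * v′)) + ((c0 r * w + c1 r * v) + (c2 r * w′ + c3 r * v′))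
      e w v w′ v′ = solve 12 (λ a b c d a′ b′ c′ d′ w v w′ v′ →
        ((a :+ a′) :* w :+ (b :+ b′) :* v) :+ ((c :+ c′) :* w′ :+ (d :+ d′) :* v′)
        := ((a :* w :+ b :* v) :+ (c :* w′ :+ d :* v′)) :+ ((a′ :* w :+ b′ :* v) :+ (c′ :* w′ :+ d′ :* v′))) refl
        (c0 p) (c1 p) (c2 p) (c3 p) (c0 r) (c1 r) (c2 r) (c3 r) w v w′ v′

    Θ-· : ∀ a p → Θ (a · p) ≡ a · Θ p
    Θ-· a p = sym (trans (·-⊕ a _ _) (cong₂ _⊕_ (·-comb a (c0 p) (c1 p) w v) (·-comb a (c2 p) (c3 p) w′ v′)))

    Θ-injective : ∀ p r → Θ p ≡ Θ r → p ≡ r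
    Θ-injective p r eq =
      let (e₀ , e₁) , (e₂ , e₃) = frame-injective ind ind′ disjoint _ _ _ _
            (trans (Θ-⊕ p ((- 1#) · r)) (trans (cong (Θ p ⊕_) (Θ-· (- 1#) r)) (trans (cong (_⊖ Θ r) eq) (⊖-self (Θ r)))))
      in ⊖-≡𝟎 (V4-≡ e₀ e₁ e₂ e₃)

    Θ-𝟎 : Θ 𝟎 ≡ 𝟎
    Θ-𝟎 = trans (cong Θ (sym (·-zeroˡ 𝟎))) (trans (Θ-· 0# 𝟎) (·-zeroˡ (Θ 𝟎)))

    Θ-into : ∀ {p} → Ust s t p → U (Θ p)
    Θ-into (x , y , refl) = proj₁ (proj₂ sub) _ _ (w∈ x) (w′∈ y)

    private
      coefficients : ∀ u → U u → Σ[ c ∈ (Fin (2 ℕ.* n) → Carrier) ] ((∀ i → InFq (c i)) × u ≡ lincomb c (proj₁ dim))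
      coefficients = proj₂ (proj₂ (proj₂ dim))

      index : ∀ u → U u → Vec (Fin q) (2 ℕ.* n)
      index u u∈ = fqs-index (proj₁ (coefficients u u∈)) (proj₁ (proj₂ (coefficients u u∈)))

      lincomb-index : ∀ u u∈ → lincomb (fqs (index u u∈)) (proj₁ dim) ≡ u
      lincomb-index u u∈ = trans (lincomb-cong {b = proj₁ dim} (fqs-fqs-index (proj₁ (coefficients u u∈)) (proj₁ (proj₂ (coefficients u u∈)))) (λ _ → refl))
        (sym (proj₂ (proj₂ (coefficients u u∈))))

      index-determines : ∀ {u u′} u∈ u′∈ → index u u∈ ≡ index u′ u′∈ → u ≡ u′
      index-determines {u} {u′} u∈ u′∈ eq = trans (sym (lincomb-index u u∈)) (trans (cong (λ i → lincomb (fqs i) (proj₁ dim)) eq) (lincomb-index u′ u′∈))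

      member : ∀ x y → U (Θ (point s t x y))
      member x y = Θ-into (x , y , refl)

      pair-index : Carrier × Carrier → Vec (Fin q) (2 ℕ.* n)
      pair-index (x , y) = index (Θ (point s t x y)) (member x y)

      pair-index-injective : ∀ {a b} → pair-index a ≡ pair-index b → a ≡ b
      pair-index-injective {x , y} {x′ , y′} eq =
        let p≡ = Θ-injective (point s t x y) (point s t x′ y′) (index-determines (member x y) (member x′ y′) eq)
        in cong₂ _,_ (cong c0 p≡) (cong c2 p≡)

      card-pairs : (Carrier × Carrier) ↔ Fin (q ℕ.^ (2 ℕ.* n))
      card-pairs = subst (λ k → (Carrier × Carrier) ↔ Fin k)
        (trans (sym (ℕₚ.^-distribˡ-+-* q n n)) (cong (λ k → q ℕ.^ (n ℕ.+ k)) (sym (ℕₚ.+-identityʳ n)))) card²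

    opaque
      -- `Θ` maps U_{s,t} injectively into U, and both have q^(2n) elements; they are compared
      -- through coordinate vectors over F_q.
      Θ-onto : ∀ u → U u → Σ[ p ∈ V4 ] (Ust s t p × Θ p ≡ u)
      Θ-onto u u∈ =
        let (x , y) , eq = injective⇒surjective card-pairs (card-fqs (2 ℕ.* n)) pair-index pair-index-injective (index u u∈)
        in point s t x y , (x , y , refl) , index-determines (member x y) u∈ eq

      Θ⁻¹ : V4 → V4
      Θ⁻¹ u = proj₁ (injective⇒surjective cardV4 cardV4 Θ (λ {p} {r} → Θ-injective p r) u)

      Θ-Θ⁻¹ : ∀ u → Θ (Θ⁻¹ u) ≡ u
      Θ-Θ⁻¹ u = proj₂ (injective⇒surjective cardV4 cardV4 Θ (λ {p} {r} → Θ-injective p r) u)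

    Θ⁻¹-Θ : ∀ p → Θ⁻¹ (Θ p) ≡ p
    Θ⁻¹-Θ p = Θ-injective (Θ⁻¹ (Θ p)) p (Θ-Θ⁻¹ (Θ p))

    collineation : IsCollineation Θ⁻¹
    -- The equivalence is linear, with the identity as companion automorphism.
    collineation = (λ x → x) , ((λ _ _ → refl) , (λ _ _ → refl) , (λ eq → eq) , (λ x → x , λ eq → eq)) ,
      (λ u u′ → Θ-injective (Θ⁻¹ (u ⊕ u′)) (Θ⁻¹ u ⊕ Θ⁻¹ u′) (trans (Θ-Θ⁻¹ (u ⊕ u′)) (sym (trans (Θ-⊕ (Θ⁻¹ u) (Θ⁻¹ u′)) (cong₂ _⊕_ (Θ-Θ⁻¹ u) (Θ-Θ⁻¹ u′)))))) ,
      (λ a u → Θ-injective (Θ⁻¹ (a · u)) (a · Θ⁻¹ u) (trans (Θ-Θ⁻¹ (a · u)) (sym (trans (Θ-· a (Θ⁻¹ u)) (cong (a ·_) (Θ-Θ⁻¹ u)))))) ,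
      (λ {u} {u′} eq → trans (sym (Θ-Θ⁻¹ u)) (trans (cong Θ eq) (Θ-Θ⁻¹ u′))) ,
      (λ p → Θ p , λ eq → trans (cong Θ⁻¹ eq) (Θ⁻¹-Θ p))

    projEquiv : ProjEquiv U (Ust s t)
    projEquiv = Θ⁻¹ , collineation , λ u _ → to , from
      where
      to : ∀ {u} → PointOf U u → PointOf (Ust s t) (Θ⁻¹ u)
      to (b , b∈ , b≢𝟎 , a , refl) =
        let p , p∈ , Θp≡b = Θ-onto b b∈
        in p , p∈ , (λ p≡𝟎 → b≢𝟎 (trans (sym Θp≡b) (trans (cong Θ p≡𝟎) Θ-𝟎))) , a ,
           Θ-injective (Θ⁻¹ (a · b)) (a · p) (trans (Θ-Θ⁻¹ (a · b)) (sym (trans (Θ-· a p) (cong (a ·_) Θp≡b))))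
      from : ∀ {u} → PointOf (Ust s t) (Θ⁻¹ u) → PointOf U u
      from {u} (p , p∈ , p≢𝟎 , a , eq) = Θ p , Θ-into p∈ , (λ Θp≡𝟎 → p≢𝟎 (Θ-injective p 𝟎 (trans Θp≡𝟎 (sym Θ-𝟎)))) , a ,
        trans (sym (Θ-Θ⁻¹ u)) (trans (cong Θ eq) (Θ-· a p))

  classification : ∀ U → MaxScattered U → HasTwoPseudoregulusLines U → Σ[ s ∈ ℕ ] Σ[ t ∈ ℕ ] (Admissible s × Admissible t × ProjEquiv U (Ust s t))
  classification U (sub , dim , scat) (r₁ , r₂ , r₁≢r₂ , pr₁ , pr₂) =
    let w , v , ind , s , ad-s , w∈ , same₁ = pseudoregulusLine⇒normalForm sub r₁ pr₁
        w′ , v′ , ind′ , t , ad-t , w′∈ , same₂ = pseudoregulusLine⇒normalForm sub r₂ pr₂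
        ℓ₁ = line w v ind
        ℓ₂ = line w′ v′ ind′
        disjoint : ¬ Meet ℓ₁ ℓ₂
        disjoint = long-lines-disjoint {U} sub scat {ℓ₁} {ℓ₂} (normalForm⇒Long {U} ind s w∈) (normalForm⇒Long {U} ind′ t w′∈)
          (λ same → r₁≢r₂ (SameLine-trans {r₁} {ℓ₁} {r₂} same₁ (SameLine-trans {ℓ₁} {ℓ₂} {r₂} same (SameLine-sym {r₂} {ℓ₂} same₂))))
    in s , t , ad-s , ad-t , Equivalence.projEquiv sub dim {s} {t} w v w′ v′ ind ind′ disjoint w∈ w′∈

  5≤n : ∀ {s t} → Admissible s → Admissible t → s ≢ t → s ≢ n ℕ.∸ t → 5 ≤ n
  5≤n {s} {t} ad-s ad-t s≢t s≢n∸t = ℕₚ.≮⇒≥ λ n<5 → [ s≢t , s≢n∸t ]′ (two-units n s t 3≤n n<5 ad-s ad-t)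

theorem2p6 : (q n : ℕ) → IsPrimePower q → 3 ≤ n →
    (F : FiniteField) → length (FiniteField.elems F) ≡ q ^ n →
    let open Geometry F q n in
    (∀ U → MaxScattered U → HasTwoPseudoregulusLines U →
    Σ[ s ∈ ℕ ] Σ[ t ∈ ℕ ] (Admissible s × Admissible t × ProjEquiv U (Ust s t)))
    × (∀ s t → Admissible s → Admissible t →
    Iff (PseudoregulusType (Ust s t)) (s ≡ t ⊎ s ≡ n ∸ t))
    × (∀ s t → Admissible s → Admissible t → s ≢ t → s ≢ n ∸ t →
    (5 ≤ n × OnlyLongLinesAreAxes (Ust s t)))
theorem2p6 q n isPrimePower 3≤n F |F| =
  classification ,
  (λ s t ad-s ad-t → pseudoregulus⇒ ad-s ad-t , pseudoregulus⇐ ad-s ad-t) ,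
  (λ s t ad-s ad-t s≢t s≢n∸t → 5≤n ad-s ad-t s≢t s≢n∸t , only-axes ad-s ad-t s≢t s≢n∸t)
  where open Theory F q n isPrimePower 3≤n |F|
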